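{- For every $0<\delta<1$ and $\varepsilon>0$, and for all sufficiently large $n$ (in terms of $\delta$ and $\varepsilon$), every $n$-vertex triangle-free graph with minimum degree at least $\frac{1}{3}n-n^{1-\delta}$ has chromatic number at most $$10^{391}+1+\left\lceil\frac{(1+\varepsilon)(1-\delta)}{\delta}\right\rceil.$$
   Context: All graphs are finite and simple. -}

module Defs where

open import Level using (0ℓ)
open import Data.Nat as ℕ using (ℕ; zero; suc)
open import Data.Integer as ℤ using (ℤ; +_; -[1+_])
open import Data.Rational as ℚ using (ℚ; 0ℚ; 1ℚ; ↥_; ↧ₙ_; _⊓_; _⊔_)
open import Data.Fin using (Fin)
open import Data.Fin.Properties using (any?; all?)
open import Data.List using (length; filter; allFin; map; upTo)
open import Data.List.Extrema.Nat using (min)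
open import Data.Vec using (Vec; []; _∷_; lookup)
open import Data.Product using (∃; ∃-syntax; _×_; _,_)
open import Data.Sum using (_⊎_)
open import Relation.Nullary using (¬_; Dec)
open import Relation.Nullary.Decidable using (map′; _→-dec_; ¬?)
open import Relation.Unary using (Pred; Decidable; _⊆_)
open import Relation.Binary using (Rel; Symmetric; Irreflexive)
import Relation.Binary as B
open import Relation.Binary.PropositionalEquality using (_≡_; _≢_)
open import Function using (_⇔_)
import Data.Fin as Fin
import Algebra.Definitions.RawSemiring as RawSemiringDefs

open RawSemiringDefs ℚ.+-*-rawSemiring using () renaming (_^_ to _^ℚ_)

------------------------------------------------------------------------
-- Real numbers, as two-sided Dedekind cuts of the rationals.
--
-- Cut is the bare pair of predicates "q < x" (Lower) and "x < q" (Upper);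
-- IsReal holds the cut axioms.  The operations are given on bare pairs
-- and have their usual meaning when the arguments satisfy IsReal.

record Cut : Set₁ where
  field
    Lower : Pred ℚ 0ℓ
    Upper : Pred ℚ 0ℓ

open Cut public

record IsReal (x : Cut) : Set where
  field
    lower-inhabited : ∃ (Lower x)
    upper-inhabited : ∃ (Upper x)
    lower-rounded   : ∀ q → Lower x q ⇔ (∃[ r ] q ℚ.< r × Lower x r)
    upper-rounded   : ∀ q → Upper x q ⇔ (∃[ r ] r ℚ.< q × Upper x r)
    disjoint        : ∀ q → ¬ (Lower x q × Upper x q)
    located         : ∀ q r → q ℚ.< r → Lower x q ⊎ Upper x r

infix  4 _<ᴿ_ _≤ᴿ_
infixl 6 _+ᴿ_ _-ᴿ_
infixl 7 _*ᴿ_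
infix  8 -ᴿ_
infixr 8 _^ᴿ_

_<ᴿ_ : Rel Cut 0ℓ
x <ᴿ y = ∃[ q ] Upper x q × Lower y q

_≤ᴿ_ : Rel Cut 0ℓ
x ≤ᴿ y = Lower x ⊆ Lower y

fromℚ : ℚ → Cut
fromℚ p = record { Lower = λ q → q ℚ.< p ; Upper = λ q → p ℚ.< q }

fromℤ : ℤ → Cut
fromℤ z = fromℚ (z ℚ./ 1)

0ᴿ 1ᴿ : Cut
0ᴿ = fromℚ 0ℚ
1ᴿ = fromℚ 1ℚ

_+ᴿ_ : Cut → Cut → Cut
x +ᴿ y = record
  { Lower = λ q → ∃[ a ] ∃[ b ] Lower x a × Lower y b × q ≡ a ℚ.+ b
  ; Upper = λ q → ∃[ a ] ∃[ b ] Upper x a × Upper y b × q ≡ a ℚ.+ b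
  }

-ᴿ_ : Cut → Cut
-ᴿ x = record { Lower = λ q → Upper x (ℚ.- q) ; Upper = λ q → Lower x (ℚ.- q) }

_-ᴿ_ : Cut → Cut → Cut
x -ᴿ y = x +ᴿ (-ᴿ y)

-- Interval multiplication: if a < x < b and c < y < d, then x y lies between
-- the least and the greatest of the four products of endpoints.
_*ᴿ_ : Cut → Cut → Cut
x *ᴿ y = record
  { Lower = λ q → ∃[ a ] ∃[ b ] ∃[ c ] ∃[ d ] Box a b c d ×
      q ℚ.< ((a ℚ.* c) ⊓ (a ℚ.* d)) ⊓ ((b ℚ.* c) ⊓ (b ℚ.* d))
  ; Upper = λ q → ∃[ a ] ∃[ b ] ∃[ c ] ∃[ d ] Box a b c d ×
      ((a ℚ.* c) ⊔ (a ℚ.* d)) ⊔ ((b ℚ.* c) ⊔ (b ℚ.* d)) ℚ.< q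
  }
  where
  Box : ℚ → ℚ → ℚ → ℚ → Set
  Box a b c d = Lower x a × Upper x b × Lower y c × Upper y d

-- Division by a positive real: for y > 0, q < 1/y iff q r < 1 for some
-- rational r > y, and 1/y < q iff 1 < q r for some rational 0 < r < y.
recip : (y : Cut) → 0ᴿ <ᴿ y → Cut
recip y _ = record
  { Lower = λ q → ∃[ r ] Upper y r × q ℚ.* r ℚ.< 1ℚ
  ; Upper = λ q → ∃[ r ] Lower y r × 0ℚ ℚ.< r × 1ℚ ℚ.< q ℚ.* r
  }

divide : Cut → (y : Cut) → 0ᴿ <ᴿ y → Cut
divide x y 0<y = x *ᴿ recip y 0<y

-- Comparison of q ^ d with b ^ p for an integer exponent p; negative powers
-- of b are moved to the other side.
PowBelow PowAbove : ℚ → ℕ → ℕ → ℤ → Set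
PowBelow q d b (+ k)    = q ^ℚ d ℚ.< (+ (b ℕ.^ k)) ℚ./ 1
PowBelow q d b -[1+ k ] = q ^ℚ d ℚ.* ((+ (b ℕ.^ suc k)) ℚ./ 1) ℚ.< 1ℚ
PowAbove q d b (+ k)    = (+ (b ℕ.^ k)) ℚ./ 1 ℚ.< q ^ℚ d
PowAbove q d b -[1+ k ] = 1ℚ ℚ.< q ^ℚ d ℚ.* ((+ (b ℕ.^ suc k)) ℚ./ 1)

-- Real powers of a natural number b ≥ 1 (no meaning is attached to b = 0).
-- For rational r = p / d, q < b ^ r iff q ≤ 0 or q ^ d < b ^ p, and
-- b ^ r < q iff 0 < q and b ^ p < q ^ d.  As x ↦ b ^ x is nondecreasing and
-- continuous, b ^ x is the supremum of b ^ r over rational r < x and the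
-- infimum of b ^ r over rational r > x.
_^ᴿ_ : ℕ → Cut → Cut
b ^ᴿ x = record
  { Lower = λ q → ∃[ r ] Lower x r × (q ℚ.≤ 0ℚ ⊎ PowBelow q (↧ₙ r) b (↥ r))
  ; Upper = λ q → ∃[ r ] Upper x r × 0ℚ ℚ.< q × PowAbove q (↧ₙ r) b (↥ r)
  }

-- z = ⌈ x ⌉, i.e. z is the least integer with x ≤ z.
IsCeiling : Cut → ℤ → Set
IsCeiling x z = x ≤ᴿ fromℤ z × (∀ m → x ≤ᴿ fromℤ m → z ℤ.≤ m)

------------------------------------------------------------------------
-- Finite simple graphs on n labelled vertices.

record Graph (n : ℕ) : Set₁ where
  field
    _~_    : Rel (Fin n) 0ℓ
    _~?_   : B.Decidable _~_
    ~-sym  : Symmetric _~_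
    ~-irr  : Irreflexive _≡_ _~_

module _ {n : ℕ} (G : Graph n) where
  open Graph G

  TriangleFree : Set
  TriangleFree = ∀ u v w → u ~ v → v ~ w → ¬ (u ~ w)

  degree : Fin n → ℕ
  degree v = length (filter (v ~?_) (allFin n))

  -- Every degree is below n, so the default value n of the minimum is
  -- only attained on the empty graph.
  minDegree : ℕ
  minDegree = min n (map degree (allFin n))

  ProperColouring : ∀ {k} → Vec (Fin k) n → Set
  ProperColouring c = ∀ u v → u ~ v → lookup c u ≢ lookup c v

  Colourable : ℕ → Set
  Colourable k = ∃ λ (c : Vec (Fin k) n) → ProperColouring c

anyVec? : ∀ {k n} {P : Pred (Vec (Fin k) n) 0ℓ} → Decidable P → Dec (∃ P)
anyVec? {n = zero}  P? = map′ ([] ,_) (λ { ([] , p) → p }) (P? [])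
anyVec? {n = suc n} P? =
  map′ (λ { (i , c , p) → i ∷ c , p }) (λ { (i ∷ c , p) → i , c , p })
       (any? (λ i → anyVec? (λ c → P? (i ∷ c))))

colourable? : ∀ {n} (G : Graph n) → Decidable (Colourable G)
colourable? G k = anyVec? λ c → all? λ u → all? λ v →
  (u ~? v) →-dec ¬? (lookup c u Fin.≟ lookup c v)
  where open Graph G

-- The least k for which G is k-colourable; giving the n vertices distinct
-- colours shows that k ≤ n, hence the default value n.
χ : ∀ {n} → Graph n → ℕ
χ {n} G = min n (filter (colourable? G) (upTo n))

{-# OPTIONS --safe #-}
-- Call an edge uv bad if fewer than n²/56 edges join N(u) to N(v).
--
-- Suppose no edge is bad. Starting from one class, pick an edge uv inside a class, put z = 1_{N(u)} - 1_{N(v)},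
-- and refine the classes by the rounded value of ⟨z, 1_{N(x)}⟩. The vectors z obtained in this way are nearly
-- orthogonal, while each z zᵀ has inner product at least n²/14 with the ±1 matrix Q = J - 2A. As the norm of
-- 18 Q - Σ z zᵀ is nonnegative, this stops within 252 steps, with at most 32^252 independent classes.
--
-- Suppose uv is bad, and let T ≈ n^(1-δ). Then N(u) ∪ N(v) and its complement are nearly completely joined,
-- which yields V = B ∪ C ∪ H with B and C independent, all neighbours of C in B, and |C| > n/6. A vertex is adjacent
-- to at most l of the 2l + 1 vertices of a closed walk, and to none in H if it lies in C; summing degrees bounds the
-- length of odd closed walks in H from below. In particular H has no 5-cycle. If |H| ≥ 108 T, every edge inside H
-- has an end with at least |H|/72 neighbours in H, and having a common neighbour in H is so close to an equivalence
-- relation on these vertices that boundedly many colours suffice. If |H| < 108 T, odd closed walks in H have length at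
-- least of order n/T = n^δ, and the theorem of Kierstead, Szemerédi and Trotter colours H with k + 1 colours
-- as soon as |H|^(1/k) log n is small compared with n^δ, that is for every k > (1-δ)/δ and large n.
module Submission where

-- Why 56: both uses of a bad edge need a number above 54. Let e count the edges between N(u) and
-- N(v). Up to terms in T, a vertex with x neighbours in N(u) ∪ N(v), n/6 ≤ x ≤ 2n/9, forces e ≥
-- (n/6)(n/9) = n²/54. And all but about 9e/n of the roughly n/3 vertices outside N(u) ∪ N(v) end up
-- in C, so |C| > n/6, which is what excludes 5-cycles, again asks for e < n²/54. The surplus
-- absorbs T. Why 252 and 18: Q has entries ±1, hence squared norm n², while zᵀQz is (Σz)² + 4e ≥
-- n²/14. With weight λ, s steps and 32 rounding buckets, the squared norm of λQ - Σ z zᵀ is at most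
-- (λ² - λs/7 + s + s(s-1)/32²) n². The best λ is s/14, integral for s = 252, and the bracket is
-- then negative. Where ε goes: 1-δ is replaced by a rational r = P/Q above it with r/(1-r) still
-- below (1+ε)(1-δ)/δ. Real powers thereby become integer powers, and the least integer k above
-- P/(Q-P) does not exceed the ceiling. That k is strictly above P/(Q-P) leaves a power of n that
-- beats the logarithm.

open import Defs
open import Data.Nat using (ℕ; _≤_; _^_)
open import Data.Integer as ℤ using (ℤ; +_)
import Data.Rational as ℚ
open import Data.Product using (∃-syntax)

open import Algebra.Definitions.RawSemiring ℚ.+-*-rawSemiring using () renaming (_^_ to _^ℚ_)
open import Data.Bool as 𝔹 using (Bool; true; false; _∧_; _∨_; not)
open import Data.Empty using (⊥; ⊥-elim)
open import Data.Fin as Fin using (Fin; zero; suc)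
import Data.Fin.Properties as Finₚ
open import Data.Integer using (-[1+_]; 0ℤ; 1ℤ)
import Data.Integer.Properties as ℤₚ
import Data.Integer.Tactic.RingSolver as ℤ-Solver
open import Data.List using (length; filter; allFin; map; tabulate; upTo)
open import Data.List.Extrema.Nat using (min≤⊤; min≤v⁺)
open import Data.List.Membership.Propositional using (lose)
open import Data.List.Membership.Propositional.Properties using (∈-filter⁺; ∈-upTo⁺; ∈-map⁺; ∈-allFin)
open import Data.Nat as ℕ using (zero; suc; _+_; _*_; _∸_; _<_; z≤n; s≤s; NonZero)
open import Data.Nat.DivMod using (_/_; _%_; m≡m%n+[m/n]*n; m%n<n; m<n*o⇒m/o<n; /-mono-≤; m*n/n≡m)
open import Data.Nat.Properties
open import Data.Nat.Tactic.RingSolver using (solve-∀)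
open import Data.Product using (∃; Σ; _×_; _,_; proj₁; proj₂)
open import Data.Rational using (ℚ; mkℚ; 0ℚ; 1ℚ; ½; ↥_; ↧_; ↧ₙ_; _⊓_; _⊔_; toℚᵘ)
import Data.Rational.Properties as ℚₚ
open import Data.Rational.Solver using (module +-*-Solver)
open import Data.Rational.Unnormalised as ℚᵘ using (mkℚᵘ; *≡*; *<*; *≤*)
import Data.Rational.Unnormalised.Properties as ℚᵘₚ
open import Data.Sum using (_⊎_; inj₁; inj₂; [_,_]′)
import Data.Vec as Vec
import Data.Vec.Properties as Vecₚ
open import Function using (_∘_; Equivalence)
open import Relation.Binary using (tri<; tri≈; tri>)
open import Relation.Binary.PropositionalEquality
open import Relation.Nullary using (¬_; Dec; yes; no; does)
open import Relation.Nullary.Decidable using (dec-true; True; toWitness; _×-dec_)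
import Algebra.Properties.Semiring.Sum +-*-semiring as ℕΣ
import Algebra.Properties.Semiring.Sum ℤₚ.+-*-semiring as ℤΣ

open +-*-Solver using (solve; _:=_; _:+_; _:*_; :-_; con)
open Equivalence using (to; from)

-- Finite sums and vertex sets

-- Opaque, so that f can be inferred from ∑ f.
opaque
  ∑ : ∀ {n} → (Fin n → ℕ) → ℕ
  ∑ = ℕΣ.sum

  ∑-cong : ∀ {n} {f g : Fin n → ℕ} → (∀ i → f i ≡ g i) → ∑ f ≡ ∑ g
  ∑-cong = ℕΣ.sum-cong-≗

  ∑-+ : ∀ {n} (f g : Fin n → ℕ) → ∑ (λ i → f i + g i) ≡ ∑ f + ∑ g
  ∑-+ = ℕΣ.∑-distrib-+

  ∑-swap : ∀ {m n} (f : Fin m → Fin n → ℕ) → ∑ (λ i → ∑ (f i)) ≡ ∑ (λ j → ∑ (λ i → f i j))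
  ∑-swap = ℕΣ.∑-comm

  *-∑ : ∀ {n} c (f : Fin n → ℕ) → c * ∑ f ≡ ∑ (λ i → c * f i)
  *-∑ = ℕΣ.*-distribˡ-sum

  ∑-* : ∀ {n} c (f : Fin n → ℕ) → ∑ f * c ≡ ∑ (λ i → f i * c)
  ∑-* = ℕΣ.*-distribʳ-sum

  ∑-mono : ∀ {n} {f g : Fin n → ℕ} → (∀ i → f i ≤ g i) → ∑ f ≤ ∑ g
  ∑-mono {zero}  f≤g = z≤n
  ∑-mono {suc n} f≤g = +-mono-≤ (f≤g zero) (∑-mono (f≤g ∘ suc))

  ∑-const : ∀ n c → ∑ {n} (λ _ → c) ≡ n * c
  ∑-const zero    c = refl
  ∑-const (suc n) c = cong (_+_ c) (∑-const n c)

  term≤∑ : ∀ {n} (f : Fin n → ℕ) i → f i ≤ ∑ f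
  term≤∑ f zero    = m≤m+n _ _
  term≤∑ f (suc i) = ≤-trans (term≤∑ (f ∘ suc) i) (m≤n+m _ (f zero))

-- Certificate for a linear inequality; the equation is left to the ring solver.
≤-by : ∀ {a b X Y} s → X ≤ Y → a + Y + s ≡ b + X → a ≤ b
≤-by {a} {b} {X} {Y} s X≤Y eq = +-cancelʳ-≤ Y a b
  (≤-trans (m≤m+n (a + Y) s) (≤-trans (≤-reflexive eq) (+-monoʳ-≤ b X≤Y)))

VSet : ℕ → Set
VSet n = Fin n → Bool

infix 4 _∈_ _∉_ _⊑_
_∈_ _∉_ : ∀ {n} → Fin n → VSet n → Set
x ∈ A = A x ≡ true
x ∉ A = ¬ (x ∈ A)

_⊑_ : ∀ {n} → VSet n → VSet n → Set
A ⊑ B = ∀ {x} → x ∈ A → x ∈ B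

infixr 7 _∩_
infixr 6 _∪_
infixl 7 _∖_
_∩_ _∪_ _∖_ : ∀ {n} → VSet n → VSet n → VSet n
(A ∩ B) x = A x ∧ B x
(A ∪ B) x = A x ∨ B x
(A ∖ B) x = A x ∧ not (B x)

∅ : ∀ {n} → VSet n
∅ _ = false

⟦_⟧ : Bool → ℕ
⟦ true ⟧  = 1
⟦ false ⟧ = 0

# : ∀ {n} → VSet n → ℕ
# A = ∑ (λ x → ⟦ A x ⟧)

∈∩ : ∀ {a b} → a ≡ true → b ≡ true → a ∧ b ≡ true
∈∩ refl refl = refl

∩⁻ : ∀ {a b} → a ∧ b ≡ true → a ≡ true × b ≡ true
∩⁻ {true} {true} refl = refl , refl

∈∪ˡ : ∀ {a b} → a ≡ true → a ∨ b ≡ true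
∈∪ˡ refl = refl

∈∪ʳ : ∀ {a b} → b ≡ true → a ∨ b ≡ true
∈∪ʳ {true}  refl = refl
∈∪ʳ {false} refl = refl

∪⁻ : ∀ {a b} → a ∨ b ≡ true → a ≡ true ⊎ b ≡ true
∪⁻ {true}  _ = inj₁ refl
∪⁻ {false} p = inj₂ p

not⁺ : ∀ {a} → ¬ (a ≡ true) → not a ≡ true
not⁺ {true}  p = ⊥-elim (p refl)
not⁺ {false} _ = refl

not⁻ : ∀ {a} → not a ≡ true → ¬ (a ≡ true)
not⁻ {false} _ ()

∈? : ∀ a → a ≡ true ⊎ not a ≡ true
∈? true  = inj₁ refl
∈? false = inj₂ refl

⟦∧⟧ : ∀ a b → ⟦ a ∧ b ⟧ ≡ ⟦ a ⟧ * ⟦ b ⟧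
⟦∧⟧ true  b = sym (+-identityʳ _)
⟦∧⟧ false b = refl

⟦⟧≤1 : ∀ a → ⟦ a ⟧ ≤ 1
⟦⟧≤1 true  = ≤-refl
⟦⟧≤1 false = z≤n

⟦⟧-true : ∀ {a} → a ≡ true → ⟦ a ⟧ ≡ 1
⟦⟧-true refl = refl

⟦⟧-false : ∀ {a} → not a ≡ true → ⟦ a ⟧ ≡ 0
⟦⟧-false {false} _ = refl

⟦⟧-mono : ∀ {a b} → (a ≡ true → b ≡ true) → ⟦ a ⟧ ≤ ⟦ b ⟧
⟦⟧-mono {true}  p = ≤-reflexive (sym (⟦⟧-true (p refl)))
⟦⟧-mono {false} p = z≤n

⟦⟧-disj : ∀ {a b c} → ¬ (a ≡ true × b ≡ true) → (a ≡ true → c ≡ true) → (b ≡ true → c ≡ true) →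
          ⟦ a ⟧ + ⟦ b ⟧ ≤ ⟦ c ⟧
⟦⟧-disj {true}  {true}  d p q = ⊥-elim (d (refl , refl))
⟦⟧-disj {true}  {false} d p q = ≤-reflexive (sym (⟦⟧-true (p refl)))
⟦⟧-disj {false} {b}     d p q = ⟦⟧-mono q

⟦⟧-cover : ∀ {a b c} → (c ≡ true → a ≡ true ⊎ b ≡ true) → ⟦ c ⟧ ≤ ⟦ a ⟧ + ⟦ b ⟧
⟦⟧-cover {true}  {b} {c} p = ≤-trans (⟦⟧≤1 c) (m≤m+n 1 _)
⟦⟧-cover {false} {b} {c} p = ⟦⟧-mono (λ q → [ (λ ()) , (λ r → r) ]′ (p q))

#-mono : ∀ {n} {A B : VSet n} → A ⊑ B → # A ≤ # B
#-mono A⊑B = ∑-mono (λ x → ⟦⟧-mono A⊑B)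

#-disj : ∀ {n} {A B C : VSet n} → (∀ {x} → x ∈ A → x ∉ B) → A ⊑ C → B ⊑ C → # A + # B ≤ # C
#-disj {A = A} {B} d p q = ≤-trans (≤-reflexive (sym (∑-+ (⟦_⟧ ∘ A) (⟦_⟧ ∘ B))))
  (∑-mono (λ x → ⟦⟧-disj (λ { (a , b) → d a b }) p q))

#-cover : ∀ {n} {A B C : VSet n} → (∀ {x} → x ∈ C → x ∈ A ⊎ x ∈ B) → # C ≤ # A + # B
#-cover {A = A} {B} p = ≤-trans (∑-mono (λ x → ⟦⟧-cover p))
  (≤-reflexive (∑-+ (⟦_⟧ ∘ A) (⟦_⟧ ∘ B)))

#-∈ : ∀ {n} {A : VSet n} {x} → x ∈ A → 1 ≤ # A
#-∈ {A = A} {x} p = ≤-trans (≤-reflexive (sym (⟦⟧-true p))) (term≤∑ (⟦_⟧ ∘ A) x)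

#≤n : ∀ {n} (A : VSet n) → # A ≤ n
#≤n {n} A = ≤-trans (∑-mono (λ x → ⟦⟧≤1 (A x))) (≤-reflexive (trans (∑-const n 1) (*-identityʳ n)))

does⁻ : ∀ {a} {P : Set a} (d : Dec P) → does d ≡ true → P
does⁻ (yes p) _ = p

some? : ∀ {n} (A : VSet n) → Dec (∃ λ x → x ∈ A)
some? A = Finₚ.any? (λ x → A x 𝔹.≟ true)

some : ∀ {n} → VSet n → Bool
some A = does (some? A)

some⁺ : ∀ {n} (A : VSet n) {x} → x ∈ A → some A ≡ true
some⁺ A {x} p = dec-true (some? A) (x , p)

some⁻ : ∀ {n} (A : VSet n) → some A ≡ true → ∃ λ x → x ∈ A
some⁻ A p with some? A
... | yes q = q
some⁻ A () | no _

single : ∀ {n} → Fin n → VSet n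
single v x = does (v Fin.≟ x)

single⁺ : ∀ {n} (v : Fin n) → v ∈ single v
single⁺ v = dec-true (v Fin.≟ v) refl

single⁻ : ∀ {n} {v x : Fin n} → x ∈ single v → v ≡ x
single⁻ {v = v} {x} p with v Fin.≟ x
... | yes q = q
single⁻ () | no _

Independent : ∀ {n} → (Fin n → Fin n → Bool) → VSet n → Set
Independent e A = ∀ {x y} → x ∈ A → y ∈ A → ¬ (e x y ≡ true)

-- Total functions, proper inside `A`: colourings of different sets then combine without subtypes.
Col : ∀ {n} → (Fin n → Fin n → Bool) → ℕ → VSet n → Set
Col {n} e k A = Σ (Fin n → Fin k) λ f → ∀ {x y} → x ∈ A → y ∈ A → e x y ≡ true → f x ≢ f y

col-⊑ : ∀ {n} {e : Fin n → Fin n → Bool} {k A B} → A ⊑ B → Col e k B → Col e k A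
col-⊑ A⊑B (f , p) = f , λ a b → p (A⊑B a) (A⊑B b)

col-indep : ∀ {n} {e : Fin n → Fin n → Bool} {A} → Independent e A → Col e 1 A
col-indep ind = (λ _ → zero) , λ a b xy _ → ind a b xy

↑ˡ≢↑ʳ : ∀ {k l} {i : Fin k} {j : Fin l} → i Fin.↑ˡ l ≢ k Fin.↑ʳ j
↑ˡ≢↑ʳ {i = suc i} eq = ↑ˡ≢↑ʳ (Finₚ.suc-injective eq)

col-∪ : ∀ {n} {e : Fin n → Fin n → Bool} {k l A B} → Col e k A → Col e l B → Col e (k + l) (A ∪ B)
col-∪ {n} {e} {k} {l} {A} {B} (f , p) (g , q) = h , r
  where
  h : Fin n → Fin (k + l)
  h x with A x
  ... | true  = f x Fin.↑ˡ l
  ... | false = k Fin.↑ʳ g x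
  r : ∀ {x y} → x ∈ A ∪ B → y ∈ A ∪ B → e x y ≡ true → h x ≢ h y
  r {x} {y} a b xy eq with A x in ax | A y in ay
  ... | true  | true  = p ax ay xy (Finₚ.↑ˡ-injective l _ _ eq)
  ... | true  | false = ↑ˡ≢↑ʳ eq
  ... | false | true  = ↑ˡ≢↑ʳ (sym eq)
  ... | false | false = q a b xy (Finₚ.↑ʳ-injective k _ _ eq)

data Walk {n} (e : Fin n → Fin n → Bool) (v : Fin n) : ℕ → Fin n → Set where
  stay : Walk e v 0 v
  step : ∀ {i a b} → Walk e v i a → e a b ≡ true → Walk e v (suc i) b

-- Two walks from v whose ends are adjacent close up to a walk of length l + l + 1.
NoOddClosedWalk : ∀ {n} → (Fin n → Fin n → Bool) → ℕ → Set
NoOddClosedWalk e R = ∀ {v l i j a b} → l ≤ R → i + j ≡ l + l →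
  Walk e v i a → Walk e v j b → ¬ (e a b ≡ true)

-- Graphs of large odd girth (Kierstead, Szemerédi, Trotter)

≤-<-search : ∀ R (f g : ℕ → ℕ) → (∃ λ j → j < R × f j ≤ g j) ⊎ (∀ j → j < R → g j < f j)
≤-<-search zero    f g = inj₂ (λ _ ())
≤-<-search (suc R) f g with ≤-<-search R f g | f R ≤? g R
... | inj₁ (j , j<R , p) | _     = inj₁ (j , m<n⇒m<1+n j<R , p)
... | inj₂ q             | yes p = inj₁ (R , ≤-refl , p)
... | inj₂ q             | no ¬p = inj₂ λ j j≤R → [ q j , (λ { refl → ≰⇒> ¬p }) ]′ (m≤n⇒m<n∨m≡n (ℕ.s≤s⁻¹ j≤R))

opaque
  -- Otherwise b would double every m steps.
  slow-step : ∀ m .{{_ : NonZero m}} L B (b : ℕ → ℕ) → (∀ j → b j ≤ b (suc j)) → 1 ≤ b 0 → (∀ j → b j ≤ B) → B < 2 ^ L →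
              ∃ λ j → j < L * m × m * b (suc j) ≤ b (suc j) + m * b j
  slow-step m L B b mono 1≤b b≤B B<2^L
    with ≤-<-search (L * m) (λ j → m * b (suc j)) (λ j → b (suc j) + m * b j)
  ... | inj₁ r    = r
  ... | inj₂ fast = ⊥-elim (<-irrefl refl (<-≤-trans B<2^L (≤-trans (double L ≤-refl) (b≤B (L * m)))))
    where
    mono+ : ∀ j q → b j ≤ b (j + q)
    mono+ j zero    = ≤-reflexive (cong b (sym (+-identityʳ j)))
    mono+ j (suc q) = ≤-trans (mono+ j q) (≤-trans (mono (j + q)) (≤-reflexive (cong b (sym (+-suc j q)))))
    -- Each fast step gains at least the fixed amount `b j / m`, where `j` is the starting point;
    -- `q = m` then doubles `b`.
    grow : ∀ j q → j + q ≤ L * m → (m + q) * b j ≤ m * b (j + q)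
    grow j zero    h = ≤-reflexive (cong₂ (λ u v → u * b v) (+-identityʳ m) (sym (+-identityʳ j)))
    grow j (suc q) h = begin
      (m + suc q) * b j                ≡⟨ lem (b j) ⟩
      b j + (m + q) * b j              ≤⟨ +-mono-≤ (mono+ j (suc q)) (grow j q (≤-trans (+-monoʳ-≤ j (n≤1+n q)) h)) ⟩
      b (j + suc q) + m * b (j + q)    ≡⟨ cong (λ z → b z + m * b (j + q)) (+-suc j q) ⟩
      b (suc (j + q)) + m * b (j + q)  ≤⟨ <⇒≤ (fast (j + q) (≤-trans (≤-reflexive (sym (+-suc j q))) h)) ⟩
      m * b (suc (j + q))              ≡⟨ cong (λ z → m * b z) (sym (+-suc j q)) ⟩
      m * b (j + suc q)                ∎
      where
      open ≤-Reasoning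
      lem : ∀ x → (m + suc q) * x ≡ x + (m + q) * x
      lem x = cong (_* x) (+-suc m q)
    double′ : ∀ l → suc l * m ≤ L * m → 2 * b (l * m) ≤ b (m + l * m)
    double′ l h = *-cancelˡ-≤ m (begin
      m * (2 * b (l * m))   ≡⟨ lem m (b (l * m)) ⟩
      (m + m) * b (l * m)   ≤⟨ grow (l * m) m (≤-trans (≤-reflexive (+-comm (l * m) m)) h) ⟩
      m * b (l * m + m)     ≡⟨ cong (λ z → m * b z) (+-comm (l * m) m) ⟩
      m * b (m + l * m)     ∎)
      where
      open ≤-Reasoning
      lem : ∀ m x → m * (2 * x) ≡ (m + m) * x
      lem = solve-∀
    double : ∀ l → l ≤ L → 2 ^ l ≤ b (l * m)
    double zero    h = 1≤b
    double (suc l) h = ≤-trans (*-monoʳ-≤ 2 (double l (<⇒≤ h))) (double′ l (*-monoˡ-≤ m h))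

even+even : ∀ p q → p + p + (q + q) ≡ p + q + (p + q)
even+even = solve-∀

odd+odd : ∀ p q → suc (p + p) + suc (q + q) ≡ suc p + q + (suc p + q)
odd+odd = solve-∀

swap₂₄ : ∀ a b c d → (a + b) + (c + d) ≡ (b + c) + (a + d)
swap₂₄ = solve-∀

module Carving {n} (e : Fin n → Fin n → Bool) (e-sym : ∀ {x y} → e x y ≡ true → e y x ≡ true)
               (m L : ℕ) .{{_ : NonZero m}} (noOdd : NoOddClosedWalk e (2 * (L * m))) where

  module Alternating (A : VSet n) (v : Fin n) (v∈A : v ∈ A) where

    N : VSet n → VSet n
    N B x = A x ∧ some (λ y → B y ∧ e y x)

    N⁺ : ∀ {B x y} → x ∈ B → y ∈ A → e x y ≡ true → y ∈ N B
    N⁺ {B} {x} {y} x∈B y∈A xy = ∈∩ y∈A (some⁺ (λ z → B z ∧ e z y) (∈∩ x∈B xy))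

    N⁻ : ∀ {B y} → y ∈ N B → y ∈ A × ∃ λ x → x ∈ B × e x y ≡ true
    N⁻ {B} {y} p with ∩⁻ {A y} p
    ... | y∈A , q with some⁻ (λ z → B z ∧ e z y) q
    ... | x , r = y∈A , x , ∩⁻ r

    -- T j and O j consist of the vertices joined to v by an even walk of length ≤ 2j,
    -- respectively an odd walk of length < 2j, inside A.
    T O : ℕ → VSet n
    T zero    = single v
    T (suc j) = T j ∪ N (O (suc j))
    O zero    = ∅
    O (suc j) = N (T j)

    T-mono : ∀ j → T j ⊑ T (suc j)
    T-mono j = ∈∪ˡ

    O-mono : ∀ j → O j ⊑ O (suc j)
    O-mono (suc j) {x} p with N⁻ {T j} p
    ... | x∈A , y , y∈T , yx = N⁺ {T (suc j)} (T-mono j {y} y∈T) x∈A yx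

    T⊑A : ∀ j → T j ⊑ A
    T⊑A zero    p with single⁻ {v = v} p
    ... | refl = v∈A
    T⊑A (suc j) {x} p with ∪⁻ {T j x} p
    ... | inj₁ q = T⊑A j q
    ... | inj₂ q = proj₁ (N⁻ {O (suc j)} q)

    O⊑A : ∀ j → O j ⊑ A
    O⊑A (suc j) p = proj₁ (N⁻ {T j} p)

    T-walk : ∀ j {x} → x ∈ T j → ∃ λ p → p ≤ j × Walk e v (p + p) x
    O-walk : ∀ j {x} → x ∈ O (suc j) → ∃ λ p → p ≤ j × Walk e v (suc (p + p)) x
    T-walk zero    q with single⁻ {v = v} q
    ... | refl = 0 , z≤n , stay
    T-walk (suc j) {x} q with ∪⁻ {T j x} q
    ... | inj₁ r = let p , p≤j , w = T-walk j r in p , m≤n⇒m≤1+n p≤j , w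
    ... | inj₂ r with N⁻ {O (suc j)} r
    ... | _ , y , y∈O , yx = let p , p≤j , w = O-walk j y∈O in
      suc p , s≤s p≤j , subst (λ z → Walk e v (suc z) x) (sym (+-suc p p)) (step w yx)
    O-walk j q with N⁻ {T j} q
    ... | _ , y , y∈T , yx = let p , p≤j , w = T-walk j y∈T in p , p≤j , step w yx

    -- Two walks found up to depth `L * m` close up to a walk of length `l + l + 1` with
    -- `l ≤ 2 * (L * m)`; this fixes the radius in `noOdd`.
    half : ∀ {j p q} → j ≤ L * m → p ≤ j → q ≤ j → p + q ≤ 2 * (L * m)
    half {j} j≤ p≤j q≤j = ≤-trans (+-mono-≤ (≤-trans p≤j j≤) (≤-trans q≤j j≤))
      (≤-reflexive (cong (_+_ (L * m)) (sym (+-identityʳ _))))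

    T-indep : ∀ {j} → j ≤ L * m → Independent e (T j)
    T-indep {j} j≤ {x} {y} x∈ y∈ with T-walk j x∈ | T-walk j y∈
    ... | p , p≤j , w | q , q≤j , w′ = noOdd (half j≤ p≤j q≤j) (even+even p q) w w′

    O-indep : ∀ {j} → j < L * m → Independent e (O (suc j))
    O-indep {j} j< {x} {y} x∈ y∈ with O-walk j x∈ | O-walk j y∈
    ... | p , p≤j , w | q , q≤j , w′ =
      noOdd (half {p = suc p} j< (s≤s p≤j) (m≤n⇒m≤1+n q≤j)) (odd+odd p q) w w′

    T-O-disjoint : ∀ {j x} → suc j ≤ L * m → x ∈ T (suc j) → x ∉ O (suc j)
    T-O-disjoint {j} {x} j≤ x∈T x∈O with N⁻ {T j} x∈O
    ... | _ , y , y∈T , yx = T-indep {suc j} j≤ (T-mono j {y} y∈T) x∈T yx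

    T-nbr : ∀ {j x y} → x ∈ T j → y ∈ A → e x y ≡ true → y ∈ O (suc j)
    T-nbr {j} = N⁺ {T j}

    O-nbr : ∀ {j x y} → x ∈ O j → y ∈ A → e x y ≡ true → y ∈ T j
    O-nbr {suc j} {x} {y} x∈O y∈A xy = ∈∪ʳ {T j y} (N⁺ {O (suc j)} x∈O y∈A xy)

  record Split (S W A : VSet n) : Set where
    field
      I W′ S′   : VSet n
      cover     : ∀ {x} → x ∈ A → x ∈ I ⊎ x ∈ W′ ⊎ x ∈ S′
      I⊑A       : I ⊑ A
      W′⊑A      : W′ ⊑ A
      I-indep   : Independent e I
      W′-indep  : Independent e W′
      S′-small  : m * # S′ ≤ # (S ∩ A)

  -- Edges leaving `X` inside `A` start in `S′` only. Hence the sets `I` of successive pieces have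
  -- no edges between them, nor have the sets `W′`, and each `S′` is charged to its own part of `S`.
  record Piece (S W A : VSet n) (v : Fin n) : Set where
    field
      X I W′ S′ : VSet n
      v∈X       : v ∈ X
      X⊑A       : X ⊑ A
      cover     : ∀ {x} → x ∈ X → x ∈ I ⊎ x ∈ W′ ⊎ x ∈ S′
      I⊑A       : I ⊑ A
      W′⊑A      : W′ ⊑ A
      I-indep   : Independent e I
      W′-indep  : Independent e W′
      I-closed  : ∀ {x y} → x ∈ I → y ∈ A → e x y ≡ true → y ∈ X
      W′-closed : ∀ {x y} → x ∈ W′ → y ∈ A → e x y ≡ true → y ∈ X
      S′-small  : m * # S′ ≤ # (S ∩ X)

    apart : # (S ∩ X) + # (S ∩ (A ∖ X)) ≤ # (S ∩ A)
    apart = #-disj {C = S ∩ A}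
      (λ {x} q r → not⁻ (proj₂ (∩⁻ {A x} (proj₂ (∩⁻ {S x} r)))) (proj₂ (∩⁻ {S x} q)))
      (λ {x} q → let s , r = ∩⁻ {S x} q in ∈∩ s (X⊑A {x} r))
      (λ {x} q → let s , r = ∩⁻ {S x} q in ∈∩ s (proj₁ (∩⁻ {A x} r)))

  module Join {S W A : VSet n} {v : Fin n} (P : Piece S W A v) (R : Split S W (A ∖ Piece.X P)) where
    private
      module P = Piece P
      module R = Split R

    cover : ∀ {x} → x ∈ A → x ∈ P.I ∪ R.I ⊎ x ∈ P.W′ ∪ R.W′ ⊎ x ∈ P.S′ ∪ R.S′
    cover {x} a with ∈? (P.X x)
    cover {x} a | inj₁ q with P.cover {x} q
    ... | inj₁ i = inj₁ (∈∪ˡ i)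
    ... | inj₂ (inj₁ w) = inj₂ (inj₁ (∈∪ˡ w))
    ... | inj₂ (inj₂ s) = inj₂ (inj₂ (∈∪ˡ s))
    cover {x} a | inj₂ ¬q with R.cover (∈∩ a ¬q)
    ... | inj₁ i = inj₁ (∈∪ʳ {P.I x} i)
    ... | inj₂ (inj₁ w) = inj₂ (inj₁ (∈∪ʳ {P.W′ x} w))
    ... | inj₂ (inj₂ s) = inj₂ (inj₂ (∈∪ʳ {P.S′ x} s))

    independent : ∀ {M N : VSet n} → Independent e M → Independent e N → N ⊑ A ∖ P.X →
                  (∀ {x y} → x ∈ M → y ∈ A → e x y ≡ true → y ∈ P.X) → Independent e (M ∪ N)
    independent {M} {N} iM iN N⊑ closed {x} {y} a b xy with ∪⁻ {M x} a | ∪⁻ {M y} b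
    ... | inj₁ p | inj₁ p′ = iM p p′ xy
    ... | inj₂ q | inj₂ q′ = iN q q′ xy
    ... | inj₁ p | inj₂ q = let a′ , ¬x = ∩⁻ {A y} (N⊑ q) in not⁻ ¬x (closed p a′ xy)
    ... | inj₂ q | inj₁ p = let a′ , ¬x = ∩⁻ {A x} (N⊑ q) in not⁻ ¬x (closed p a′ (e-sym xy))

    inside : ∀ {M N : VSet n} → M ⊑ A → N ⊑ A ∖ P.X → M ∪ N ⊑ A
    inside {M} M⊑ N⊑ {x} q with ∪⁻ {M x} q
    ... | inj₁ p = M⊑ p
    ... | inj₂ p = proj₁ (∩⁻ {A x} (N⊑ p))

    small : m * # (P.S′ ∪ R.S′) ≤ # (S ∩ A)
    small = ≤-trans (*-monoʳ-≤ m (#-cover {C = P.S′ ∪ R.S′} (λ {x} → ∪⁻ {P.S′ x})))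
      (≤-trans (≤-reflexive (*-distribˡ-+ m (# P.S′) (# R.S′)))
      (≤-trans (+-mono-≤ P.S′-small R.S′-small) P.apart))

    joined : Split S W A
    joined = record
      { I = P.I ∪ R.I ; W′ = P.W′ ∪ R.W′ ; S′ = P.S′ ∪ R.S′ ; cover = cover
      ; I⊑A = inside P.I⊑A R.I⊑A ; W′⊑A = inside P.W′⊑A R.W′⊑A
      ; I-indep = independent P.I-indep R.I-indep R.I⊑A P.I-closed
      ; W′-indep = independent P.W′-indep R.W′-indep R.W′⊑A P.W′-closed
      ; S′-small = small }

  module _ {S W : VSet n} (W-indep : Independent e W) (S-size : # S + # S < 2 ^ L) where

    -- Only vertices of `S` weigh, since those of `W` can be absorbed by `W′`. `slow-step` wants a
    -- bound at every `j`, also past the depth where `T` and `O` are known to be disjoint; hence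
    -- `# S + # S`.
    weight : ∀ A v → v ∈ A → ℕ → ℕ
    weight A v v∈A j = # (S ∩ T j) + # (S ∩ O j)
      where open Alternating A v v∈A

    slow-layer : ∀ A v (v∈A : v ∈ A) → v ∈ S → let b = weight A v v∈A in
                 ∃ λ j → j < L * m × m * b (suc j) ≤ b (suc j) + m * b j
    slow-layer A v v∈A v∈S = slow-step m L (# S + # S) (weight A v v∈A)
      (λ j → +-mono-≤ (#-mono (mono {j} T (T-mono j))) (#-mono (mono {j} O (O-mono j))))
      (≤-trans (#-∈ {A = S ∩ single v} (∈∩ v∈S (single⁺ v))) (m≤m+n _ _))
      (λ j → +-mono-≤ (#-mono (proj₁ ∘ ∩⁻)) (#-mono (proj₁ ∘ ∩⁻)))
      S-size
      where
      open Alternating A v v∈A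
      mono : ∀ {j} (F : ℕ → VSet n) → F j ⊑ F (suc j) → S ∩ F j ⊑ S ∩ F (suc j)
      mono F F⊑ {x} p = let s , q = ∩⁻ {S x} p in ∈∩ s (F⊑ {x} q)

    module Carve (A : VSet n) (A⊑ : ∀ {x} → x ∈ A → x ∈ S ⊎ x ∈ W) (v : Fin n) (v∈A : v ∈ A)
                 (j : ℕ) (j< : j < L * m)
                 (slow : m * weight A v v∈A (suc j) ≤ weight A v v∈A (suc j) + m * weight A v v∈A j) where
      open Alternating A v v∈A

      b : ℕ → ℕ
      b = weight A v v∈A

      -- The boundary vertices in `S` form `S′`, few because layer `j` is slow. A boundary vertex of
      -- `O (suc j)` in `W` costs nothing: `W` is independent, so its neighbours in `A` lie in
      -- `S ∩ T (suc j)`, which `X` contains.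
      I W′ S′ X : VSet n
      I  = T j
      S′ = S ∩ ((O (suc j) ∖ O j) ∪ (T (suc j) ∖ T j))
      W′ = O j ∪ (O (suc j) ∩ W)
      X  = T j ∪ O (suc j) ∪ (S ∩ T (suc j))

      W′⊑O : W′ ⊑ O (suc j)
      W′⊑O {x} p with ∪⁻ {O j x} p
      ... | inj₁ q = O-mono j {x} q
      ... | inj₂ q = proj₁ (∩⁻ {O (suc j) x} q)

      X⊑A : X ⊑ A
      X⊑A {x} p with ∪⁻ {T j x} p
      ... | inj₁ q = T⊑A j q
      ... | inj₂ q with ∪⁻ {O (suc j) x} q
      ... | inj₁ r = O⊑A (suc j) r
      ... | inj₂ r = T⊑A (suc j) (proj₂ (∩⁻ {S x} r))

      v∈X : v ∈ X
      v∈X = ∈∪ˡ (go j)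
        where
        go : ∀ j → v ∈ T j
        go zero    = single⁺ v
        go (suc j) = ∈∪ˡ (go j)

      W′⊑A : W′ ⊑ A
      W′⊑A {x} p = O⊑A (suc j) (W′⊑O {x} p)

      coverX : ∀ {x} → x ∈ X → x ∈ I ⊎ x ∈ W′ ⊎ x ∈ S′
      coverX {x} p with ∈? (T j x)
      ... | inj₁ t = inj₁ t
      ... | inj₂ ¬t with ∈? (O j x)
      ... | inj₁ o = inj₂ (inj₁ (∈∪ˡ o))
      ... | inj₂ ¬o with ∪⁻ {T j x} p
      ... | inj₁ t = inj₁ t
      ... | inj₂ q with ∪⁻ {O (suc j) x} q
      ... | inj₂ r = let s , t = ∩⁻ {S x} r in
        inj₂ (inj₂ (∈∩ s (∈∪ʳ {(O (suc j) ∖ O j) x} (∈∩ t ¬t))))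
      ... | inj₁ o with A⊑ (O⊑A (suc j) o)
      ... | inj₁ s = inj₂ (inj₂ (∈∩ s (∈∪ˡ (∈∩ o ¬o))))
      ... | inj₂ w = inj₂ (inj₁ (∈∪ʳ {O j x} (∈∩ o w)))

      I-closed : ∀ {x y} → x ∈ I → y ∈ A → e x y ≡ true → y ∈ X
      I-closed {x} {y} x∈ y∈A xy = ∈∪ʳ {T j y} (∈∪ˡ (T-nbr {j} x∈ y∈A xy))

      W′-closed : ∀ {x y} → x ∈ W′ → y ∈ A → e x y ≡ true → y ∈ X
      W′-closed {x} {y} x∈ y∈A xy with ∪⁻ {O j x} x∈
      ... | inj₁ o = ∈∪ˡ (O-nbr {j} o y∈A xy)
      ... | inj₂ q with ∩⁻ {O (suc j) x} q | A⊑ y∈A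
      ... | o , w | inj₁ s  = ∈∪ʳ {T j y} (∈∪ʳ {O (suc j) y} (∈∩ s (O-nbr {suc j} o y∈A xy)))
      ... | o , w | inj₂ w′ = ⊥-elim (W-indep w w′ xy)

      -- As the two parities are disjoint, `b (suc j)` counts vertices of `S ∩ X`, and `# S′` is at
      -- most the growth from `b j` to `b (suc j)`; slowness compares the two.
      S′-small : m * # S′ ≤ # (S ∩ X)
      S′-small = +-cancelʳ-≤ (m * b j) _ _ (begin
        m * # S′ + m * b j   ≡⟨ *-distribˡ-+ m (# S′) (b j) ⟨
        m * (# S′ + b j)     ≤⟨ *-monoʳ-≤ m gain ⟩
        m * b (suc j)        ≤⟨ slow ⟩
        b (suc j) + m * b j  ≤⟨ +-monoˡ-≤ (m * b j) fits ⟩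
        # (S ∩ X) + m * b j  ∎)
        where
        open ≤-Reasoning
        fits : b (suc j) ≤ # (S ∩ X)
        fits = #-disj {C = S ∩ X}
          (λ {x} p q → T-O-disjoint {j} {x} j< (proj₂ (∩⁻ {S x} p)) (proj₂ (∩⁻ {S x} q)))
          fT fO
          where
          fT : S ∩ T (suc j) ⊑ S ∩ X
          fT {x} p = let s , t = ∩⁻ {S x} p in ∈∩ s (∈∪ʳ {T j x} (∈∪ʳ {O (suc j) x} (∈∩ s t)))
          fO : S ∩ O (suc j) ⊑ S ∩ X
          fO {x} p = let s , o = ∩⁻ {S x} p in ∈∩ s (∈∪ʳ {T j x} (∈∪ˡ o))
        part : ∀ (F : ℕ → VSet n) → F j ⊑ F (suc j) →
               # (S ∩ (F (suc j) ∖ F j)) + # (S ∩ F j) ≤ # (S ∩ F (suc j))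
        part F F⊑ = #-disj {C = S ∩ F (suc j)}
          (λ {x} p q → not⁻ (proj₂ (∩⁻ {F (suc j) x} (proj₂ (∩⁻ {S x} p)))) (proj₂ (∩⁻ {S x} q)))
          (λ {x} p → let s , q = ∩⁻ {S x} p in ∈∩ s (proj₁ (∩⁻ {F (suc j) x} q)))
          (λ {x} p → let s , q = ∩⁻ {S x} p in ∈∩ s (F⊑ {x} q))
        split : # S′ ≤ # (S ∩ (O (suc j) ∖ O j)) + # (S ∩ (T (suc j) ∖ T j))
        split = #-cover {C = S′} f
          where
          f : ∀ {x} → x ∈ S′ → x ∈ S ∩ (O (suc j) ∖ O j) ⊎ x ∈ S ∩ (T (suc j) ∖ T j)
          f {x} p with ∩⁻ {S x} p
          ... | s , q with ∪⁻ {(O (suc j) ∖ O j) x} q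
          ... | inj₁ o = inj₁ (∈∩ s o)
          ... | inj₂ t = inj₂ (∈∩ s t)
        gain : # S′ + b j ≤ b (suc j)
        gain = begin
          # S′ + b j                                     ≤⟨ +-monoˡ-≤ (b j) split ⟩
          (dO + dT) + (# (S ∩ T j) + # (S ∩ O j))        ≡⟨ swap₂₄ dO dT _ _ ⟩
          (dT + # (S ∩ T j)) + (dO + # (S ∩ O j))        ≤⟨ +-mono-≤ (part T (T-mono j)) (part O (O-mono j)) ⟩
          b (suc j)                                      ∎
          where
          dO = # (S ∩ (O (suc j) ∖ O j))
          dT = # (S ∩ (T (suc j) ∖ T j))

      piece : Piece S W A v
      piece = record
        { X = X ; I = I ; W′ = W′ ; S′ = S′ ; v∈X = v∈X ; X⊑A = λ {x} → X⊑A {x} ; cover = λ {x} → coverX {x}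
        ; I⊑A = λ {x} → T⊑A j {x} ; W′⊑A = λ {x} → W′⊑A {x} ; I-indep = λ {x} {y} → T-indep {j} (<⇒≤ j<) {x} {y}
        ; W′-indep = λ {x} {y} a b → O-indep {j} j< (W′⊑O {x} a) (W′⊑O {y} b)
        ; I-closed = λ {x} {y} → I-closed {x} {y} ; W′-closed = λ {x} {y} → W′-closed {x} {y} ; S′-small = S′-small }

    carve : ∀ A → (∀ {x} → x ∈ A → x ∈ S ⊎ x ∈ W) → ∀ v → v ∈ S → v ∈ A → Piece S W A v
    carve A A⊑ v v∈S v∈A = let j , j< , slow = slow-layer A v v∈A v∈S in Carve.piece A A⊑ v v∈A j j< slow

    -- Pieces grow only around vertices of `S`, and `fuel` bounds how many of these are left. Once
    -- there are none, `A` lies in `W` and is itself a valid `W′`.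
    split : ∀ fuel A → (∀ {x} → x ∈ A → x ∈ S ⊎ x ∈ W) → # (S ∩ A) ≤ fuel → Split S W A
    split fuel A A⊑ h with some? (S ∩ A)
    ... | no none = record
      { I = ∅ ; W′ = A ; S′ = ∅
      ; cover = λ a → inj₂ (inj₁ a) ; I⊑A = λ () ; W′⊑A = λ a → a
      ; I-indep = λ ()
      ; W′-indep = λ {x} {y} a b → W-indep (inW a) (inW b)
      ; S′-small = ≤-trans (≤-reflexive (trans (cong (m *_) #∅) (*-zeroʳ m))) z≤n }
      where
      #∅ : # {n} ∅ ≡ 0
      #∅ = trans (∑-const n 0) (*-zeroʳ n)
      inW : ∀ {x} → x ∈ A → x ∈ W
      inW {x} a with A⊑ a
      ... | inj₁ s = ⊥-elim (none (x , ∈∩ s a))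
      ... | inj₂ w = w
    split zero A A⊑ h | yes (v , p) = ⊥-elim (<⇒≱ (#-∈ {A = S ∩ A} p) h)
    split (suc fuel) A A⊑ h | yes (v , p) = finish (carve A A⊑ v v∈S (proj₂ (∩⁻ {S v} p)))
      where
      v∈S : v ∈ S
      v∈S = proj₁ (∩⁻ p)
      finish : Piece S W A v → Split S W A
      finish P = Join.joined P (split fuel (A ∖ P.X) (λ {x} q → A⊑ (proj₁ (∩⁻ {A x} q)))
        (ℕ.s≤s⁻¹ (≤-trans (+-monoˡ-≤ _ (#-∈ {A = S ∩ P.X} (∈∩ v∈S P.v∈X))) (≤-trans P.apart h))))
        where module P = Piece P

  -- Kierstead–Szemerédi–Trotter: every round spends one new colour on I and passes the
  -- independent set W′ on, so that only |S| has to shrink; the last colour is shared by all rounds.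
  kst : ∀ k {S W} → Independent e W → # S + # S < 2 ^ L → # S < m ^ k → Col e (suc k) (S ∪ W)
  kst zero {S} {W} W-indep _ S<1 = col-⊑ {B = W} f (col-indep W-indep)
    where
    f : S ∪ W ⊑ W
    f {x} p with ∪⁻ {S x} p
    ... | inj₁ s = ⊥-elim (<⇒≱ S<1 (#-∈ {A = S} s))
    ... | inj₂ w = w
  kst (suc k) {S} {W} W-indep S<2^L S<m^k =
    col-⊑ {B = I ∪ (S′ ∪ W′)} f (col-∪ (col-indep I-indep)
      (kst k W′-indep (≤-<-trans (+-mono-≤ S′≤S S′≤S) S<2^L)
        (*-cancelˡ-< m (# S′) (m ^ k) (≤-<-trans mS′≤S S<m^k))))
    where
    open Split (split W-indep S<2^L (# (S ∩ (S ∪ W))) (S ∪ W) (λ {x} → ∪⁻ {S x}) ≤-refl)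
    mS′≤S : m * # S′ ≤ # S
    mS′≤S = ≤-trans S′-small (#-mono (λ {x} p → proj₁ (∩⁻ {S x} p)))
    S′≤S : # S′ ≤ # S
    S′≤S = ≤-trans (m≤n*m (# S′) m) mS′≤S
    f : S ∪ W ⊑ I ∪ (S′ ∪ W′)
    f {x} p with cover p
    ... | inj₁ i = ∈∪ˡ i
    ... | inj₂ (inj₁ w) = ∈∪ʳ {I x} (∈∪ʳ {S′ x} w)
    ... | inj₂ (inj₂ s) = ∈∪ʳ {I x} (∈∪ˡ s)

-- Edge counting in triangle-free graphs

∁ : ∀ {n} → VSet n → VSet n
∁ A x = not (A x)

full : ∀ {n} → VSet n
full _ = true

#-full : ∀ n → # {n} full ≡ n
#-full n = trans (∑-const n 1) (*-identityʳ n)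

#-∁ : ∀ {n} (A : VSet n) → # A + # (∁ A) ≡ n
#-∁ {n} A = trans (sym (∑-+ (⟦_⟧ ∘ A) (⟦_⟧ ∘ ∁ A))) (trans (∑-cong (λ x → lem (A x))) (#-full n))
  where
  lem : ∀ a → ⟦ a ⟧ + ⟦ not a ⟧ ≡ 1
  lem true  = refl
  lem false = refl

#-split : ∀ {n} (A B : VSet n) → # A ≡ # (A ∩ B) + # (A ∩ ∁ B)
#-split A B = trans (∑-cong (λ x → lem (A x) (B x))) (∑-+ (⟦_⟧ ∘ (A ∩ B)) (⟦_⟧ ∘ (A ∩ ∁ B)))
  where
  lem : ∀ a b → ⟦ a ⟧ ≡ ⟦ a ∧ b ⟧ + ⟦ a ∧ not b ⟧
  lem true  true  = refl
  lem true  false = refl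
  lem false b     = refl

∑∈-bound : ∀ {n} (A : VSet n) (f : Fin n → ℕ) r → (∀ {x} → x ∈ A → f x ≤ r) →
           ∑ (λ x → ⟦ A x ⟧ * f x) ≤ # A * r
∑∈-bound A f r h = ≤-trans (∑-mono pt) (≤-reflexive (sym (∑-* r (⟦_⟧ ∘ A))))
  where
  pt : ∀ x → ⟦ A x ⟧ * f x ≤ ⟦ A x ⟧ * r
  pt x with A x in eq
  ... | true  = *-monoʳ-≤ 1 (h eq)
  ... | false = z≤n

∑∈-lower : ∀ {n} (A : VSet n) (f : Fin n → ℕ) r → (∀ {x} → x ∈ A → r ≤ f x) →
           # A * r ≤ ∑ (λ x → ⟦ A x ⟧ * f x)
∑∈-lower A f r h = ≤-trans (≤-reflexive (∑-* r (⟦_⟧ ∘ A))) (∑-mono pt)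
  where
  pt : ∀ x → ⟦ A x ⟧ * r ≤ ⟦ A x ⟧ * f x
  pt x with A x in eq
  ... | true  = *-monoʳ-≤ 1 (h eq)
  ... | false = z≤n

∑∈-linear : ∀ {n} (A : VSet n) c d (f g : Fin n → ℕ) →
            ∑ (λ x → ⟦ A x ⟧ * (c * f x + d * g x)) ≡ c * ∑ (λ x → ⟦ A x ⟧ * f x) + d * ∑ (λ x → ⟦ A x ⟧ * g x)
∑∈-linear A c d f g = trans (∑-cong (λ x → pt ⟦ A x ⟧ c d (f x) (g x)))
  (trans (∑-+ _ _) (cong₂ _+_ (sym (*-∑ c _)) (sym (*-∑ d _))))
  where
  pt : ∀ a c d f g → a * (c * f + d * g) ≡ c * (a * f) + d * (a * g)
  pt = solve-∀

∑-⟦∩⟧ : ∀ {n} (A B : VSet n) → ∑ (λ x → ⟦ A x ⟧ * ⟦ B x ⟧) ≡ # (A ∩ B)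
∑-⟦∩⟧ A B = ∑-cong (λ x → sym (⟦∧⟧ (A x) (B x)))

module TriangleFreeGraph {n} (adj : Fin n → Fin n → Bool)
  (adj-sym : ∀ {x y} → adj x y ≡ true → adj y x ≡ true)
  (no△ : ∀ {x y z} → adj x y ≡ true → adj x z ≡ true → ¬ (adj y z ≡ true)) where

  adj-comm : ∀ x y → adj x y ≡ adj y x
  adj-comm x y with adj x y in p | adj y x in q
  ... | true  | true  = refl
  ... | false | false = refl
  ... | true  | false = trans (sym (adj-sym p)) q
  ... | false | true  = trans (sym p) (adj-sym q)

  deg : Fin n → ℕ
  deg x = # (adj x)

  -- Ordered pairs are counted, so an edge with both ends in `P ∩ Q` counts twice; hence the factor
  -- 2 in `edges-within-all`.
  edges : VSet n → VSet n → ℕ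
  edges P Q = ∑ (λ x → ⟦ P x ⟧ * # (adj x ∩ Q))

  edges-sym : ∀ P Q → edges P Q ≡ edges Q P
  edges-sym P Q = trans (∑-cong (λ x → *-∑ ⟦ P x ⟧ _)) (trans (∑-swap _)
    (∑-cong (λ y → trans (∑-cong (λ x → pt x y)) (sym (*-∑ ⟦ Q y ⟧ _)))))
    where
    lem : ∀ p q a → p * (a * q) ≡ q * (a * p)
    lem = solve-∀
    pt : ∀ x y → ⟦ P x ⟧ * ⟦ (adj x ∩ Q) y ⟧ ≡ ⟦ Q y ⟧ * ⟦ (adj y ∩ P) x ⟧
    pt x y = trans (cong (⟦ P x ⟧ *_) (⟦∧⟧ (adj x y) (Q y)))
      (trans (cong (λ z → ⟦ P x ⟧ * (⟦ z ⟧ * ⟦ Q y ⟧)) (adj-comm x y))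
      (trans (lem ⟦ P x ⟧ ⟦ Q y ⟧ ⟦ adj y x ⟧) (cong (⟦ Q y ⟧ *_) (sym (⟦∧⟧ (adj y x) (P x))))))

  nbr-disjoint : ∀ {x y A} → adj x y ≡ true → # (adj x ∩ A) + # (adj y ∩ A) ≤ # A
  nbr-disjoint {x} {y} {A} xy = #-disj {C = A}
    (λ {z} p q → no△ (adj-sym (proj₁ (∩⁻ {adj x z} p))) (adj-sym (proj₁ (∩⁻ {adj y z} q))) xy)
    (λ {z} p → proj₂ (∩⁻ {adj x z} p)) (λ {z} p → proj₂ (∩⁻ {adj y z} p))

  -- Edges inside N(u) ∪ N(v) run between N(u) and N(v).
  module _ (u v : Fin n) where
    private
      U = adj u
      V = adj v

    edges-within : ∀ D → edges (D ∩ (U ∪ V)) (U ∪ V) ≤ edges (U ∩ D) V + edges U (V ∩ D)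
    edges-within D = begin
      edges (D ∩ (U ∪ V)) (U ∪ V)                       ≤⟨ ∑-mono pt ⟩
      ∑ (λ x → ⟦ (U ∩ D) x ⟧ * # (adj x ∩ V) + ⟦ (V ∩ D) x ⟧ * # (adj x ∩ U)) ≡⟨ ∑-+ _ _ ⟩
      edges (U ∩ D) V + edges (V ∩ D) U                 ≡⟨ cong (_+_ (edges (U ∩ D) V)) (edges-sym (V ∩ D) U) ⟩
      edges (U ∩ D) V + edges U (V ∩ D)                 ∎
      where
      open ≤-Reasoning
      pt : ∀ x → ⟦ (D ∩ (U ∪ V)) x ⟧ * # (adj x ∩ (U ∪ V)) ≤
                 ⟦ (U ∩ D) x ⟧ * # (adj x ∩ V) + ⟦ (V ∩ D) x ⟧ * # (adj x ∩ U)
      pt x with D x | U x in ux | V x in vx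
      ... | false | _     | _     = z≤n
      ... | true  | false | false = z≤n
      ... | true  | true  | _     = ≤-trans (*-monoʳ-≤ 1 (#-mono {A = adj x ∩ (U ∪ V)} {adj x ∩ V} f)) (m≤m+n _ _)
        where
        f : adj x ∩ (U ∪ V) ⊑ adj x ∩ V
        f {y} p with ∩⁻ {adj x y} p
        ... | xy , q with ∪⁻ {U y} q
        ... | inj₁ uy = ⊥-elim (no△ ux uy xy)
        ... | inj₂ vy = ∈∩ xy vy
      ... | true  | false | true  = *-monoʳ-≤ 1 (#-mono {A = adj x ∩ (U ∪ V)} {adj x ∩ U} f)
        where
        f : adj x ∩ (U ∪ V) ⊑ adj x ∩ U
        f {y} p with ∩⁻ {adj x y} p
        ... | xy , q with ∪⁻ {U y} q
        ... | inj₁ uy = ∈∩ xy uy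
        ... | inj₂ vy = ⊥-elim (no△ vx vy xy)

    edges-within-all : edges (U ∪ V) (U ∪ V) ≤ 2 * edges U V
    edges-within-all = ≤-trans (edges-within full) (≤-reflexive (trans (cong₂ _+_
      (∑-cong (λ x → cong (λ z → ⟦ z ⟧ * # (adj x ∩ V)) (∧-true (U x))))
      (∑-cong (λ x → cong (⟦ U x ⟧ *_) (∑-cong (λ y → cong (λ z → ⟦ adj x y ∧ z ⟧) (∧-true (V y)))))))
      (cong (_+_ (edges U V)) (sym (+-identityʳ _)))))
      where
      ∧-true : ∀ a → a ∧ true ≡ a
      ∧-true true  = refl
      ∧-true false = refl

    -- N(w) meets each edge between N(u) and N(v) in at most one endpoint.
    edges-within-nbr : ∀ w → edges (adj w ∩ (U ∪ V)) (U ∪ V) ≤ edges U V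
    edges-within-nbr w = ≤-trans (edges-within (adj w)) (≤-trans (≤-reflexive (sym (∑-+ _ _))) (∑-mono pt))
      where
      pt : ∀ x → ⟦ (U ∩ adj w) x ⟧ * # (adj x ∩ V) + ⟦ U x ⟧ * # (adj x ∩ (V ∩ adj w)) ≤ ⟦ U x ⟧ * # (adj x ∩ V)
      pt x with U x | adj w x in wx
      ... | false | _     = z≤n
      ... | true  | true  = ≤-reflexive (trans (cong (_+_ (1 * # (adj x ∩ V)))
                              (trans (*-identityˡ _) none)) (+-identityʳ _))
        where
        none : # (adj x ∩ (V ∩ adj w)) ≡ 0
        none = n≤0⇒n≡0 (≤-trans (#-mono {B = ∅} f) (≤-reflexive (trans (∑-const n 0) (*-zeroʳ n))))
          where
          f : adj x ∩ (V ∩ adj w) ⊑ ∅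
          f {y} p with ∩⁻ {adj x y} p
          ... | xy , q = ⊥-elim (no△ wx (proj₂ (∩⁻ {V y} q)) xy)
      ... | true  | false = *-monoʳ-≤ 1 (#-mono {A = adj x ∩ (V ∩ adj w)} {adj x ∩ V} f)
        where
        f : adj x ∩ (V ∩ adj w) ⊑ adj x ∩ V
        f {y} p with ∩⁻ {adj x y} p
        ... | xy , q = ∈∩ xy (proj₁ (∩⁻ {V y} q))

-- Every edge uv spans many edges between N(u) and N(v)

opaque
  unfolding ∑

  ∑ᶻ : ∀ {n} → (Fin n → ℤ) → ℤ
  ∑ᶻ = ℤΣ.sum

  ∑ᶻ-cong : ∀ {n} {f g : Fin n → ℤ} → (∀ i → f i ≡ g i) → ∑ᶻ f ≡ ∑ᶻ g
  ∑ᶻ-cong = ℤΣ.sum-cong-≗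

  ∑ᶻ-+ : ∀ {n} (f g : Fin n → ℤ) → ∑ᶻ (λ i → f i ℤ.+ g i) ≡ ∑ᶻ f ℤ.+ ∑ᶻ g
  ∑ᶻ-+ = ℤΣ.∑-distrib-+

  *-∑ᶻ : ∀ {n} c (f : Fin n → ℤ) → c ℤ.* ∑ᶻ f ≡ ∑ᶻ (λ i → c ℤ.* f i)
  *-∑ᶻ = ℤΣ.*-distribˡ-sum

  ∑ᶻ-* : ∀ {n} c (f : Fin n → ℤ) → ∑ᶻ f ℤ.* c ≡ ∑ᶻ (λ i → f i ℤ.* c)
  ∑ᶻ-* = ℤΣ.*-distribʳ-sum

  ∑ᶻ-mono : ∀ {n} {f g : Fin n → ℤ} → (∀ i → f i ℤ.≤ g i) → ∑ᶻ f ℤ.≤ ∑ᶻ g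
  ∑ᶻ-mono {zero}  f≤g = ℤₚ.≤-refl
  ∑ᶻ-mono {suc n} f≤g = ℤₚ.+-mono-≤ (f≤g zero) (∑ᶻ-mono (f≤g ∘ suc))

  ∑ᶻ-const : ∀ n c → ∑ᶻ {n} (λ _ → c) ≡ + n ℤ.* c
  ∑ᶻ-const zero    c = sym (ℤₚ.*-zeroˡ c)
  ∑ᶻ-const (suc n) c = trans (cong (λ z → c ℤ.+ z) (∑ᶻ-const n c)) (sym (ℤₚ.suc-* (+ n) c))

  ∑ᶻ-pos : ∀ {n} (f : Fin n → ℕ) → ∑ᶻ (λ i → + f i) ≡ + ∑ f
  ∑ᶻ-pos {zero}  f = refl
  ∑ᶻ-pos {suc n} f = cong (λ z → + f zero ℤ.+ z) (∑ᶻ-pos (f ∘ suc))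

≤ᶻ-by : ∀ {a b X Y} → X ℤ.≤ Y → a ℤ.+ Y ≡ b ℤ.+ X → a ℤ.≤ b
≤ᶻ-by {a} {b} {X} {Y} X≤Y eq = ℤₚ.≤-trans (ℤₚ.≤-reflexive (a≡ a b X Y eq)) (ℤₚ.≤-trans (ℤₚ.+-monoʳ-≤ b (ℤₚ.+-monoˡ-≤ (ℤ.- Y) X≤Y))
    (ℤₚ.≤-reflexive (trans (cong (λ z → b ℤ.+ z) (ℤₚ.+-inverseʳ Y)) (ℤₚ.+-identityʳ b))))
  where
  lem₁ : ∀ a Y → a ≡ (a ℤ.+ Y) ℤ.+ ℤ.- Y
  lem₁ = ℤ-Solver.solve-∀
  lem₂ : ∀ b X Y → b ℤ.+ X ℤ.+ ℤ.- Y ≡ b ℤ.+ (X ℤ.+ ℤ.- Y)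
  lem₂ = ℤ-Solver.solve-∀
  a≡ : ∀ a b X Y → a ℤ.+ Y ≡ b ℤ.+ X → a ≡ b ℤ.+ (X ℤ.+ ℤ.- Y)
  a≡ a b X Y eq = trans (lem₁ a Y) (trans (cong (λ z → z ℤ.+ ℤ.- Y) eq) (lem₂ b X Y))

sq : ℤ → ℤ
sq z = z ℤ.* z

0≤sq : ∀ z → 0ℤ ℤ.≤ sq z
0≤sq (+ zero)   = ℤ.+≤+ z≤n
0≤sq (+ suc k)  = ℤ.+≤+ z≤n
0≤sq (-[1+ k ]) = ℤ.+≤+ z≤n

sq-bound : ∀ {x} m → x ℤ.≤ + m → ℤ.- x ℤ.≤ + m → sq x ℤ.≤ + m ℤ.* + m
sq-bound {+ k} m (ℤ.+≤+ k≤m) _ = subst₂ ℤ._≤_ (ℤₚ.pos-* k k) (ℤₚ.pos-* m m) (ℤ.+≤+ (*-mono-≤ k≤m k≤m))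
sq-bound { -[1+ k ]} m _ (ℤ.+≤+ k≤m) = subst (λ z → sq -[1+ k ] ℤ.≤ z) (ℤₚ.pos-* m m) (ℤ.+≤+ (*-mono-≤ k≤m k≤m))

∑∑ : ∀ {n} → (Fin n → Fin n → ℤ) → ℤ
∑∑ M = ∑ᶻ (λ a → ∑ᶻ (M a))

∑∑-cong : ∀ {n} {M N : Fin n → Fin n → ℤ} → (∀ a b → M a b ≡ N a b) → ∑∑ M ≡ ∑∑ N
∑∑-cong p = ∑ᶻ-cong (λ a → ∑ᶻ-cong (p a))

∑∑-mono : ∀ {n} {M N : Fin n → Fin n → ℤ} → (∀ a b → M a b ℤ.≤ N a b) → ∑∑ M ℤ.≤ ∑∑ N
∑∑-mono p = ∑ᶻ-mono (λ a → ∑ᶻ-mono (p a))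

∑∑-+ : ∀ {n} (M N : Fin n → Fin n → ℤ) → ∑∑ (λ a b → M a b ℤ.+ N a b) ≡ ∑∑ M ℤ.+ ∑∑ N
∑∑-+ M N = trans (∑ᶻ-cong (λ a → ∑ᶻ-+ (M a) (N a))) (∑ᶻ-+ _ _)

*-∑∑ : ∀ {n} c (M : Fin n → Fin n → ℤ) → c ℤ.* ∑∑ M ≡ ∑∑ (λ a b → c ℤ.* M a b)
*-∑∑ c M = trans (*-∑ᶻ c _) (∑ᶻ-cong (λ a → *-∑ᶻ c (M a)))

∑∑-product : ∀ {n} (f g : Fin n → ℤ) → ∑∑ (λ a b → f a ℤ.* g b) ≡ ∑ᶻ f ℤ.* ∑ᶻ g
∑∑-product f g = sym (trans (∑ᶻ-* (∑ᶻ g) f) (∑ᶻ-cong (λ a → *-∑ᶻ (f a) g)))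

∑∑-const : ∀ n c → ∑∑ {n} (λ _ _ → c) ≡ + n ℤ.* (+ n ℤ.* c)
∑∑-const n c = trans (∑ᶻ-cong (λ _ → ∑ᶻ-const n c)) (∑ᶻ-const n _)

0≤∑∑ : ∀ {n} {M : Fin n → Fin n → ℤ} → (∀ a b → 0ℤ ℤ.≤ M a b) → 0ℤ ℤ.≤ ∑∑ M
0≤∑∑ {n} {M} p = ℤₚ.≤-trans (ℤₚ.≤-reflexive (sym (trans (∑∑-const n 0ℤ) (trans (cong (λ z → + n ℤ.* z) (ℤₚ.*-zeroʳ (+ n))) (ℤₚ.*-zeroʳ (+ n)))))) (∑∑-mono p)

module Spread {n} (adj : Fin n → Fin n → Bool)
  (adj-sym : ∀ {x y} → adj x y ≡ true → adj y x ≡ true)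
  (no△ : ∀ {x y z} → adj x y ≡ true → adj x z ≡ true → ¬ (adj y z ≡ true)) where

  open TriangleFreeGraph adj adj-sym no△

  i : Fin n → Fin n → ℤ
  i x a = + ⟦ adj x a ⟧

  z : Fin n → Fin n → Fin n → ℤ
  z u v a = i u a ℤ.+ ℤ.- i v a

  Q : Fin n → Fin n → ℤ
  Q a b = 1ℤ ℤ.+ ℤ.- (+ 2 ℤ.* i a b)

  -- The quadratic form of `M` at `f`, that is, the inner product of `M` with the rank-one matrix f
  -- fᵀ.
  corr : (Fin n → Fin n → ℤ) → (Fin n → ℤ) → ℤ
  corr M f = ∑∑ (λ a b → M a b ℤ.* (f a ℤ.* f b))

  ∑∑-path : ∀ u v → ∑∑ (λ a b → i u a ℤ.* i a b ℤ.* i v b) ≡ + edges (adj u) (adj v)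
  ∑∑-path u v = trans (∑ᶻ-cong (λ a → trans (∑ᶻ-cong (pt a)) (trans (∑ᶻ-pos _) (cong +_ (sym (*-∑ ⟦ adj u a ⟧ _))))))
    (∑ᶻ-pos (λ a → ⟦ adj u a ⟧ * # (adj a ∩ adj v)))
    where
    pt : ∀ a b → i u a ℤ.* i a b ℤ.* i v b ≡ + (⟦ adj u a ⟧ * ⟦ (adj a ∩ adj v) b ⟧)
    pt a b = trans (cong (λ w → w ℤ.* i v b) (sym (ℤₚ.pos-* ⟦ adj u a ⟧ ⟦ adj a b ⟧)))
      (trans (sym (ℤₚ.pos-* (⟦ adj u a ⟧ * ⟦ adj a b ⟧) ⟦ adj v b ⟧))
      (cong +_ (trans (*-assoc ⟦ adj u a ⟧ ⟦ adj a b ⟧ ⟦ adj v b ⟧) (cong (⟦ adj u a ⟧ *_) (sym (⟦∧⟧ (adj a b) (adj v b)))))))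

  -- N(u) and N(v) are independent, so on an edge ab the product z a * z b only sees pairs split by u and v.
  Q-pointwise : ∀ u v a b → Q a b ℤ.* (z u v a ℤ.* z u v b) ≡
    z u v a ℤ.* z u v b ℤ.+ + 2 ℤ.* (i u a ℤ.* i a b ℤ.* i v b ℤ.+ i v a ℤ.* i a b ℤ.* i u b)
  Q-pointwise u v a b = trans (lem (i u a) (i u b) (i v a) (i v b) (i a b))
    (trans (cong₂ (λ p q → R ℤ.+ ℤ.- (+ 2 ℤ.* (p ℤ.+ q))) (none u) (none v)) (ℤₚ.+-identityʳ R))
    where
    R = z u v a ℤ.* z u v b ℤ.+ + 2 ℤ.* (i u a ℤ.* i a b ℤ.* i v b ℤ.+ i v a ℤ.* i a b ℤ.* i u b)
    lem : ∀ ua ub va vb ab →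
      (1ℤ ℤ.+ ℤ.- (+ 2 ℤ.* ab)) ℤ.* ((ua ℤ.+ ℤ.- va) ℤ.* (ub ℤ.+ ℤ.- vb)) ≡
      ((ua ℤ.+ ℤ.- va) ℤ.* (ub ℤ.+ ℤ.- vb) ℤ.+ + 2 ℤ.* (ua ℤ.* ab ℤ.* vb ℤ.+ va ℤ.* ab ℤ.* ub))
        ℤ.+ ℤ.- (+ 2 ℤ.* (ua ℤ.* ab ℤ.* ub ℤ.+ va ℤ.* ab ℤ.* vb))
    lem = ℤ-Solver.solve-∀
    none : ∀ w → i w a ℤ.* i a b ℤ.* i w b ≡ 0ℤ
    none w with adj w a in wa | adj a b in ab | adj w b in wb
    ... | false | true  | true  = refl
    ... | false | true  | false = refl
    ... | false | false | true  = refl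
    ... | false | false | false = refl
    ... | true  | false | true  = refl
    ... | true  | false | false = refl
    ... | true  | true  | false = refl
    ... | true  | true  | true  = ⊥-elim (no△ wa wb ab)

  -- The form equals the square of `∑ᶻ (z u v)` plus four times the edge count; the square is
  -- dropped.
  Q-large : ∀ u v → + 4 ℤ.* + edges (adj u) (adj v) ℤ.≤ corr Q (z u v)
  Q-large u v = ℤₚ.≤-trans (ℤₚ.≤-trans (ℤₚ.≤-reflexive (lem E)) (ℤₚ.+-monoˡ-≤ (+ 2 ℤ.* (E ℤ.+ E)) (0≤sq (∑ᶻ (z u v)))))
    (ℤₚ.≤-reflexive (sym (trans (∑∑-cong (Q-pointwise u v)) (trans (∑∑-+ _ _)
      (cong₂ ℤ._+_ (∑∑-product (z u v) (z u v))
        (trans (sym (*-∑∑ (+ 2) _)) (cong (λ w → + 2 ℤ.* w) (trans (∑∑-+ _ _)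
          (cong₂ ℤ._+_ (∑∑-path u v) (trans (∑∑-path v u) (cong +_ (edges-sym (adj v) (adj u)))))))))))))
    where
    E = + edges (adj u) (adj v)
    lem : ∀ E → + 4 ℤ.* E ≡ 0ℤ ℤ.+ + 2 ℤ.* (E ℤ.+ E)
    lem = ℤ-Solver.solve-∀

  -- The pairing of `z u v` with the indicator of the neighbourhood of `x`, shifted by `# (adj v)`
  -- into the range from 0 to `n` so that natural division can round it; in `pairing` the shift
  -- cancels.
  val : Fin n → Fin n → Fin n → ℕ
  val u v x = # (adj u ∩ adj x) + # (adj v ∩ ∁ (adj x))

  val≤n : ∀ {u v} x → adj u v ≡ true → val u v x ≤ n
  val≤n {u} {v} x uv = ≤-trans (#-disj {A = adj u ∩ adj x} {adj v ∩ ∁ (adj x)} {full}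
    (λ {a} p q → not⁻ (proj₂ (∩⁻ {adj v a} q)) (proj₂ (∩⁻ {adj u a} p))) (λ _ → refl) (λ _ → refl)) (≤-reflexive (#-full n))

  val-pairing : ∀ u v x → ∑ᶻ (λ a → z u v a ℤ.* i x a) ℤ.+ + # (adj v) ≡ + val u v x
  val-pairing u v x = trans (cong (λ w → ∑ᶻ (λ a → z u v a ℤ.* i x a) ℤ.+ w) (sym (∑ᶻ-pos (⟦_⟧ ∘ adj v))))
    (trans (sym (∑ᶻ-+ _ _)) (trans (∑ᶻ-cong pt) (trans (∑ᶻ-+ _ _) (cong₂ ℤ._+_ (∑ᶻ-pos (⟦_⟧ ∘ (adj u ∩ adj x))) (∑ᶻ-pos (⟦_⟧ ∘ (adj v ∩ ∁ (adj x))))))))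
    where
    pt : ∀ a → z u v a ℤ.* i x a ℤ.+ i v a ≡ + ⟦ (adj u ∩ adj x) a ⟧ ℤ.+ + ⟦ (adj v ∩ ∁ (adj x)) a ⟧
    pt a with adj u a | adj v a | adj x a
    ... | false | false | false = refl
    ... | false | false | true  = refl
    ... | false | true  | false = refl
    ... | false | true  | true  = refl
    ... | true  | false | false = refl
    ... | true  | false | true  = refl
    ... | true  | true  | false = refl
    ... | true  | true  | true  = refl

  pairing : ∀ u v x y → ∑ᶻ (λ a → z u v a ℤ.* z x y a) ≡ + val u v x ℤ.+ ℤ.- + val u v y
  pairing u v x y = trans (trans (∑ᶻ-cong pt) (trans (∑ᶻ-+ _ _) (cong (λ w → ∑ᶻ (λ a → z u v a ℤ.* i x a) ℤ.+ w)
      (trans (sym (*-∑ᶻ (ℤ.- 1ℤ) _)) (ℤₚ.-1*i≡-i _)))))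
    (trans (lem (∑ᶻ (λ a → z u v a ℤ.* i x a)) (∑ᶻ (λ a → z u v a ℤ.* i y a)) (+ # (adj v))) (cong₂ (λ p q → p ℤ.+ ℤ.- q) (val-pairing u v x) (val-pairing u v y)))
    where
    pt : ∀ a → z u v a ℤ.* z x y a ≡ z u v a ℤ.* i x a ℤ.+ ℤ.- 1ℤ ℤ.* (z u v a ℤ.* i y a)
    pt a = lem (z u v a) (i x a) (i y a)
      where
      lem : ∀ p q r → p ℤ.* (q ℤ.+ ℤ.- r) ≡ p ℤ.* q ℤ.+ ℤ.- 1ℤ ℤ.* (p ℤ.* r)
      lem = ℤ-Solver.solve-∀
    lem : ∀ p q r → p ℤ.+ ℤ.- q ≡ (p ℤ.+ r) ℤ.+ ℤ.- (q ℤ.+ r)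
    lem = ℤ-Solver.solve-∀

  z² : ∀ u v a b → sq (z u v a ℤ.* z u v b) ℤ.≤ 1ℤ
  z² u v a b with adj u a | adj v a | adj u b | adj v b
  ... | false | false | _     | _     = ℤ.+≤+ z≤n
  ... | true  | true  | _     | _     = ℤ.+≤+ z≤n
  ... | false | true  | false | false = ℤ.+≤+ z≤n
  ... | false | true  | true  | true  = ℤ.+≤+ z≤n
  ... | false | true  | false | true  = ℤ.+≤+ (s≤s z≤n)
  ... | false | true  | true  | false = ℤ.+≤+ (s≤s z≤n)
  ... | true  | false | false | false = ℤ.+≤+ z≤n
  ... | true  | false | true  | true  = ℤ.+≤+ z≤n
  ... | true  | false | false | true  = ℤ.+≤+ (s≤s z≤n)
  ... | true  | false | true  | false = ℤ.+≤+ (s≤s z≤n)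

  same-quotient : ∀ {p q m} r → (p * r) / suc m ≡ (q * r) / suc m → + r ℤ.* (+ p ℤ.+ ℤ.- + q) ℤ.≤ + m
  same-quotient {p} {q} {m} r eq = ≤ᶻ-by (ℤ.+≤+ pr≤) (trans (cong (λ w → + r ℤ.* (+ p ℤ.+ ℤ.- + q) ℤ.+ w) pos-qr)
    (trans (lem (+ r) (+ p) (+ q) (+ m)) (cong (λ w → + m ℤ.+ w) (sym (ℤₚ.pos-* p r)))))
    where
    lem : ∀ r p q m → r ℤ.* (p ℤ.+ ℤ.- q) ℤ.+ (q ℤ.* r ℤ.+ m) ≡ m ℤ.+ p ℤ.* r
    lem = ℤ-Solver.solve-∀
    pos-qr : + (q * r + m) ≡ + q ℤ.* + r ℤ.+ + m
    pos-qr = cong (λ w → w ℤ.+ + m) (ℤₚ.pos-* q r)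
    pr≤ : p * r ≤ q * r + m
    pr≤ = begin
      p * r                                      ≡⟨ m≡m%n+[m/n]*n (p * r) (suc m) ⟩
      p * r % suc m + p * r / suc m * suc m      ≤⟨ +-mono-≤ (ℕ.s≤s⁻¹ (m%n<n (p * r) (suc m))) (≤-reflexive (cong (_* suc m) eq)) ⟩
      m + q * r / suc m * suc m                  ≤⟨ +-monoʳ-≤ m (≤-trans (m≤n+m _ (q * r % suc m)) (≤-reflexive (sym (m≡m%n+[m/n]*n (q * r) (suc m))))) ⟩
      m + q * r                                  ≡⟨ +-comm m (q * r) ⟩
      q * r + m                                  ∎
      where open ≤-Reasoning

  module _ (r : ℕ) .{{_ : NonZero r}} (good : ∀ {u v} → adj u v ≡ true → n * n ≤ 56 * edges (adj u) (adj v)) where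

    N K : ℤ
    N = + n ℤ.* + n
    K = + r ℤ.* + r

    -- The weight 18 is s/14 for the number s = 252 of stages that is ruled out.
    energy : (Fin n → Fin n → ℤ) → ℤ
    energy F = ∑∑ (λ a b → sq (+ 18 ℤ.* Q a b ℤ.+ ℤ.- F a b))

    -- The energy in units of `N`, times `7 * K`. The norm of 18 Q gives 324; a stage adds 1 for z
    -- zᵀ itself, at most `2 * s / K` for its correlation with `F`, and at most -36/14 for that with
    -- `Q`, in all `2 * s / K` - 11/7.
    bound : ℕ → ℤ
    bound zero    = + 7 ℤ.* (K ℤ.* + 324)
    bound (suc s) = bound s ℤ.+ (+ 14 ℤ.* + s ℤ.+ ℤ.- (+ 11 ℤ.* K))

    -- F is a sum of s matrices z zᵀ.
    record Stage (s : ℕ) : Set where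
      field
        F          : Fin n → Fin n → ℤ
        class      : Fin n → Fin (r ^ s)
        low-energy : + 7 ℤ.* (K ℤ.* energy F) ℤ.≤ N ℤ.* bound s
        indistinct : ∀ {x y} → class x ≡ class y → K ℤ.* corr F (z x y) ℤ.≤ + s ℤ.* N

    Q²≡1 : ∀ a b → sq (+ 18 ℤ.* Q a b ℤ.+ ℤ.- 0ℤ) ≡ + 324
    Q²≡1 a b with adj a b
    ... | true  = refl
    ... | false = refl

    stage₀ : Stage 0
    stage₀ = record
      { F = λ _ _ → 0ℤ
      ; class = λ _ → zero
      ; low-energy = ℤₚ.≤-reflexive (trans (cong (λ w → + 7 ℤ.* (K ℤ.* w)) (trans (∑∑-cong Q²≡1) (∑∑-const n (+ 324)))) (lem K (+ n) (+ 324)))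
      ; indistinct = λ {x} {y} _ → ℤₚ.≤-reflexive (trans (cong (K ℤ.*_) (trans (∑∑-cong {N = λ _ _ → 0ℤ} (λ a b → ℤₚ.*-zeroˡ (z x y a ℤ.* z x y b))) (∑∑-const n 0ℤ)))
                                      (lem′ K (+ n))) }
      where
      lem : ∀ K n w → + 7 ℤ.* (K ℤ.* (n ℤ.* (n ℤ.* w))) ≡ n ℤ.* n ℤ.* (+ 7 ℤ.* (K ℤ.* w))
      lem = ℤ-Solver.solve-∀
      lem′ : ∀ K n → K ℤ.* (n ℤ.* (n ℤ.* 0ℤ)) ≡ 0ℤ ℤ.* (n ℤ.* n)
      lem′ = ℤ-Solver.solve-∀

    module Refine {s} (S : Stage s) {u v : Fin n} (uv : adj u v ≡ true) where
      open Stage S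

      -- `val` can equal `n`; dividing by `suc n` keeps the quotient below `r`.
      bucket-bound : ∀ x → val u v x * r / suc n < r
      bucket-bound x = m<n*o⇒m/o<n (≤-<-trans (≤-reflexive (*-comm (val u v x) r)) (*-monoʳ-< r (s≤s (val≤n x uv))))

      bucket : Fin n → Fin r
      bucket x = Fin.fromℕ< (bucket-bound x)

      F′ : Fin n → Fin n → ℤ
      F′ a b = F a b ℤ.+ z u v a ℤ.* z u v b

      class′ : Fin n → Fin (r ^ suc s)
      class′ x = Fin.combine (bucket x) (class x)

      close : ∀ {x y} → bucket x ≡ bucket y → K ℤ.* sq (∑ᶻ (λ a → z u v a ℤ.* z x y a)) ℤ.≤ N
      close {x} {y} eq = ℤₚ.≤-trans (ℤₚ.≤-reflexive (trans (cong (λ w → K ℤ.* sq w) (pairing u v x y)) (lem (+ r) (+ val u v x ℤ.+ ℤ.- + val u v y))))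
        (sq-bound n (same-quotient {val u v x} {val u v y} {n} r quot) (ℤₚ.≤-trans (ℤₚ.≤-reflexive (lem′ (+ r) (+ val u v x) (+ val u v y))) (same-quotient {val u v y} {val u v x} {n} r (sym quot))))
        where
        lem : ∀ r d → r ℤ.* r ℤ.* (d ℤ.* d) ≡ (r ℤ.* d) ℤ.* (r ℤ.* d)
        lem = ℤ-Solver.solve-∀
        lem′ : ∀ r p q → ℤ.- (r ℤ.* (p ℤ.+ ℤ.- q)) ≡ r ℤ.* (q ℤ.+ ℤ.- p)
        lem′ = ℤ-Solver.solve-∀
        quot : val u v x * r / suc n ≡ val u v y * r / suc n
        quot = trans (sym (Finₚ.toℕ-fromℕ< (bucket-bound x))) (trans (cong Fin.toℕ eq) (Finₚ.toℕ-fromℕ< (bucket-bound y)))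

      indistinct′ : ∀ {x y} → class′ x ≡ class′ y → K ℤ.* corr F′ (z x y) ℤ.≤ + suc s ℤ.* N
      indistinct′ {x} {y} eq with Finₚ.combine-injective (bucket x) (class x) (bucket y) (class y) eq
      ... | eqb , eqc = ℤₚ.≤-trans (ℤₚ.≤-reflexive (trans (cong (K ℤ.*_) split) (ℤₚ.*-distribˡ-+ K _ _)))
          (ℤₚ.≤-trans (ℤₚ.+-mono-≤ (indistinct eqc) (close eqb)) (ℤₚ.≤-reflexive (trans (ℤₚ.+-comm (+ s ℤ.* N) N) (sym (ℤₚ.suc-* (+ s) N)))))
        where
        lem : ∀ f za zb wa wb → (f ℤ.+ za ℤ.* zb) ℤ.* (wa ℤ.* wb) ≡ f ℤ.* (wa ℤ.* wb) ℤ.+ (za ℤ.* wa) ℤ.* (zb ℤ.* wb)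
        lem = ℤ-Solver.solve-∀
        split : corr F′ (z x y) ≡ corr F (z x y) ℤ.+ sq (∑ᶻ (λ a → z u v a ℤ.* z x y a))
        split = trans (∑∑-cong (λ a b → lem (F a b) (z u v a) (z u v b) (z x y a) (z x y b)))
          (trans (∑∑-+ _ _) (cong (λ w → corr F (z x y) ℤ.+ w) (∑∑-product (λ a → z u v a ℤ.* z x y a) (λ a → z u v a ℤ.* z x y a))))

      -- The entries of z zᵀ are at most 1 in absolute value, so its own square costs at most `N`;
      -- the cross terms stay exact.
      energy′ : energy F′ ℤ.≤ energy F ℤ.+ ((ℤ.- + 36) ℤ.* corr Q (z u v) ℤ.+ (+ 2 ℤ.* corr F (z u v) ℤ.+ N))
      energy′ = ℤₚ.≤-trans (∑∑-mono pt) (ℤₚ.≤-reflexive (trans (∑∑-+ _ _) (cong (λ w → energy F ℤ.+ w) (trans (∑∑-+ _ _)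
        (cong₂ ℤ._+_ (sym (*-∑∑ (ℤ.- + 36) _)) (trans (∑∑-+ _ _) (cong₂ ℤ._+_ (sym (*-∑∑ (+ 2) _)) (trans (∑∑-const n 1ℤ) (cong (λ w → + n ℤ.* w) (ℤₚ.*-identityʳ (+ n)))))))))))
        where
        lem : ∀ q f x → (+ 18 ℤ.* q ℤ.+ ℤ.- (f ℤ.+ x)) ℤ.* (+ 18 ℤ.* q ℤ.+ ℤ.- (f ℤ.+ x)) ≡
              (+ 18 ℤ.* q ℤ.+ ℤ.- f) ℤ.* (+ 18 ℤ.* q ℤ.+ ℤ.- f) ℤ.+ ((ℤ.- + 36) ℤ.* (q ℤ.* x) ℤ.+ (+ 2 ℤ.* (f ℤ.* x) ℤ.+ x ℤ.* x))
        lem = ℤ-Solver.solve-∀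
        pt : ∀ a b → sq (+ 18 ℤ.* Q a b ℤ.+ ℤ.- F′ a b) ℤ.≤ sq (+ 18 ℤ.* Q a b ℤ.+ ℤ.- F a b) ℤ.+
             ((ℤ.- + 36) ℤ.* (Q a b ℤ.* (z u v a ℤ.* z u v b)) ℤ.+ (+ 2 ℤ.* (F a b ℤ.* (z u v a ℤ.* z u v b)) ℤ.+ 1ℤ))
        pt a b = ℤₚ.≤-trans (ℤₚ.≤-reflexive (lem (Q a b) (F a b) (z u v a ℤ.* z u v b)))
          (ℤₚ.+-monoʳ-≤ (sq (+ 18 ℤ.* Q a b ℤ.+ ℤ.- F a b)) (ℤₚ.+-monoʳ-≤ ((ℤ.- + 36) ℤ.* (Q a b ℤ.* (z u v a ℤ.* z u v b)))
            (ℤₚ.+-monoʳ-≤ (+ 2 ℤ.* (F a b ℤ.* (z u v a ℤ.* z u v b))) (z² u v a b))))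

      N≤14Q : N ℤ.≤ + 14 ℤ.* corr Q (z u v)
      N≤14Q = ℤₚ.≤-trans (ℤₚ.≤-trans (ℤₚ.≤-reflexive (sym (ℤₚ.pos-* n n))) (ℤₚ.≤-trans (ℤ.+≤+ (good uv))
        (ℤₚ.≤-reflexive (trans (ℤₚ.pos-* 56 (edges (adj u) (adj v))) (ℤₚ.*-assoc (+ 14) (+ 4) (+ edges (adj u) (adj v)))))))
        (ℤₚ.*-monoˡ-≤-nonNeg (+ 14) (Q-large u v))

      instance
        K-nonNeg : ℤ.NonNegative K
        K-nonNeg = ℤ.nonNegative (0≤sq (+ r))

      -- Here it matters that `u` and `v` share a class: `indistinct` limits the correlation of the
      -- new matrix with the earlier ones to `s * N / K`.
      low-energy′ : class u ≡ class v → + 7 ℤ.* (K ℤ.* energy F′) ℤ.≤ N ℤ.* bound (suc s)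
      low-energy′ eq = ≤ᶻ-by (ℤₚ.+-mono-≤ (ℤₚ.*-monoˡ-≤-nonNeg (+ 7) (ℤₚ.*-monoˡ-≤-nonNeg K energy′))
          (ℤₚ.+-mono-≤ low-energy (ℤₚ.+-mono-≤ (ℤₚ.*-monoˡ-≤-nonNeg (+ 14) (indistinct eq)) (ℤₚ.*-monoˡ-≤-nonNeg (+ 18) (ℤₚ.*-monoˡ-≤-nonNeg K N≤14Q)))))
        (lem (energy F′) (energy F) (corr Q (z u v)) (corr F (z u v)) K N (bound s) (+ s))
        where
        lem : ∀ e′ e q f K N B s → + 7 ℤ.* (K ℤ.* e′) ℤ.+ (+ 7 ℤ.* (K ℤ.* (e ℤ.+ ((ℤ.- + 36) ℤ.* q ℤ.+ (+ 2 ℤ.* f ℤ.+ N)))) ℤ.+ (N ℤ.* B ℤ.+ (+ 14 ℤ.* (s ℤ.* N) ℤ.+ + 18 ℤ.* (K ℤ.* (+ 14 ℤ.* q))))) ≡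
              N ℤ.* (B ℤ.+ (+ 14 ℤ.* s ℤ.+ ℤ.- (+ 11 ℤ.* K))) ℤ.+ (+ 7 ℤ.* (K ℤ.* e′) ℤ.+ (+ 7 ℤ.* (K ℤ.* e) ℤ.+ (+ 14 ℤ.* (K ℤ.* f) ℤ.+ + 18 ℤ.* (K ℤ.* N))))
        lem = ℤ-Solver.solve-∀

    stages : ∀ s → (∃ λ t → t ≤ s × Col adj (r ^ t) full) ⊎ Stage s
    stages zero    = inj₂ stage₀
    stages (suc s) with stages s
    ... | inj₁ (t , t≤s , col) = inj₁ (t , m≤n⇒m≤1+n t≤s , col)
    ... | inj₂ S with Finₚ.any? (λ u → some? (λ v → adj u v ∧ does (Stage.class S u Fin.≟ Stage.class S v)))
    ... | yes (u , v , p) = let uv , q = ∩⁻ {adj u v} p in inj₂ (record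
          { F = Refine.F′ S uv ; class = Refine.class′ S uv
          ; low-energy = Refine.low-energy′ S uv (does⁻ (Stage.class S u Fin.≟ Stage.class S v) q)
          ; indistinct = Refine.indistinct′ S uv })
    ... | no none = inj₁ (s , n≤1+n s , Stage.class S , λ {u} {v} _ _ uv eq →
          none (u , v , ∈∩ uv (dec-true (Stage.class S u Fin.≟ Stage.class S v) eq)))

    spread-colouring : 0 < n → ∀ s → bound s ℤ.< 0ℤ → ∃ λ t → t ≤ s × Col adj (r ^ t) full
    spread-colouring n>0 s neg with stages s
    ... | inj₁ r = r
    ... | inj₂ S = ⊥-elim (ℤₚ.<⇒≱ too-low (ℤₚ.≤-trans nonneg (Stage.low-energy S)))
      where
      instance
        N-pos : ℤ.Positive N
        N-pos = subst ℤ.Positive (ℤₚ.pos-* n n) (ℤ.positive (ℤ.+<+ (*-mono-≤ n>0 n>0)))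
        K-nonNeg : ℤ.NonNegative K
        K-nonNeg = ℤ.nonNegative (0≤sq (+ r))
      nonneg : 0ℤ ℤ.≤ + 7 ℤ.* (K ℤ.* energy (Stage.F S))
      nonneg = ℤₚ.≤-trans (ℤₚ.≤-reflexive (sym (cong (+ 7 ℤ.*_) (ℤₚ.*-zeroʳ K))))
        (ℤₚ.*-monoˡ-≤-nonNeg (+ 7) (ℤₚ.*-monoˡ-≤-nonNeg K (0≤∑∑ (λ a b → 0≤sq (+ 18 ℤ.* Q a b ℤ.+ ℤ.- Stage.F S a b)))))
      too-low : N ℤ.* bound s ℤ.< 0ℤ
      too-low = subst (λ w → N ℤ.* bound s ℤ.< w) (ℤₚ.*-zeroʳ N) (ℤₚ.*-monoˡ-<-pos N neg)

-- Some edge uv spans few edges between N(u) and N(v)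

-- `c` is at most about `n / 3`, so `y ≤ c / 2` leaves about half of the degree to `x`.
x-lower : ∀ {n x y c T} → n ≤ 3 * (x + y) + 3 * T → 2 * y ≤ c → 3 * c ≤ n + 6 * T → n ≤ 6 * x + 12 * T
x-lower {n} {x} {y} {c} {T} p q r = ≤-by 0 (+-mono-≤ (*-monoʳ-≤ 2 p) (+-mono-≤ (*-monoʳ-≤ 3 q) r)) (lem n x y c T)
  where
  lem : ∀ n x y c T → n + (2 * (3 * (x + y) + 3 * T) + (3 * c + (n + 6 * T))) + 0 ≡ (6 * x + 12 * T) + (2 * n + (3 * (2 * y) + 3 * c))
  lem = solve-∀

1+≤ : ∀ {a b} → ¬ (a ≤ b) → 1 + b ≤ a
1+≤ = ≰⇒>

-- Absorbs the error terms: 10000 is at least every product `j * k` met below, which each use checks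
-- by evaluation.
lower-T : ∀ j k T n {_ : True (j * k ≤? 10000)} → 10000 * T ≤ n → j * (k * T) ≤ n
lower-T j k T n {jk≤} hT = ≤-trans (≤-reflexive (sym (*-assoc j k T))) (≤-trans (*-monoˡ-≤ T (toWitness jk≤)) hT)

-- The quadratic x (n/3 - x) stays above e as long as x is between n/6 and 2n/9.
no-middle : ∀ {n x y c T e} → x * (n + 3 * y) ≤ x * (3 * T + 3 * c) + 3 * e →
            9 * T + 9 * c + n ≤ 3 * n + 9 * y + 36 * T → n ≤ 6 * x + 12 * T → x ≤ n →
            1 + 56 * e ≤ n * n → 10000 * T ≤ n → ⊥
no-middle {n} {x} {y} {c} {T} {e} A Q h x≤n bad hT = <⇒≱ (s≤s z≤n) s₃
  where
  lem₁ : ∀ n x y c T e → x * n + (3 * (x * (3 * T + 3 * c) + 3 * e) + x * (3 * n + 9 * y + 36 * T)) + 0 ≡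
         (9 * e + 36 * (x * T)) + (3 * (x * (n + 3 * y)) + x * (9 * T + 9 * c + n))
  lem₁ = solve-∀
  s₁ : x * n ≤ 9 * e + 36 * (x * T)
  s₁ = ≤-by 0 (+-mono-≤ (*-monoʳ-≤ 3 A) (*-monoʳ-≤ x Q)) (lem₁ n x y c T e)
  lem₂ : ∀ n x T e → n * n + (n * (6 * x + 12 * T) + (6 * (9 * e + 36 * (x * T)) + 216 * T * n)) + 0 ≡
         (54 * e + n * (228 * T)) + (n * n + (6 * (x * n) + 216 * T * x))
  lem₂ = solve-∀
  s₂ : n * n ≤ 54 * e + n * (228 * T)
  s₂ = ≤-by 0 (+-mono-≤ (*-monoʳ-≤ n h) (+-mono-≤ (*-monoʳ-≤ 6 s₁) (*-monoʳ-≤ (216 * T) x≤n))) (lem₂ n x T e)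
  lem₃ : ∀ n t e → 27 + (28 * (54 * e + n * t) + (27 * (n * n) + n * n)) + 0 ≡
         0 + (28 * (n * n) + (27 * (1 + 56 * e) + n * (28 * t)))
  lem₃ = solve-∀
  s₃ : 27 ≤ 0
  s₃ = ≤-by 0 (+-mono-≤ (*-monoʳ-≤ 28 s₂) (+-mono-≤ (*-monoʳ-≤ 27 bad) (*-monoʳ-≤ n (lower-T 28 228 T n hT)))) (lem₃ n (228 * T) e)

-- Otherwise the degree bound makes `y` at least about `n / 9`, and `c - y` falls below `2 n / 9` up
-- to terms in `T`, which `no-middle` forbids.
x-large : ∀ {n x y c T e} → x * (n + 3 * y) ≤ x * (3 * T + 3 * c) + 3 * e →
          n ≤ 3 * (x + y) + 3 * T → 2 * y ≤ c → 3 * c ≤ n + 6 * T → x ≤ n →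
          1 + 56 * e ≤ n * n → 10000 * T ≤ n → 2 * n ≤ 9 * x
x-large {n} {x} {y} {c} {T} {e} A D Y C x≤n bad hT with 2 * n ≤? 9 * x
... | yes p = p
... | no ¬p = ⊥-elim (no-middle {n} {x} {y} {c} {T} {e} A
    (≤-by 1 (+-mono-≤ (*-monoʳ-≤ 3 C) (+-mono-≤ (*-monoʳ-≤ 3 D) (1+≤ ¬p))) (lem n x y c T)) (x-lower {n} {x} {y} {c} {T} D Y C) x≤n bad hT)
  where
  lem : ∀ n x y c T → (9 * T + 9 * c + n) + (3 * (n + 6 * T) + (3 * (3 * (x + y) + 3 * T) + 2 * n)) + 1 ≡
        (3 * n + 9 * y + 36 * T) + (3 * (3 * c) + (3 * n + (1 + 9 * x)))
  lem = solve-∀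

y-small : ∀ {n x y c T e} → x * (n + 3 * y) ≤ x * (3 * T + 3 * c) + 3 * e →
          n ≤ 3 * (x + y) + 3 * T → 2 * y ≤ c → 3 * c ≤ n + 6 * T → x ≤ n →
          1 + 56 * e ≤ n * n → 10000 * T ≤ n → 9 * y + 2 * n ≤ 9 * c
y-small {n} {x} {y} {c} {T} {e} A D Y C x≤n bad hT with 9 * y + 2 * n ≤? 9 * c
... | yes p = p
... | no ¬p = ⊥-elim (no-middle {n} {x} {y} {c} {T} {e} A
    (≤-by (27 * T + 1) (1+≤ ¬p) (lem n x y c T)) (x-lower {n} {x} {y} {c} {T} D Y C) x≤n bad hT)
  where
  lem : ∀ n x y c T → (9 * T + 9 * c + n) + (9 * y + 2 * n) + (27 * T + 1) ≡
        (3 * n + 9 * y + 36 * T) + (1 + 9 * c)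
  lem = solve-∀

>0 : ∀ {n e} → 1 + 56 * e ≤ n * n → 0 < n
>0 {suc n} _ = s≤s z≤n

-- p counts vertices of B₀ that miss at least 2n/9 of the c vertices of C₀.
few-defects : ∀ {n b c p N e T} → b ≤ n → b * n ≤ 6 * e + 3 * N + b * (3 * T) → 9 * N + 2 * n * p ≤ b * (9 * c) →
              3 * c ≤ n + 6 * T → 1 + 56 * e ≤ n * n → 56 * p ≤ 9 * n + 756 * T
few-defects {n} {b} {c} {p} {N} {e} {T} b≤n M P C bad =
  *-cancelˡ-≤ n {{ℕ.>-nonZero (>0 {n} {e} bad)}} (≤-by 9
    (+-mono-≤ (*-monoʳ-≤ 84 M) (+-mono-≤ (*-monoʳ-≤ 28 P) (+-mono-≤ (*-monoʳ-≤ 84 (*-monoʳ-≤ b C))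
      (+-mono-≤ (*-monoʳ-≤ 9 bad) (*-monoʳ-≤ (756 * T) b≤n))))) (lem n b c p N e T))
  where
  lem : ∀ n b c p N e T → n * (56 * p) + (84 * (6 * e + 3 * N + b * (3 * T)) + (28 * (b * (9 * c)) + (84 * (b * (n + 6 * T)) + (9 * (n * n) + 756 * T * n)))) + 9 ≡
        n * (9 * n + 756 * T) + (84 * (b * n) + (28 * (9 * N + 2 * n * p) + (84 * (b * (3 * c)) + (9 * (1 + 56 * e) + 756 * T * b))))
  lem = solve-∀

-- 2/9 - 9/56 = 31/504 exceeds 1/18 = 28/504; the difference 3/504 pays for `T`.
β-large : ∀ {n x p β T} → 2 * n ≤ 9 * x → x ≤ β + p → 56 * p ≤ 9 * n + 756 * T → 10000 * T ≤ n → n ≤ 18 * β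
β-large {n} {x} {p} {β} {T} X B P hT = *-cancelˡ-≤ 56
  (≤-by 0 (+-mono-≤ (*-monoʳ-≤ 112 X) (+-mono-≤ (*-monoʳ-≤ 1008 B) (+-mono-≤ (*-monoʳ-≤ 18 P)
    (*-monoʳ-≤ 6 (lower-T 3 756 T n hT))))) (lem n x p β (756 * T)))
  where
  lem : ∀ n x p β t → 56 * n + (112 * (9 * x) + (1008 * (β + p) + (18 * (9 * n + t) + 6 * n))) + 0 ≡
        56 * (18 * β) + (112 * (2 * n) + (1008 * x + (18 * (56 * p) + 6 * (3 * t))))
  lem = solve-∀

-- The slack k of 3 c₀ ≤ n + 6 T enters with the favourable sign because 2 n ≤ 9 b.
c-large : ∀ {n b c₀ c q N e T} → b + c₀ ≡ n → b * n ≤ 6 * e + 3 * N + b * (3 * T) → 9 * N + 2 * n * q ≤ c₀ * (9 * b) →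
          c₀ ≤ q + c → 3 * c₀ ≤ n + 6 * T → 1 + 56 * e ≤ n * n → 10000 * T ≤ n → 29 * n ≤ 168 * c + 1932 * T
c-large {n} {b} {c₀} {c} {q} {N} {e} {T} b+c₀ M Q cover C bad hT =
  *-cancelˡ-≤ 2 (*-cancelˡ-≤ n {{ℕ.>-nonZero (>0 {n} {e} bad)}} (≤-by 54
    (+-mono-≤ (*-monoʳ-≤ 56 s₄) (*-monoʳ-≤ 54 bad)) (lem₅ n c T e)))
  where
  k = n + 6 * T ∸ 3 * c₀
  k-eq : 3 * c₀ + k ≡ n + 6 * T
  k-eq = m+[n∸m]≡n C
  b≤n : b ≤ n
  b≤n = ≤-trans (m≤m+n b c₀) (≤-reflexive b+c₀)
  lem₁ : ∀ n b c₀ T → 2 * n + (3 * (b + c₀) + (n + 6 * T)) + 0 ≡ (3 * b + 6 * T) + (3 * n + 3 * c₀)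
  lem₁ = solve-∀
  s₁ : 2 * n ≤ 3 * b + 6 * T
  s₁ = ≤-by 0 (+-mono-≤ (*-monoʳ-≤ 3 (≤-reflexive (sym b+c₀))) C) (lem₁ n b c₀ T)
  lem₂ : ∀ n b T → 2 * n + (3 * (3 * b + 6 * T) + 4 * n) + 2 * T ≡ 9 * b + (3 * (2 * n) + 4 * (1 * (5 * T)))
  lem₂ = solve-∀
  s₂ : 2 * n ≤ 9 * b
  s₂ = ≤-by (2 * T) (+-mono-≤ (*-monoʳ-≤ 3 s₁) (*-monoʳ-≤ 4 (lower-T 1 5 T n hT))) (lem₂ n b T)
  lem₃ : ∀ n b c₀ c q N e T →
         2 * (n * (3 * c₀)) + 9 * (b * n) + (9 * (6 * e + 3 * N + b * (3 * T)) + (3 * (c₀ * (9 * b)) + 6 * n * (q + c))) + 0 ≡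
         6 * (n * c) + 9 * (b * (3 * c₀)) + 54 * e + 27 * (b * T) + (9 * (b * n) + (3 * (9 * N + 2 * n * q) + 6 * n * c₀))
  lem₃ = solve-∀
  s₃ : 2 * (n * (3 * c₀)) + 9 * (b * n) ≤ 6 * (n * c) + 9 * (b * (3 * c₀)) + 54 * e + 27 * (b * T)
  s₃ = ≤-by 0 (+-mono-≤ (*-monoʳ-≤ 9 M) (+-mono-≤ (*-monoʳ-≤ 3 Q) (*-monoʳ-≤ (6 * n) cover))) (lem₃ n b c₀ c q N e T)
  -- Applied with d = 3 c₀ and d + k = n + 6 T.
  lem₄ : ∀ n b c e T k d →
         2 * (n * n) + 12 * (n * T) +
           ((6 * (n * c) + 9 * (b * d) + 54 * e + 27 * (b * T)) + (9 * b * k + (54 * T * n + (27 * T * n + (2 * n * (d + k) + 9 * b * (n + 6 * T)))))) + 0 ≡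
         (6 * (n * c) + 81 * (n * T) + 54 * e) +
           ((2 * (n * d) + 9 * (b * n)) + (2 * n * k + (54 * T * b + (27 * T * b + (2 * n * (n + 6 * T) + 9 * b * (d + k))))))
  lem₄ = solve-∀
  s₄ : 2 * (n * n) + 12 * (n * T) ≤ 6 * (n * c) + 81 * (n * T) + 54 * e
  s₄ = ≤-by 0 (+-mono-≤ s₃ (+-mono-≤ (*-monoˡ-≤ k s₂) (+-mono-≤ (*-monoʳ-≤ (54 * T) b≤n) (+-mono-≤ (*-monoʳ-≤ (27 * T) b≤n)
         (+-mono-≤ (*-monoʳ-≤ (2 * n) (≤-reflexive (sym k-eq))) (*-monoʳ-≤ (9 * b) (≤-reflexive k-eq)))))))
       (lem₄ n b c e T k (3 * c₀))
  lem₅ : ∀ n c T e → n * (2 * (29 * n)) + (56 * (6 * (n * c) + 81 * (n * T) + 54 * e) + 54 * (n * n)) + 54 ≡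
         n * (2 * (168 * c + 1932 * T)) + (56 * (2 * (n * n) + 12 * (n * T)) + 54 * (1 + 56 * e))
  lem₅ = solve-∀

too-long : ∀ {n t} → n ≤ t → 2 * t ≤ n → ¬ (0 < n)
too-long {n} {t} n≤t 2t≤n n>0 = <⇒≱ n>0 (≤-by 0 (+-mono-≤ (*-monoʳ-≤ 2 n≤t) 2t≤n) (lem n t))
  where
  lem : ∀ n t → n + (2 * t + n) + 0 ≡ 0 + (2 * n + 2 * t)
  lem = solve-∀

small-h : ∀ {n c h T} → h + 6 * n ≤ 18 * (c + T + h) → 1 + h ≤ 108 * T → n ≤ 3 * c + 309 * T
small-h {n} {c} {h} {T} H h< = *-cancelˡ-≤ 6 (≤-by 17 (+-mono-≤ H (*-monoʳ-≤ 17 h<)) (lem n c h T))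
  where
  lem : ∀ n c h T → 6 * n + (18 * (c + T + h) + 17 * (108 * T)) + 17 ≡ 6 * (3 * c + 309 * T) + ((h + 6 * n) + 17 * (1 + h))
  lem = solve-∀

-- With `c` near `n / 3`, the bound `l * c′` is near `2 l n / 3`, which is `n / 3` short of the
-- degree sum. So `n` is at most `315 l T + 3 T`, and `l ≤ 2 * M` turns this into 630 + 3.
short-walk : ∀ {n c c′ T l M} → (1 + (l + l)) * n ≤ 3 * (l * c′) + 3 * ((1 + (l + l)) * T) → n ≤ 3 * c + 309 * T →
             c + c′ ≤ n → l ≤ 2 * M → T ≤ M * T → n ≤ 633 * (M * T)
short-walk {n} {c} {c′} {T} {l} {M} W N cc′ l≤ T≤ = ≤-by 0 (+-mono-≤ W (+-mono-≤ (*-monoʳ-≤ l N)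
    (+-mono-≤ (*-monoʳ-≤ (3 * l) cc′) (+-mono-≤ (*-monoʳ-≤ (315 * T) l≤) (*-monoʳ-≤ 3 T≤))))) (lem n c c′ T l M)
  where
  lem : ∀ n c c′ T l M → n + ((3 * (l * c′) + 3 * ((1 + (l + l)) * T)) + (l * (3 * c + 309 * T) + (3 * l * n + (315 * T * (2 * M) + 3 * (M * T))))) + 0 ≡
        633 * (M * T) + ((1 + (l + l)) * n + (l * n + (3 * l * (c + c′) + (315 * T * l + 3 * T))))
  lem = solve-∀

-- The origin of 72 and 108: `18 * (s + t)` is below `h / 2`, and `54 * T` is at most `h / 2`.
two-low : ∀ {h s t T} → h ≤ 18 * (s + t) + 54 * T → 108 * T ≤ h → 1 + 72 * s ≤ h → ¬ (1 + 72 * t ≤ h)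
two-low {h} {s} {t} {T} E T≤ S S′ = <⇒≱ (s≤s z≤n) 2≤0
  where
  lem : ∀ h s t T → 2 + (4 * (18 * (s + t) + 54 * T) + (2 * h + (h + h))) + 0 ≡
        0 + (4 * h + (2 * (108 * T) + ((1 + 72 * s) + (1 + 72 * t))))
  lem = solve-∀
  2≤0 : 2 ≤ 0
  2≤0 = ≤-by 0 (+-mono-≤ (*-monoʳ-≤ 4 E) (+-mono-≤ (*-monoʳ-≤ 2 T≤) (+-mono-≤ S S′))) (lem h s t T)

half-≤ : ∀ {s l f} → 2 * s ≤ l + l + f → f ≤ 1 → s ≤ l
half-≤ {s} {l} p f≤1 = ℕ.s≤s⁻¹ (*-cancelˡ-< 2 s (suc l) (≤-<-trans p (≤-<-trans (+-monoʳ-≤ (l + l) f≤1) (≤-reflexive (lem l)))))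
  where
  lem : ∀ l → 1 + (l + l + 1) ≡ 2 * (1 + l)
  lem = solve-∀

-- Colouring by common neighbours in the absence of 5-cycles

module NearbyClasses {n} (e : Fin n → Fin n → Bool) (e-sym : ∀ {x y} → e x y ≡ true → e y x ≡ true)
  (no-5-cycle : ∀ {z x y} → Walk e z 2 x → Walk e z 2 y → ¬ (e x y ≡ true))
  (H : VSet n) (nbr : ∀ {x y} → e x y ≡ true → y ∈ H) (m : ℕ) where

  near : Fin n → VSet n
  near z w = some (e w ∩ e z)

  near-walk : ∀ {z w} → w ∈ near z → Walk e z 2 w
  near-walk {z} {w} p = let y , q = some⁻ (e w ∩ e z) p ; wy , zy = ∩⁻ {e w y} q in step (step stay zy) (e-sym wy)

  -- Both vertices are two steps away from `z`, so an edge between them closes a walk of length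
  -- five.
  near-indep : ∀ {z A} → Independent e (A ∩ near z)
  near-indep {z} {A} {x} {y} p q = no-5-cycle (near-walk {z} {x} (proj₂ (∩⁻ {A x} p))) (near-walk {z} {y} (proj₂ (∩⁻ {A y} q)))

  split-near : ∀ A z → A ⊑ (A ∩ near z) ∪ (A ∖ near z)
  split-near A z {w} w∈A with ∈? (near z w)
  ... | inj₁ p = ∈∪ˡ (∈∩ w∈A p)
  ... | inj₂ p = ∈∪ʳ {(A ∩ near z) w} (∈∩ w∈A p)

  -- Y collects the disjoint neighbourhoods of the centres chosen so far.
  greedy : ∀ k (A Y : VSet n) → (∀ {w} → w ∈ A → 1 ≤ # H × # H ≤ m * # (e w)) → Y ⊑ H →
           (∀ {w y} → w ∈ A → y ∈ e w → y ∉ Y) → m * # H ≤ m * # Y + k * # H → Col e (suc k) A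
  greedy k A Y dense Y⊑ apart inv with some? A
  greedy k A Y dense Y⊑ apart inv | no none = (λ _ → zero) , λ {s} p → ⊥-elim (none (s , p))
  -- Every earlier centre has used up at least `# H / m` vertices. At `k = 0` the set `Y` has
  -- exhausted `H`, leaving no room for the neighbours of one more centre.
  greedy zero A Y dense Y⊑ apart inv | yes (z , z∈A) = ⊥-elim (<⇒≱ h>0 (≤-trans h≤mN
      (+-cancelˡ-≤ (m * # Y) _ _ (≤-trans full-H (≤-trans inv ≤-refl)))))
    where
    h>0 : 1 ≤ # H
    h>0 = proj₁ (dense {z} z∈A)
    h≤mN : # H ≤ m * # (e z)
    h≤mN = proj₂ (dense {z} z∈A)
    full-H : m * # Y + m * # (e z) ≤ m * # H
    full-H = ≤-trans (≤-reflexive (sym (*-distribˡ-+ m (# Y) (# (e z)))))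
      (*-monoʳ-≤ m (#-disj {A = Y} {e z} {H} (λ {y} p q → apart {z} {y} z∈A q p) (λ {y} → Y⊑ {y}) (λ {y} → nbr {z} {y})))
  greedy (suc k) A Y dense Y⊑ apart inv | yes (z , z∈A) =
    col-⊑ {B = (A ∩ near z) ∪ (A ∖ near z)} (λ {w} → split-near A z {w})
      (col-∪ (col-indep (λ {x} {y} → near-indep {z} {A} {x} {y}))
        (greedy k (A ∖ near z) (Y ∪ e z) (λ {w} p → dense {w} (proj₁ (∩⁻ {A w} p)))
          (λ {y} p → [ Y⊑ {y} , nbr {z} {y} ]′ (∪⁻ {Y y} p)) (λ {w} {y} → apart′ {w} {y}) inv′))
    where
    apart′ : ∀ {w y} → w ∈ A ∖ near z → y ∈ e w → y ∉ Y ∪ e z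
    apart′ {w} {y} p y∈ q with ∪⁻ {Y y} q
    ... | inj₁ y∈Y = apart {w} {y} (proj₁ (∩⁻ {A w} p)) y∈ y∈Y
    ... | inj₂ y∈z = not⁻ (proj₂ (∩⁻ {A w} p)) (some⁺ (e w ∩ e z) (∈∩ y∈ y∈z))
    grow : # Y + # (e z) ≤ # (Y ∪ e z)
    grow = #-disj {A = Y} {e z} {Y ∪ e z} (λ {y} p q → apart {z} {y} z∈A q p) ∈∪ˡ (λ {y} → ∈∪ʳ {Y y})
    inv′ : m * # H ≤ m * # (Y ∪ e z) + k * # H
    inv′ = begin
      m * # H                                  ≤⟨ inv ⟩
      m * # Y + (# H + k * # H)                ≤⟨ +-monoʳ-≤ (m * # Y) (+-monoˡ-≤ (k * # H) (proj₂ (dense {z} z∈A))) ⟩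
      m * # Y + (m * # (e z) + k * # H)        ≡⟨ +-assoc (m * # Y) _ _ ⟨
      m * # Y + m * # (e z) + k * # H          ≡⟨ cong (_+ k * # H) (*-distribˡ-+ m (# Y) (# (e z))) ⟨
      m * (# Y + # (e z)) + k * # H            ≤⟨ +-monoˡ-≤ (k * # H) (*-monoʳ-≤ m grow) ⟩
      m * # (Y ∪ e z) + k * # H                ∎
      where open ≤-Reasoning

  greedy-colouring : ∀ A → (∀ {w} → w ∈ A → 1 ≤ # H × # H ≤ m * # (e w)) → Col e (suc m) A
  greedy-colouring A dense = greedy m A ∅ dense (λ ()) (λ _ _ ()) (m≤n+m (m * # H) (m * # {n} ∅))

-- Colouring a graph that has a bad edge

module _ {n} (adj : Fin n → Fin n → Bool)
  (adj-sym : ∀ {x y} → adj x y ≡ true → adj y x ≡ true)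
  (no△ : ∀ {x y z} → adj x y ≡ true → adj x z ≡ true → ¬ (adj y z ≡ true))
  (T : ℕ) (large : ∀ v → n ≤ 3 * # (adj v) + 3 * T) (hT : 10000 * T ≤ n) where

  open TriangleFreeGraph adj adj-sym no△

  -- The structure forced by a bad edge: B and C are independent, C has more than n/6 vertices,
  -- and the remaining vertices form H, which sends no edges to C.
  module Tripartition (n>0 : 0 < n) (B C H : VSet n)
    (cover      : ∀ w → w ∈ B ⊎ w ∈ C ⊎ w ∈ H)
    (parts      : # B + # C + # H ≤ n)
    (B-indep    : Independent adj B)
    (C-indep    : Independent adj C)
    (nbr-of-B   : ∀ {w z} → w ∈ B → adj w z ≡ true → z ∈ C ⊎ z ∈ H)
    (nbr-of-H   : ∀ {w z} → w ∈ H → adj w z ≡ true → z ∈ B ∪ H)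
    (nbr-of-H∉C : ∀ {w z} → w ∈ H → adj w z ≡ true → z ∉ C)
    (H-nbr      : ∀ {w} → w ∈ H → ∃ λ z → adj w z ≡ true × z ∈ H)
    (β-large′   : ∀ {w} → w ∈ H → n ≤ 18 * # (adj w ∩ B))
    (c-large′   : 29 * n ≤ 168 * # C + 1932 * T) where

    b = # B
    c = # C
    h = # H

    β d : Fin n → ℕ
    β w = # (adj w ∩ B)
    d w = # (adj w ∩ H)

    -- Counting edges between B and H: every b ∈ B has all but c neighbours in H,
    -- while w ∈ H leaves at least n/18 vertices of B to any neighbour in H.
    H-lower : ∀ {w} → w ∈ H → h + 6 * n ≤ 18 * (c + T + h)
    H-lower {w} w∈H = *-cancelˡ-≤ b {{ℕ.>-nonZero b>0}}
      (≤-by 0 (+-mono-≤ (*-monoʳ-≤ 6 from-B) (+-mono-≤ from-H (*-monoʳ-≤ h (#≤n B)))) (lem n b c h T (edges H B)))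
      where
      b>0 : 0 < b
      b>0 = *-cancelˡ-< 18 0 b (≤-trans n>0 (≤-trans (β-large′ {w} w∈H)
        (*-monoʳ-≤ 18 (#-mono {A = adj w ∩ B} {B} (λ {z} q → proj₂ (∩⁻ {adj w z} q))))))
      lem : ∀ n b c h T E → b * (h + 6 * n) + (6 * (b * (3 * (c + T)) + 3 * E) + (h * (18 * b) + h * n)) + 0 ≡
            b * (18 * (c + T + h)) + (6 * (b * n) + ((18 * E + h * n) + h * b))
      lem = solve-∀
      from-B : b * n ≤ b * (3 * (c + T)) + 3 * edges H B
      from-B = begin
        b * n
          ≤⟨ ∑∈-lower B (λ s → 1 * (3 * (c + T)) + 3 * d s) n (λ {s} q → pt {s} q) ⟩
        ∑ (λ s → ⟦ B s ⟧ * (1 * (3 * (c + T)) + 3 * d s))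
          ≡⟨ ∑∈-linear B 1 3 (λ _ → 3 * (c + T)) d ⟩
        1 * ∑ (λ s → ⟦ B s ⟧ * (3 * (c + T))) + 3 * edges B H
          ≡⟨ cong₂ _+_ (trans (*-identityˡ _) (sym (∑-* (3 * (c + T)) (⟦_⟧ ∘ B)))) (cong (3 *_) (edges-sym B H)) ⟩
        b * (3 * (c + T)) + 3 * edges H B ∎
        where
        open ≤-Reasoning
        lem′ : ∀ n D c ds T → n + ((3 * D + 3 * T) + 3 * (c + ds)) + 0 ≡ (1 * (3 * (c + T)) + 3 * ds) + (n + 3 * D)
        lem′ = solve-∀
        pt : ∀ {s} → s ∈ B → n ≤ 1 * (3 * (c + T)) + 3 * d s
        pt {s} s∈B = ≤-by 0 (+-mono-≤ (large s) (*-monoʳ-≤ 3 (#-cover {A = C} {adj s ∩ H} {adj s} (λ {z} → cov {z})))) (lem′ n (deg s) c (d s) T)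
          where
          cov : ∀ {z} → adj s z ≡ true → z ∈ C ⊎ z ∈ adj s ∩ H
          cov {z} sz with nbr-of-B {s} {z} s∈B sz
          ... | inj₁ r = inj₁ r
          ... | inj₂ r = inj₂ (∈∩ sz r)
      from-H : 18 * edges H B + h * n ≤ h * (18 * b)
      from-H = ≤-trans (≤-reflexive (sym (trans (∑∈-linear H 18 1 β (λ _ → n))
          (cong (_+_ (18 * edges H B)) (trans (*-identityˡ _) (sym (∑-* n (⟦_⟧ ∘ H))))))))
        (∑∈-bound H _ (18 * b) (λ {s} q → pt {s} q))
        where
        lem′ : ∀ n bs bz b → (18 * bs + 1 * n) + (18 * b + 18 * bz) + 0 ≡ 18 * b + (18 * (bs + bz) + n)
        lem′ = solve-∀
        pt : ∀ {s} → s ∈ H → 18 * β s + 1 * n ≤ 18 * b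
        pt {s} s∈H with H-nbr {s} s∈H
        ... | z , sz , z∈H = ≤-by 0 (+-mono-≤ (*-monoʳ-≤ 18 (nbr-disjoint {s} {z} {B} sz)) (β-large′ {z} z∈H)) (lem′ n (β s) (β z) b)

    -- Adjacent vertices have disjoint neighbourhoods in `B`, and `# B` is at most `n - c - h`. So
    -- `d s + d t` is at least about `c + h - n / 3`, which by `H-lower` is at least `h / 18` up to
    -- terms in `T`.
    H-edge : ∀ {s t} → s ∈ H → t ∈ H → adj s t ≡ true → h ≤ 18 * (d s + d t) + 54 * T
    H-edge {s} {t} s∈H t∈H st = ≤-by 0 (+-mono-≤ (H-lower {s} s∈H) (+-mono-≤ (*-monoʳ-≤ 6 (large s)) (+-mono-≤ (*-monoʳ-≤ 6 (large t))
        (+-mono-≤ (*-monoʳ-≤ 18 (within {s} s∈H)) (+-mono-≤ (*-monoʳ-≤ 18 (within {t} t∈H))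
        (+-mono-≤ (*-monoʳ-≤ 18 (nbr-disjoint {s} {t} {B} st)) (*-monoʳ-≤ 18 parts)))))))
      (lem n b c h T (deg s) (deg t) (β s) (β t) (d s) (d t))
      where
      within : ∀ {w} → w ∈ H → deg w ≤ β w + d w
      within {w} w∈H = #-cover {A = adj w ∩ B} {adj w ∩ H} {adj w} cov
        where
        cov : ∀ {z} → adj w z ≡ true → z ∈ adj w ∩ B ⊎ z ∈ adj w ∩ H
        cov {z} wz with ∪⁻ {B z} (nbr-of-H {w} {z} w∈H wz)
        ... | inj₁ r = inj₁ (∈∩ wz r)
        ... | inj₂ r = inj₂ (∈∩ wz r)
      lem : ∀ n b c h T Ds Dt βs βt ds dt →
        h + (18 * (c + T + h) + (6 * (3 * Ds + 3 * T) + (6 * (3 * Dt + 3 * T) + (18 * (βs + ds) + (18 * (βt + dt) + (18 * b + 18 * n)))))) + 0 ≡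
        (18 * (ds + dt) + 54 * T) + ((h + 6 * n) + (6 * n + (6 * n + (18 * Ds + (18 * Dt + (18 * (βs + βt) + 18 * (b + c + h)))))))
      lem = solve-∀

    eH : Fin n → Fin n → Bool
    eH s t = adj s t ∧ (H s ∧ H t)

    eH-sym : ∀ {s t} → eH s t ≡ true → eH t s ≡ true
    eH-sym {s} {t} q = let st , r = ∩⁻ {adj s t} q ; s∈ , t∈ = ∩⁻ {H s} r in ∈∩ (adj-sym st) (∈∩ t∈ s∈)

    walk-start : ∀ {s i t} → Walk eH s i t → t ∈ H → s ∈ H
    walk-start stay t∈H = t∈H
    walk-start {t = t} (step {a = a} w q) t∈H = walk-start w (proj₁ (∩⁻ {H a} (proj₂ (∩⁻ {adj a t} q))))

    -- g z is the number of vertices of the walk, apart from the first, that are adjacent to z.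
    walk-count : ∀ {s i t} → Walk eH s i t → Σ (Fin n → ℕ) λ g →
      (∀ z → 2 * g z + ⟦ adj s z ⟧ ≤ i + ⟦ adj t z ⟧) × (∀ {z} → z ∈ C → g z ≡ 0) × i * n ≤ 3 * ∑ g + 3 * (i * T)
    walk-count {s} stay = (λ _ → 0) , (λ z → ≤-refl) , (λ _ → refl) , z≤n
    walk-count {s} {suc i} {t} (step {a = a} w q) with walk-count w
    ... | g , half , g∉C , total = (λ z → g z + ⟦ adj t z ⟧) , half′ , g′∉C , total′
      where
      at : adj a t ≡ true
      at = proj₁ (∩⁻ {adj a t} q)
      t∈H : t ∈ H
      t∈H = proj₂ (∩⁻ {H a} (proj₂ (∩⁻ {adj a t} q)))
      lem : ∀ g f i x y → 2 * (g + y) + f + ((i + x) + 1) + 0 ≡ (1 + i + y) + ((2 * g + f) + (x + y))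
      lem = solve-∀
      half′ : ∀ z → 2 * (g z + ⟦ adj t z ⟧) + ⟦ adj s z ⟧ ≤ 1 + i + ⟦ adj t z ⟧
      half′ z = ≤-by 0 (+-mono-≤ (half z) (⟦⟧-disj {adj a z} {adj t z} {true}
        (λ { (az , tz) → no△ at az tz }) (λ _ → refl) (λ _ → refl)))
        (lem (g z) ⟦ adj s z ⟧ i ⟦ adj a z ⟧ ⟦ adj t z ⟧)
      g′∉C : ∀ {z} → z ∈ C → g z + ⟦ adj t z ⟧ ≡ 0
      g′∉C {z} z∈C = cong₂ _+_ (g∉C {z} z∈C) (⟦⟧-false {adj t z} (not⁺ λ tz → nbr-of-H∉C {t} {z} t∈H tz z∈C))
      lem′ : ∀ n i G D T → (n + i * n) + ((3 * G + 3 * (i * T)) + (3 * D + 3 * T)) + 0 ≡ 3 * (G + D) + 3 * (T + i * T) + (i * n + n)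
      lem′ = solve-∀
      total′ : n + i * n ≤ 3 * ∑ (λ z → g z + ⟦ adj t z ⟧) + 3 * (T + i * T)
      total′ = ≤-trans (≤-by 0 (+-mono-≤ total (large t)) (lem′ n i (∑ g) (deg t) T))
        (≤-reflexive (cong (λ z → 3 * z + 3 * (T + i * T)) (sym (∑-+ g (⟦_⟧ ∘ adj t)))))

    -- Both walks start at `s`, which neither `g` nor `g′` counts, so it is added once. The two
    -- `half` estimates, and the fact that `z` sees at most one end of the closing edge, bound twice
    -- the count by `l + l + 1`; parity leaves `l`.
    odd-closed-walk : ∀ {s l i j a a′} → i + j ≡ l + l → Walk eH s i a → Walk eH s j a′ → eH a a′ ≡ true →
      (1 + (l + l)) * n ≤ 3 * (l * # (∁ C)) + 3 * ((1 + (l + l)) * T)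
    odd-closed-walk {s} {l} {i} {j} {a} {a′} i+j w w′ q with walk-count w | walk-count w′
    ... | g , half , g∉C , total | g′ , half′ , g′∉C , total′ =
      ≤-trans (≤-reflexive (cong (λ z → (1 + z) * n) (sym i+j)))
      (≤-trans (≤-by 0 (+-mono-≤ total (+-mono-≤ total′ (+-mono-≤ (large s) (*-monoʳ-≤ 3 count)))) (lem n i j (∑ g) (∑ g′) (deg s) T (l * # (∁ C))))
        (≤-reflexive (cong (λ z → 3 * (l * # (∁ C)) + 3 * ((1 + z) * T)) i+j)))
      where
      aa′ : adj a a′ ≡ true
      aa′ = proj₁ (∩⁻ {adj a a′} q)
      a∈H : a ∈ H
      a∈H = proj₁ (∩⁻ {H a} (proj₂ (∩⁻ {adj a a′} q)))
      s∈H : s ∈ H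
      s∈H = walk-start w a∈H
      lem : ∀ n i j G G′ D T L → (1 + (i + j)) * n + ((3 * G + 3 * (i * T)) + ((3 * G′ + 3 * (j * T)) + ((3 * D + 3 * T) + 3 * L))) + 0 ≡
            3 * L + 3 * ((1 + (i + j)) * T) + (i * n + (j * n + (n + 3 * (D + G + G′))))
      lem = solve-∀
      lem₁ : ∀ f g g′ i j x y → 2 * (f + g + g′) + ((i + x) + (j + y)) + 0 ≡ (i + j + (x + y)) + ((2 * g + f) + (2 * g′ + f))
      lem₁ = solve-∀
      pt : ∀ z → ⟦ adj s z ⟧ + g z + g′ z ≤ l * ⟦ ∁ C z ⟧
      pt z with ∈? (C z)
      ... | inj₁ z∈C = ≤-trans (≤-reflexive (cong₂ _+_ (cong₂ _+_ (⟦⟧-false {adj s z} (not⁺ λ sz → nbr-of-H∉C {s} {z} s∈H sz z∈C)) (g∉C {z} z∈C)) (g′∉C {z} z∈C))) z≤n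
      ... | inj₂ z∉C = ≤-trans (half-≤ {f = ⟦ adj a z ⟧ + ⟦ adj a′ z ⟧}
          (≤-trans (≤-by 0 (+-mono-≤ (half z) (half′ z)) (lem₁ ⟦ adj s z ⟧ (g z) (g′ z) i j ⟦ adj a z ⟧ ⟦ adj a′ z ⟧))
            (≤-reflexive (cong (_+ (⟦ adj a z ⟧ + ⟦ adj a′ z ⟧)) i+j)))
          (⟦⟧-disj {adj a z} {adj a′ z} {true} (λ { (az , a′z) → no△ aa′ az a′z }) (λ _ → refl) (λ _ → refl)))
        (≤-reflexive (sym (trans (cong (l *_) (⟦⟧-true z∉C)) (*-identityʳ l))))
      count : deg s + ∑ g + ∑ g′ ≤ l * # (∁ C)
      count = begin
        deg s + ∑ g + ∑ g′                        ≡⟨ cong (_+ ∑ g′) (∑-+ (⟦_⟧ ∘ adj s) g) ⟨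
        ∑ (λ z → ⟦ adj s z ⟧ + g z) + ∑ g′        ≡⟨ ∑-+ (λ z → ⟦ adj s z ⟧ + g z) g′ ⟨
        ∑ (λ z → ⟦ adj s z ⟧ + g z + g′ z)        ≤⟨ ∑-mono pt ⟩
        ∑ (λ z → l * ⟦ ∁ C z ⟧)                   ≡⟨ *-∑ l (⟦_⟧ ∘ ∁ C) ⟨
        l * # (∁ C)                               ∎
        where open ≤-Reasoning

    -- For `l = 2` the walk bound reads `5 n ≤ 6 (n - c) + 15 T`; multiplied by 28 and combined with
    -- `c-large′` it becomes `140 n ≤ 139 n + 2352 T`.
    no-5-cycle : ∀ {s i j a a′} → i + j ≡ 4 → Walk eH s i a → Walk eH s j a′ → ¬ (eH a a′ ≡ true)
    no-5-cycle i+j w w′ q = too-long {n} {2352 * T} n≤ (lower-T 2 2352 T n hT) n>0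
      where
      lem : ∀ n c c′ T → n + (28 * (3 * (2 * c′) + 3 * ((1 + (2 + 2)) * T)) + ((168 * c + 1932 * T) + 168 * n)) + 0 ≡
            2352 * T + (28 * ((1 + (2 + 2)) * n) + (29 * n + 168 * (c + c′)))
      lem = solve-∀
      n≤ : n ≤ 2352 * T
      n≤ = ≤-by 0 (+-mono-≤ (*-monoʳ-≤ 28 (odd-closed-walk {l = 2} i+j w w′ q))
        (+-mono-≤ c-large′ (*-monoʳ-≤ 168 (≤-reflexive (#-∁ C))))) (lem n c (# (∁ C)) T)

    module SmallH (h< : 1 + h ≤ 108 * T) (m L : ℕ) .{{_ : NonZero m}} .{{_ : NonZero L}}
                  (long : 2 * (633 * (L * m * T)) ≤ n) where

      no-odd : NoOddClosedWalk eH (2 * (L * m))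
      no-odd {s} {l} {i} {j} {a} {a′} l≤ i+j w w′ q = too-long {n} {633 * (L * m * T)} n≤ long n>0
        where
        n≤ : n ≤ 633 * (L * m * T)
        n≤ = short-walk {n} {c} {# (∁ C)} {T} {l} {L * m} (odd-closed-walk {l = l} i+j w w′ q)
          (small-h {n} {c} {h} {T} (H-lower {a} (proj₁ (∩⁻ {H a} (proj₂ (∩⁻ {adj a a′} q))))) h<)
          (≤-reflexive (#-∁ C)) l≤ (m≤n*m T (L * m) {{m*n≢0 L m}})

      H-colourable : ∀ k → h + h < 2 ^ L → h < m ^ k → Col adj (1 + k) H
      H-colourable k h<2^L h<m^k = proj₁ col , λ {s} {t} s∈ t∈ st →
        proj₂ col {s} {t} (∈∪ˡ s∈) (∈∪ˡ t∈) (∈∩ st (∈∩ s∈ t∈))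
        where
        col : Col eH (suc k) (H ∪ ∅)
        col = Carving.kst eH (λ {s} {t} → eH-sym {s} {t}) m L no-odd k {H} {∅} (λ ()) h<2^L h<m^k

    module BigH (h≥ : 108 * T ≤ h) where

      low high : VSet n
      low w  = H w ∧ does (72 * d w <? h)
      high w = H w ∧ not (does (72 * d w <? h))

      low-indep : Independent adj low
      low-indep {s} {t} p q st = two-low {h} {d s} {d t} {T}
        (H-edge {s} {t} (proj₁ (∩⁻ {H s} p)) (proj₁ (∩⁻ {H t} q)) st) h≥ (below {s} p) (below {t} q)
        where
        below : ∀ {w} → w ∈ low → 1 + 72 * d w ≤ h
        below {w} r = does⁻ (72 * d w <? h) (proj₂ (∩⁻ {H w} r))

      high⁻ : ∀ {w} → w ∈ high → w ∈ H × h ≤ 72 * d w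
      high⁻ {w} r = let w∈H , q = ∩⁻ {H w} r in w∈H , ≮⇒≥ (λ lt → not⁻ q (dec-true (72 * d w <? h) lt))

      high-colourable : Col adj 73 high
      high-colourable = proj₁ col , λ {s} {t} s∈ t∈ st →
        proj₂ col {s} {t} s∈ t∈ (∈∩ st (∈∩ (proj₁ (high⁻ {s} s∈)) (proj₁ (high⁻ {t} t∈))))
        where
        nbr : ∀ {w z} → eH w z ≡ true → z ∈ H
        nbr {w} {z} q = proj₂ (∩⁻ {H w} (proj₂ (∩⁻ {adj w z} q)))
        dense : ∀ {w} → w ∈ high → 1 ≤ h × h ≤ 72 * # (eH w)
        dense {w} p = let w∈H , h≤ = high⁻ {w} p in #-∈ {A = H} w∈H ,
          ≤-trans h≤ (*-monoʳ-≤ 72 (#-mono {A = adj w ∩ H} {eH w} (λ {z} q → let wz , z∈H = ∩⁻ {adj w z} q in ∈∩ wz (∈∩ w∈H z∈H))))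
        col : Col eH 73 high
        col = NearbyClasses.greedy-colouring eH (λ {s} {t} → eH-sym {s} {t}) (λ {z} {s} {t} → no-5-cycle {z} {2} {2} refl) H (λ {w} {z} → nbr {w} {z}) 72 high (λ {w} → dense {w})

      H-colourable : Col adj 74 H
      H-colourable = col-⊑ {B = low ∪ high} (λ {w} → cov {w}) (col-∪ (col-indep low-indep)
        high-colourable)
        where
        cov : H ⊑ low ∪ high
        cov {w} p with ∈? (does (72 * d w <? h))
        ... | inj₁ q = ∈∪ˡ (∈∩ p q)
        ... | inj₂ q = ∈∪ʳ {low w} (∈∩ p q)

    extend-from-H : ∀ {k} → Col adj k H → Col adj (2 + k) full
    extend-from-H col = col-⊑ {B = B ∪ (C ∪ H)} (λ {w} _ → cov {w}) (col-∪ (col-indep B-indep) (col-∪ (col-indep C-indep) col))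
      where
      cov : ∀ {w} → w ∈ B ∪ (C ∪ H)
      cov {w} with cover w
      ... | inj₁ p        = ∈∪ˡ p
      ... | inj₂ (inj₁ p) = ∈∪ʳ {B w} (∈∪ˡ p)
      ... | inj₂ (inj₂ p) = ∈∪ʳ {B w} (∈∪ʳ {C w} p)

    colouring : ∀ m L k .{{_ : NonZero m}} .{{_ : NonZero L}} → 2 * (633 * (L * m * T)) ≤ n →
      216 * T ≤ 2 ^ L → 108 * T ≤ m ^ k → Col adj 76 full ⊎ Col adj (3 + k) full
    colouring m L k long T≤2^L T≤m^k with 108 * T ≤? h
    ... | yes h≥ = inj₁ (extend-from-H (BigH.H-colourable h≥))
    ... | no h≱ = inj₂ (extend-from-H (SmallH.H-colourable h< m L long k
        (<-≤-trans (≤-by 1 (*-monoʳ-≤ 2 h<) (lem h T)) T≤2^L) (<-≤-trans h< T≤m^k)))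
      where
      h< : 1 + h ≤ 108 * T
      h< = ≰⇒> h≱
      lem : ∀ h T → 1 + (h + h) + 2 * (108 * T) + 1 ≡ 216 * T + 2 * (1 + h)
      lem = solve-∀

  -- Construction of the parts `B`, `C` and `H`

  module BadEdge (u v : Fin n) (uv : adj u v ≡ true) (bad : 1 + 56 * edges (adj u) (adj v) ≤ n * n) where

    e = edges (adj u) (adj v)

    n>0 : 0 < n
    n>0 = >0 {n} {e} bad

    B₀ C₀ : VSet n
    B₀ = adj u ∪ adj v
    C₀ = ∁ B₀

    x y : Fin n → ℕ
    x w = # (adj w ∩ B₀)
    y w = # (adj w ∩ C₀)

    b₀ = # B₀
    c₀ = # C₀

    b₀+c₀ : b₀ + c₀ ≡ n
    b₀+c₀ = #-∁ B₀

    deg-xy : ∀ w → n ≤ 3 * (x w + y w) + 3 * T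
    deg-xy w = ≤-trans (large w) (≤-reflexive (cong (λ z → 3 * z + 3 * T) (#-split (adj w) B₀)))

    x≤n : ∀ w → x w ≤ n
    x≤n w = #≤n (adj w ∩ B₀)

    c₀-small : 3 * c₀ ≤ n + 6 * T
    c₀-small = ≤-by 0 (+-mono-≤ (large u) (+-mono-≤ (large v) (+-mono-≤ (*-monoʳ-≤ 3 du+dv) (*-monoʳ-≤ 3 (≤-reflexive b₀+c₀)))))
      (lem n b₀ c₀ (deg u) (deg v) T)
      where
      du+dv : deg u + deg v ≤ b₀
      du+dv = #-disj {C = B₀} (λ p q → no△ uv p q) ∈∪ˡ (λ {z} → ∈∪ʳ {adj u z})
      lem : ∀ n b c p q T → 3 * c + ((3 * p + 3 * T) + ((3 * q + 3 * T) + (3 * b + 3 * n))) + 0 ≡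
            (n + 6 * T) + (n + (n + (3 * (p + q) + 3 * (b + c))))
      lem = solve-∀

    -- A neighbour `b` of `w` in `B₀` shares no neighbour with `w` in `C₀`, hence has at least
    -- `n / 3 - T - c₀ + y w` neighbours in `B₀`. Summed over `b`, these are edges inside `B₀` at
    -- `adj w`, of which there are at most `e`.
    trade-off : ∀ w → x w * (n + 3 * y w) ≤ x w * (3 * T + 3 * c₀) + 3 * e
    trade-off w = begin
      x w * (n + 3 * y w)
        ≤⟨ ∑∈-lower (adj w ∩ B₀) (λ b → 1 * (3 * T + 3 * c₀) + 3 * x b) (n + 3 * y w) (λ {b} p → pt b (proj₁ (∩⁻ {adj w b} p))) ⟩
      ∑ (λ b → ⟦ (adj w ∩ B₀) b ⟧ * (1 * (3 * T + 3 * c₀) + 3 * x b))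
        ≡⟨ ∑∈-linear (adj w ∩ B₀) 1 3 (λ _ → 3 * T + 3 * c₀) x ⟩
      1 * ∑ (λ b → ⟦ (adj w ∩ B₀) b ⟧ * (3 * T + 3 * c₀)) + 3 * edges (adj w ∩ B₀) B₀
        ≡⟨ cong (_+ 3 * edges (adj w ∩ B₀) B₀) (trans (*-identityˡ _) (sym (∑-* (3 * T + 3 * c₀) (⟦_⟧ ∘ (adj w ∩ B₀))))) ⟩
      x w * (3 * T + 3 * c₀) + 3 * edges (adj w ∩ B₀) B₀
        ≤⟨ +-monoʳ-≤ (x w * (3 * T + 3 * c₀)) (*-monoʳ-≤ 3 (edges-within-nbr u v w)) ⟩
      x w * (3 * T + 3 * c₀) + 3 * e ∎
      where
      open ≤-Reasoning
      lem : ∀ n yw yb xb c T → (n + 3 * yw) + ((3 * (xb + yb) + 3 * T) + 3 * c) + 0 ≡ (1 * (3 * T + 3 * c) + 3 * xb) + (n + 3 * (yw + yb))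
      lem = solve-∀
      pt : ∀ b → adj w b ≡ true → n + 3 * y w ≤ 1 * (3 * T + 3 * c₀) + 3 * x b
      pt b wb = ≤-by 0 (+-mono-≤ (deg-xy b) (*-monoʳ-≤ 3 (nbr-disjoint {w} {b} {C₀} wb))) (lem n (y w) (y b) (x b) c₀ T)

    -- Membership in `B₀` is replaced by adjacency to more than half of `C₀`: two such vertices have
    -- a common neighbour, which makes `B` independent.
    B X : VSet n
    X w = does (2 * y w ≤? c₀)
    B = ∁ X

    X⁻ : ∀ {w} → w ∈ X → 2 * y w ≤ c₀
    X⁻ {w} = does⁻ (2 * y w ≤? c₀)

    B⁻ : ∀ {w} → w ∈ B → c₀ < 2 * y w
    B⁻ {w} p = ≰⇒> (λ q → not⁻ p (dec-true (2 * y w ≤? c₀) q))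

    B-indep : Independent adj B
    B-indep {s} {t} p q st = <-irrefl refl (≤-trans (≤-<-trans (+-monoʳ-≤ c₀ (+-monoʳ-≤ c₀ z≤n)) (+-mono-<-≤ (B⁻ {s} p) (≤-trans (≤-reflexive (+-identityʳ c₀)) (<⇒≤ (B⁻ {t} q)))))
      (≤-trans (≤-reflexive (sym (*-distribˡ-+ 2 (y s) (y t)))) (*-monoʳ-≤ 2 (nbr-disjoint {s} {t} {C₀} st))))

    x-large′ : ∀ {w} → w ∈ X → 2 * n ≤ 9 * x w
    x-large′ {w} p = x-large {n} {x w} {y w} {c₀} {T} {e} (trade-off w) (deg-xy w) (X⁻ {w} p) c₀-small (x≤n w) bad hT

    y-small′ : ∀ {w} → w ∈ X → 9 * y w + 2 * n ≤ 9 * c₀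
    y-small′ {w} p = y-small {n} {x w} {y w} {c₀} {T} {e} (trade-off w) (deg-xy w) (X⁻ {w} p) c₀-small (x≤n w) bad hT

    crossing = edges B₀ C₀

    -- Degrees are summed over `B₀`; the edges inside `B₀` account for at most `2 * e` of the sum.
    many-crossing : b₀ * n ≤ 6 * e + 3 * crossing + b₀ * (3 * T)
    many-crossing = begin
      b₀ * n
        ≤⟨ ∑∈-lower B₀ (λ b → 3 * (x b + y b) + 1 * (3 * T)) n (λ {b} _ → ≤-trans (deg-xy b) (≤-reflexive (cong (_+_ (3 * (x b + y b))) (sym (*-identityˡ (3 * T)))))) ⟩
      ∑ (λ b → ⟦ B₀ b ⟧ * (3 * (x b + y b) + 1 * (3 * T)))
        ≡⟨ ∑∈-linear B₀ 3 1 (λ b → x b + y b) (λ _ → 3 * T) ⟩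
      3 * ∑ (λ b → ⟦ B₀ b ⟧ * (x b + y b)) + 1 * ∑ (λ b → ⟦ B₀ b ⟧ * (3 * T))
        ≡⟨ cong₂ _+_ (cong (3 *_) (trans (∑-cong (λ b → *-distribˡ-+ ⟦ B₀ b ⟧ (x b) (y b))) (∑-+ _ _)))
                     (trans (*-identityˡ _) (sym (∑-* (3 * T) (⟦_⟧ ∘ B₀)))) ⟩
      3 * (edges B₀ B₀ + crossing) + b₀ * (3 * T)
        ≤⟨ +-monoˡ-≤ (b₀ * (3 * T)) (*-monoʳ-≤ 3 (+-monoˡ-≤ crossing (edges-within-all u v))) ⟩
      3 * (2 * e + crossing) + b₀ * (3 * T)
        ≡⟨ lem e crossing (b₀ * (3 * T)) ⟩
      6 * e + 3 * crossing + b₀ * (3 * T) ∎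
      where
      open ≤-Reasoning
      lem : ∀ e N z → 3 * (2 * e + N) + z ≡ 6 * e + 3 * N + z
      lem = solve-∀

    defects : ∀ (P Q D : VSet n) r → (∀ {w} → w ∈ P → 9 * # (adj w ∩ Q) + 2 * n * ⟦ D w ⟧ ≤ 9 * r) →
              9 * edges P Q + 2 * n * # (P ∩ D) ≤ # P * (9 * r)
    defects P Q D r h = ≤-trans (≤-reflexive (sym (trans (∑∈-linear P 9 (2 * n) _ _)
        (cong (λ z → 9 * edges P Q + 2 * n * z) (∑-⟦∩⟧ P D)))))
      (∑∈-bound P _ (9 * r) h)

    p = # (B₀ ∩ X)

    p-small : 56 * p ≤ 9 * n + 756 * T
    p-small = few-defects {n} {b₀} {c₀} {p} {crossing} {e} {T} (#≤n B₀) many-crossing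
      (defects B₀ C₀ X c₀ pt) c₀-small bad
      where
      pt : ∀ {w} → w ∈ B₀ → 9 * y w + 2 * n * ⟦ X w ⟧ ≤ 9 * c₀
      pt {w} _ with ∈? (X w)
      ... | inj₁ w∈X = ≤-trans (≤-reflexive (cong (_+_ (9 * y w)) (trans (cong (2 * n *_) (⟦⟧-true w∈X)) (*-identityʳ (2 * n))))) (y-small′ {w} w∈X)
      ... | inj₂ w∉X = ≤-trans (≤-reflexive (trans (cong (_+_ (9 * y w)) (trans (cong (2 * n *_) (⟦⟧-false w∉X)) (*-zeroʳ (2 * n)))) (+-identityʳ _)))
                         (*-monoʳ-≤ 9 (#-mono {A = adj w ∩ C₀} (λ {z} q → proj₂ (∩⁻ {adj w z} q))))

    -- `C` consists of the vertices with all neighbours in `B`. That `C` lies in `X` is a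
    -- consequence: a vertex of `B` has some neighbour by `has-nbr`, and that neighbour is in `X` by
    -- `B→X`.
    nbr-in-X C H : VSet n
    nbr-in-X w = some (adj w ∩ X)
    C = ∁ nbr-in-X
    H = X ∩ nbr-in-X

    c = # C
    h = # H

    C⁻ : ∀ {w z} → w ∈ C → adj w z ≡ true → z ∉ X
    C⁻ {w} {z} w∈C wz z∈X = not⁻ w∈C (some⁺ (adj w ∩ X) (∈∩ wz z∈X))

    has-nbr : ∀ w → ∃ λ z → adj w z ≡ true
    has-nbr w with some? (adj w)
    ... | yes r = r
    ... | no none = ⊥-elim (<⇒≱ n>0 (*-cancelˡ-≤ 6 (≤-by 0 (+-mono-≤ (*-monoʳ-≤ 7 (large w)) (+-mono-≤ (*-monoʳ-≤ 21 d≤0) (lower-T 1 21 T n hT))) (lem n (deg w) T))))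
      where
      d≤0 : deg w ≤ 0
      d≤0 = ≤-trans (#-mono {A = adj w} {∅} (λ {z} q → ⊥-elim (none (z , q)))) (≤-reflexive (trans (∑-const n 0) (*-zeroʳ n)))
      lem : ∀ n d T → 6 * n + (7 * (3 * d + 3 * T) + (21 * 0 + n)) + 0 ≡ 6 * 0 + (7 * n + (21 * d + 1 * (21 * T)))
      lem = solve-∀

    B→X : ∀ {w z} → w ∈ B → adj w z ≡ true → z ∈ X
    B→X {w} {z} w∈B wz with ∈? (X z)
    ... | inj₁ r = r
    ... | inj₂ r = ⊥-elim (B-indep {w} {z} w∈B r wz)

    C⊑X : C ⊑ X
    C⊑X {w} w∈C with ∈? (X w)
    ... | inj₁ r = r
    ... | inj₂ w∈B = let z , wz = has-nbr w in ⊥-elim (C⁻ {w} {z} w∈C wz (B→X {w} {z} w∈B wz))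

    C-indep : Independent adj C
    C-indep {s} {t} p q st = C⁻ {s} {t} p st (C⊑X {t} q)

    -- A vertex of `C₀` with a neighbour `z` in `X` misses the `2 n / 9` neighbours that `z` has in
    -- `B₀`; `many-crossing` leaves room for only few such vertices.
    c-large′ : 29 * n ≤ 168 * c + 1932 * T
    c-large′ = c-large {n} {b₀} {c₀} {c} {# (C₀ ∩ nbr-in-X)} {crossing} {e} {T} b₀+c₀ many-crossing
      (≤-trans (≤-reflexive (cong (λ z → 9 * z + 2 * n * # (C₀ ∩ nbr-in-X)) (edges-sym B₀ C₀))) (defects C₀ B₀ nbr-in-X b₀ (λ {w} _ → pt {w})))
      (#-cover {C = C₀} (λ {w} r → cov {w} r)) c₀-small bad hT
      where
      cov : ∀ {w} → w ∈ C₀ → w ∈ C₀ ∩ nbr-in-X ⊎ w ∈ C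
      cov {w} r with ∈? (nbr-in-X w)
      ... | inj₁ q = inj₁ (∈∩ r q)
      ... | inj₂ q = inj₂ q
      lem : ∀ n xw xz b → (9 * xw + 2 * n) + (9 * b + 9 * xz) + 0 ≡ 9 * b + (9 * (xw + xz) + 2 * n)
      lem = solve-∀
      pt : ∀ {w} → 9 * x w + 2 * n * ⟦ nbr-in-X w ⟧ ≤ 9 * b₀
      pt {w} with ∈? (nbr-in-X w)
      ... | inj₂ q = ≤-trans (≤-reflexive (trans (cong (_+_ (9 * x w)) (trans (cong (2 * n *_) (⟦⟧-false q)) (*-zeroʳ (2 * n)))) (+-identityʳ _)))
                         (*-monoʳ-≤ 9 (#-mono {A = adj w ∩ B₀} (λ {z} q → proj₂ (∩⁻ {adj w z} q))))
      ... | inj₁ q with some⁻ (adj w ∩ X) q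
      ... | z , r = let wz , z∈X = ∩⁻ {adj w z} r in
        ≤-trans (≤-reflexive (cong (_+_ (9 * x w)) (trans (cong (2 * n *_) (⟦⟧-true q)) (*-identityʳ (2 * n)))))
          (≤-by 0 (+-mono-≤ (*-monoʳ-≤ 9 (nbr-disjoint {w} {z} {B₀} wz)) (x-large′ {z} z∈X)) (lem n (x w) (x z) b₀))

    nbr-of-H : ∀ {w z} → w ∈ H → adj w z ≡ true → z ∈ B ∪ H
    nbr-of-H {w} {z} w∈H wz with ∈? (X z)
    ... | inj₂ r = ∈∪ˡ r
    ... | inj₁ r = ∈∪ʳ {B z} (∈∩ r (some⁺ (adj z ∩ X) (∈∩ (adj-sym wz) (proj₁ (∩⁻ {X w} w∈H)))))

    nbr-of-H∉C : ∀ {w z} → w ∈ H → adj w z ≡ true → z ∉ C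
    nbr-of-H∉C {w} {z} w∈H wz z∈C = C⁻ {z} {w} z∈C (adj-sym wz) (proj₁ (∩⁻ {X w} w∈H))

    H-nbr : ∀ {w} → w ∈ H → ∃ λ z → adj w z ≡ true × z ∈ H
    H-nbr {w} w∈H with some⁻ (adj w ∩ X) (proj₂ (∩⁻ {X w} w∈H))
    ... | z , r = let wz , z∈X = ∩⁻ {adj w z} r in
      z , wz , ∈∩ z∈X (some⁺ (adj z ∩ X) (∈∩ (adj-sym wz) (proj₁ (∩⁻ {X w} w∈H))))

    β-large′ : ∀ {w} → w ∈ X → n ≤ 18 * # (adj w ∩ B)
    β-large′ {w} w∈X = β-large {n} {x w} {p} {# (adj w ∩ B)} {T} (x-large′ {w} w∈X) (#-cover {C = adj w ∩ B₀} (λ {z} → cov {z})) p-small hT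
      where
      cov : ∀ {z} → z ∈ adj w ∩ B₀ → z ∈ adj w ∩ B ⊎ z ∈ B₀ ∩ X
      cov {z} q with ∩⁻ {adj w z} q | ∈? (X z)
      ... | wz , z∈B₀ | inj₁ r = inj₂ (∈∩ z∈B₀ r)
      ... | wz , z∈B₀ | inj₂ r = inj₁ (∈∩ wz r)

    parts : # B + c + h ≤ n
    parts = ≤-trans (≤-trans (≤-reflexive (+-assoc (# B) c h))
      (+-monoʳ-≤ (# B) (#-disj {A = C} {H} {X} (λ {w} p q → not⁻ p (proj₂ (∩⁻ {X w} q))) (λ {w} → C⊑X {w}) (λ {w} p → proj₁ (∩⁻ {X w} p)))))
      (≤-reflexive (trans (+-comm (# B) (# X)) (#-∁ X)))

    nbr-of-B : ∀ {w z} → w ∈ B → adj w z ≡ true → z ∈ C ⊎ z ∈ H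
    nbr-of-B {w} {z} w∈B wz with ∈? (nbr-in-X z)
    ... | inj₂ r = inj₁ r
    ... | inj₁ r = inj₂ (∈∩ (B→X {w} {z} w∈B wz) r)

    cover : ∀ w → w ∈ B ⊎ w ∈ C ⊎ w ∈ H
    cover w with ∈? (X w) | ∈? (nbr-in-X w)
    ... | inj₂ p | _      = inj₁ p
    ... | inj₁ p | inj₂ q = inj₂ (inj₁ q)
    ... | inj₁ p | inj₁ q = inj₂ (inj₂ (∈∩ p q))

    bad-edge-colouring : ∀ m L k .{{_ : NonZero m}} .{{_ : NonZero L}} → 2 * (633 * (L * m * T)) ≤ n →
      216 * T ≤ 2 ^ L → 108 * T ≤ m ^ k → Col adj 76 full ⊎ Col adj (3 + k) full
    bad-edge-colouring = Tripartition.colouring n>0 B C H cover parts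
      (λ {w} {z} → B-indep {w} {z}) (λ {w} {z} → C-indep {w} {z}) (λ {w} {z} → nbr-of-B {w} {z}) (λ {w} {z} → nbr-of-H {w} {z})
      (λ {w} {z} → nbr-of-H∉C {w} {z}) (λ {w} → H-nbr {w}) (λ {w} w∈H → β-large′ {w} (proj₁ (∩⁻ {X w} w∈H))) c-large′

-- Choice of the scales m and L

^-distrib-* : ∀ a b k → (a * b) ^ k ≡ a ^ k * b ^ k
^-distrib-* a b zero    = refl
^-distrib-* a b (suc k) = trans (cong (a * b *_) (^-distrib-* a b k)) (lem a b (a ^ k) (b ^ k))
  where
  lem : ∀ a b x y → a * b * (x * y) ≡ a * x * (b * y)
  lem = solve-∀

suc≤2* : ∀ {a} → 1 ≤ a → suc a ≤ 2 * a
suc≤2* {a} 1≤a = ≤-trans (+-monoˡ-≤ a 1≤a) (≤-reflexive (cong (_+_ a) (sym (+-identityʳ a))))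

suc≤2^ : ∀ q → suc q ≤ 2 ^ q
suc≤2^ zero    = ≤-refl
suc≤2^ (suc q) = ≤-trans (suc≤2* (s≤s z≤n)) (*-monoʳ-≤ 2 (suc≤2^ q))

log₂-bracket : ∀ n → 1 ≤ n → ∃ λ l → 2 ^ l ≤ n × n < 2 ^ suc l
log₂-bracket (suc zero)    _ = 0 , ≤-refl , ≤-refl
log₂-bracket (suc (suc n)) _ with log₂-bracket (suc n) (s≤s z≤n)
... | l , 2^l≤ , <2^l with suc (suc n) <? 2 ^ suc l
... | yes p = l , m≤n⇒m≤1+n 2^l≤ , p
... | no ¬p = suc l , ≮⇒≥ ¬p , ≤-trans (s≤s <2^l) (≤-trans (suc≤2* (m^n>0 2 (suc l))) ≤-refl)

-- `m` is the root rounded up: `m - 1` is too small, and `m ≤ 2 (m - 1)` unless `m = 1`.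
root : ∀ k x .{{_ : NonZero k}} → 1 ≤ x → ∀ b → x ≤ b ^ k → ∃ λ m → 1 ≤ m × x ≤ m ^ k × m ^ k ≤ 2 ^ k * x
root (suc k) x 1≤x zero    x≤b = ⊥-elim (<⇒≱ 1≤x x≤b)
root k x 1≤x (suc b) x≤b with x ≤? b ^ k
... | yes p = root k x 1≤x b p
root k x 1≤x (suc zero)    x≤b | no _ = 1 , ≤-refl , x≤b , ≤-trans (≤-reflexive (^-zeroˡ k)) (*-mono-≤ (m^n>0 2 k) 1≤x)
root k x 1≤x (suc (suc b)) x≤b | no ¬p = suc (suc b) , s≤s z≤n , x≤b ,
  ≤-trans (^-monoˡ-≤ k (suc≤2* {suc b} (s≤s z≤n))) (≤-trans (≤-reflexive (^-distrib-* 2 (suc b) k)) (*-monoʳ-≤ (2 ^ k) (<⇒≤ (≰⇒> ¬p))))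

-- Writing l = r + q (J + 1), compare 2 ^ l ≥ (q + 1) ^ (J + 1) with (l + 9) ^ J ≤ (9 (J + 1) (q + 1)) ^ J.
exponential-wins : ∀ c J → ∃ λ X → ∀ l → X ≤ l → c * (l + 9) ^ J < 2 ^ l
exponential-wins c J = c * (9 * d) ^ J * d , λ l X≤l → let
    q = l / d
    l+9≤ : l + 9 ≤ 9 * d * suc q
    l+9≤ = ≤-trans (+-monoˡ-≤ 9 (≤-reflexive (m≡m%n+[m/n]*n l d))) (≤-trans (+-monoˡ-≤ 9 (+-monoˡ-≤ (q * d) (ℕ.s≤s⁻¹ (m%n<n l d))))
             (≤-by (8 * (J + q * d)) z≤n (lem J q)))
    c≤q : c * (9 * d) ^ J ≤ q
    c≤q = ≤-trans (≤-reflexive (sym (m*n/n≡m (c * (9 * d) ^ J) d))) (/-mono-≤ X≤l (≤-refl {d}))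
    in begin-strict
    c * (l + 9) ^ J                          ≤⟨ *-monoʳ-≤ c (^-monoˡ-≤ J l+9≤) ⟩
    c * (9 * d * suc q) ^ J                  ≡⟨ cong (c *_) (^-distrib-* (9 * d) (suc q) J) ⟩
    c * ((9 * d) ^ J * suc q ^ J)            ≡⟨ *-assoc c ((9 * d) ^ J) (suc q ^ J) ⟨
    c * (9 * d) ^ J * suc q ^ J              <⟨ *-monoˡ-< (suc q ^ J) {{m^n≢0 (suc q) J}} (s≤s c≤q) ⟩
    suc q ^ d                                ≤⟨ ^-monoˡ-≤ d (suc≤2^ q) ⟩
    (2 ^ q) ^ d                              ≡⟨ ^-*-assoc 2 q d ⟩
    2 ^ (q * d)                              ≤⟨ ^-monoʳ-≤ 2 (≤-trans (m≤n+m (q * d) (l % d)) (≤-reflexive (sym (m≡m%n+[m/n]*n l d)))) ⟩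
    2 ^ l                                    ∎
  where
  open ≤-Reasoning
  d = suc J
  lem : ∀ J q → J + q * (1 + J) + 9 + 0 + 8 * (J + q * (1 + J)) ≡ 9 * (1 + J) * (1 + q) + 0
  lem = solve-∀

-- `L * m` is the depth to which `H` is explored. `root-bound` lets `k` divisions by `m` exhaust
-- `H`, `log-bound` limits the doublings of the weight to fewer than `L`, and `small` excludes odd
-- closed walks within reach.
record Parameters (k n T : ℕ) : Set where
  field
    m L         : ℕ
    m≥1         : 1 ≤ m
    L≥1         : 1 ≤ L
    small       : 10000 * (L * m * T) ≤ n
    log-bound   : 216 * T ≤ 2 ^ L
    root-bound  : 108 * T ≤ m ^ k

-- Opaque, because normalising the threshold 2 ^ X is infeasible.
opaque
  -- If 10000 L m T > n then n ^ (k Q) ≤ c L ^ (k Q) n ^ (P + k P) for a constant c, hence n ≤ c L ^ (k Q).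
  parameters : ∀ P Q k .{{_ : NonZero k}} → P + k * P + 1 ≤ k * Q →
    ∃ λ N → ∀ n → N ≤ n → ∀ T → 1 ≤ T → T ^ Q ≤ 2 ^ Q * n ^ P → Parameters k n T
  parameters P Q k gap = 2 ^ X , found
    where
    E A c X : ℕ
    E = k * Q
    A = 10000
    c = A ^ E * ((2 ^ k * 108) ^ Q * (2 ^ Q * (2 ^ Q) ^ k))
    X = proj₁ (exponential-wins c E)
    found : ∀ n → 2 ^ X ≤ n → ∀ T → 1 ≤ T → T ^ Q ≤ 2 ^ Q * n ^ P → Parameters k n T
    found n N≤n T 1≤T T^Q with log₂-bracket n (≤-trans (m^n>0 2 X) N≤n)
    ... | l , 2^l≤n , n<2^l with root k (108 * T) (≤-trans 1≤T (m≤n*m T 108)) (108 * T) self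
      where
      self : 108 * T ≤ (108 * T) ^ k
      self = ≤-trans (≤-reflexive (sym (^-identityʳ (108 * T)))) (^-monoʳ-≤ (108 * T) {{ℕ.>-nonZero (≤-trans 1≤T (m≤n*m T 108))}} (ℕ.>-nonZero⁻¹ k))
    ... | m , m≥1 , x≤m^k , m^k≤ = record
      { m = m ; L = L ; m≥1 = m≥1 ; L≥1 = ≤-trans (s≤s z≤n) (m≤n+m 9 l) ; small = small
      ; log-bound = log-bound ; root-bound = x≤m^k }
      where
      -- 9 = 8 + 1, from `216 ≤ 2 ^ 8` and `T ≤ n < 2 ^ suc l`.
      L : ℕ
      L = l + 9
      instance
        n≢0 : NonZero n
        n≢0 = ℕ.>-nonZero (≤-trans (m^n>0 2 X) N≤n)
      X≤l : X ≤ l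
      X≤l = ≮⇒≥ λ l<X → <⇒≱ n<2^l (≤-trans (^-monoʳ-≤ 2 l<X) N≤n)
      final : ∀ aJ lJ u v np v′ npk → aJ * lJ * ((u * (v * np)) * (v′ * npk)) ≡ aJ * (u * (v * v′)) * lJ * (np * npk)
      final = solve-∀
      power : (A * (L * m * T)) ^ E ≤ c * L ^ E * n ^ (P + k * P)
      power = begin
        (A * (L * m * T)) ^ E                                   ≡⟨ cong (_^ E) (lem₁ A L m T) ⟩
        (A * L * (m * T)) ^ E                                   ≡⟨ trans (^-distrib-* (A * L) (m * T) E) (cong₂ _*_ (^-distrib-* A L E) (^-distrib-* m T E)) ⟩
        A ^ E * L ^ E * (m ^ E * T ^ E)                         ≡⟨ cong₂ (λ p q → A ^ E * L ^ E * (p * q)) (sym (^-*-assoc m k Q)) (trans (cong (T ^_) (*-comm k Q)) (sym (^-*-assoc T Q k))) ⟩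
        A ^ E * L ^ E * ((m ^ k) ^ Q * (T ^ Q) ^ k)             ≤⟨ *-monoʳ-≤ (A ^ E * L ^ E) (*-mono-≤ mQ Tk) ⟩
        A ^ E * L ^ E * (((2 ^ k * 108) ^ Q * (2 ^ Q * n ^ P)) * ((2 ^ Q) ^ k * (n ^ P) ^ k))
          ≡⟨ final (A ^ E) (L ^ E) ((2 ^ k * 108) ^ Q) (2 ^ Q) (n ^ P) ((2 ^ Q) ^ k) ((n ^ P) ^ k) ⟩
        c * L ^ E * (n ^ P * (n ^ P) ^ k)                       ≡⟨ cong (λ w → c * L ^ E * (n ^ P * w)) (trans (^-*-assoc n P k) (cong (n ^_) (*-comm P k))) ⟩
        c * L ^ E * (n ^ P * n ^ (k * P))                       ≡⟨ cong (c * L ^ E *_) (sym (^-distribˡ-+-* n P (k * P))) ⟩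
        c * L ^ E * n ^ (P + k * P)                             ∎
        where
        open ≤-Reasoning
        lem₁ : ∀ A L m T → A * (L * m * T) ≡ A * L * (m * T)
        lem₁ = solve-∀
        mQ : (m ^ k) ^ Q ≤ (2 ^ k * 108) ^ Q * (2 ^ Q * n ^ P)
        mQ = ≤-trans (^-monoˡ-≤ Q (≤-trans m^k≤ (≤-reflexive (sym (*-assoc (2 ^ k) 108 T)))))
          (≤-trans (≤-reflexive (^-distrib-* (2 ^ k * 108) T Q)) (*-monoʳ-≤ ((2 ^ k * 108) ^ Q) T^Q))
        Tk : (T ^ Q) ^ k ≤ (2 ^ Q) ^ k * (n ^ P) ^ k
        Tk = ≤-trans (^-monoˡ-≤ k T^Q) (≤-reflexive (^-distrib-* (2 ^ Q) (n ^ P) k))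
      small : A * (L * m * T) ≤ n
      small = ≮⇒≥ λ n< → <⇒≱ (<-≤-trans (proj₂ (exponential-wins c E) l X≤l) 2^l≤n)
        (*-cancelʳ-≤ n (c * L ^ E) (n ^ (P + k * P)) {{m^n≢0 n (P + k * P)}} (begin
          n * n ^ (P + k * P)          ≡⟨ cong (n ^_) (sym (+-comm (P + k * P) 1)) ⟩
          n ^ (P + k * P + 1)          ≤⟨ ^-monoʳ-≤ n gap ⟩
          n ^ E                        ≤⟨ ^-monoˡ-≤ E (<⇒≤ n<) ⟩
          (A * (L * m * T)) ^ E        ≤⟨ power ⟩
          c * L ^ E * n ^ (P + k * P)  ∎))
        where open ≤-Reasoning
      T≤n : T ≤ n
      T≤n = ≤-trans (≤-trans (m≤n*m T (L * m) {{m*n≢0 L m {{ℕ.>-nonZero (≤-trans (s≤s z≤n) (m≤n+m 9 l))}} {{ℕ.>-nonZero m≥1}}}}) (m≤n*m (L * m * T) A)) small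
      log-bound : 216 * T ≤ 2 ^ L
      log-bound = ≤-trans (*-mono-≤ {216} {2 ^ 8} (≤ᵇ⇒≤ 216 (2 ^ 8) _) (≤-trans T≤n (<⇒≤ n<2^l)))
        (≤-reflexive (trans (sym (^-distribˡ-+-* 2 8 (suc l))) (cong (2 ^_) (trans (+-comm 8 (suc l)) (sym (+-suc l 8))))))

-- The chromatic number

col-≤ : ∀ {n} {e : Fin n → Fin n → Bool} {k l A} → k ≤ l → Col e k A → Col e l A
col-≤ k≤l (f , p) = (λ x → Fin.inject≤ (f x) k≤l) , λ a b xy eq → p a b xy (Finₚ.inject≤-injective k≤l k≤l _ _ eq)

module _ {n} (adj : Fin n → Fin n → Bool)
  (adj-sym : ∀ {x y} → adj x y ≡ true → adj y x ≡ true)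
  (no△ : ∀ {x y z} → adj x y ≡ true → adj x z ≡ true → ¬ (adj y z ≡ true)) where

  open TriangleFreeGraph adj adj-sym no△

  spread-case : ∀ C k → 32 ^ 252 ≤ C → 0 < n → (∀ {u v} → adj u v ≡ true → n * n ≤ 56 * edges (adj u) (adj v)) →
                Col adj (C + 1 + k) full
  spread-case C k 32^252≤C n>0 good =
    -- Divided by `7 * 32 ^ 2`, the bound at 252 is 324 - 396 + 252 · 251 / 1024, about -10; its
    -- sign is decided by evaluation.
    let t , t≤ , col = Spread.spread-colouring adj adj-sym no△ 32 good n>0 252 (toWitness {a? = _ ℤ.<? _} _)
    in col-≤ (≤-trans (^-monoʳ-≤ 32 t≤) (≤-trans 32^252≤C (≤-trans (m≤m+n C 1) (m≤m+n (C + 1) k)))) col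

  bad-case : ∀ C k T → 76 ≤ C → (∀ v → n ≤ 3 * # (adj v) + 3 * T) → Parameters k n T →
             ∀ u v → adj u v ≡ true → 1 + 56 * edges (adj u) (adj v) ≤ n * n → Col adj (C + 1 + k) full
  bad-case C k T 76≤C large prm u v uv bad = [ col-≤ (≤-trans 76≤C (≤-trans (m≤m+n C 1) (m≤m+n (C + 1) k))) , col-≤ (+-monoˡ-≤ k 3≤C+1) ]′ colouring
    where
    open Parameters prm
    instance
      m≢0 : NonZero m
      m≢0 = ℕ.>-nonZero m≥1
      L≢0 : NonZero L
      L≢0 = ℕ.>-nonZero L≥1
    3≤C+1 : 3 ≤ C + 1
    3≤C+1 = ≤-trans (≤-trans (≤ᵇ⇒≤ 3 76 _) 76≤C) (m≤m+n C 1)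
    hT : 10000 * T ≤ n
    hT = ≤-trans (*-monoʳ-≤ 10000 (m≤n*m T (L * m) {{m*n≢0 L m}})) small
    long : 2 * (633 * (L * m * T)) ≤ n
    long = lower-T 2 633 (L * m * T) n small
    colouring : Col adj 76 full ⊎ Col adj (3 + k) full
    colouring = BadEdge.bad-edge-colouring adj adj-sym no△ T large hT u v uv bad m L k long log-bound root-bound

  dichotomy : ∀ C k T → 32 ^ 252 ≤ C → 76 ≤ C → (∀ v → n ≤ 3 * # (adj v) + 3 * T) → 0 < n → Parameters k n T →
              Col adj (C + 1 + k) full
  dichotomy C k T 32^252≤C 76≤C large n>0 prm
    with Finₚ.any? (λ u → Finₚ.any? (λ v → (adj u v 𝔹.≟ true) ×-dec (1 + 56 * edges (adj u) (adj v) ≤? n * n)))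
  ... | no none                 = spread-case C k 32^252≤C n>0 (λ {u} {v} uv → ℕ.s≤s⁻¹ (≰⇒> (λ lt → none (u , v , uv , lt))))
  ... | yes (u , v , uv , bad) = bad-case C k T 76≤C large prm u v uv bad

module _ {n} (G : Graph n) where
  open Graph G

  adjacent : Fin n → Fin n → Bool
  adjacent u v = does (u ~? v)

  adjacent⁻ : ∀ {u v} → adjacent u v ≡ true → u ~ v
  adjacent⁻ {u} {v} = does⁻ (u ~? v)

  adjacent⁺ : ∀ {u v} → u ~ v → adjacent u v ≡ true
  adjacent⁺ {u} {v} = dec-true (u ~? v)

  opaque
    unfolding ∑
    length-filter : ∀ {m} {A : Set} {P : A → Set} (P? : ∀ a → Dec (P a)) (f : Fin m → A) →
                    length (filter P? (tabulate f)) ≡ ∑ (λ i → ⟦ does (P? (f i)) ⟧)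
    length-filter {zero}  P? f = refl
    length-filter {suc m} P? f with does (P? (f zero))
    ... | true  = cong suc (length-filter P? (f ∘ suc))
    ... | false = length-filter P? (f ∘ suc)

  minDegree≤ : ∀ v → minDegree G ≤ # (adjacent v)
  minDegree≤ v = ≤-trans
    (min≤v⁺ n (map (degree G) (allFin n)) (inj₂ (lose (∈-map⁺ (degree G) (∈-allFin v)) ≤-refl)))
    (≤-reflexive (length-filter (v ~?_) (λ i → i)))

  Colourable⇒χ≤ : ∀ {k} → Colourable G k → χ G ≤ k
  Colourable⇒χ≤ {k} col with k <? n
  ... | yes k<n = min≤v⁺ n (filter (colourable? G) (upTo n)) (inj₂ (lose (∈-filter⁺ (colourable? G) (∈-upTo⁺ k<n) col) ≤-refl))
  -- `upTo n` stops below `n`; from there on the default value of the minimum gives the bound.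
  ... | no k≮n  = ≤-trans (min≤⊤ n (filter (colourable? G) (upTo n))) (≮⇒≥ k≮n)

  Col⇒Colourable : ∀ {k} → Col adjacent k full → Colourable G k
  Col⇒Colourable (f , p) = Vec.tabulate f , λ u v uv eq → p {u} {v} refl refl (adjacent⁺ uv)
    (trans (sym (Vecₚ.lookup∘tabulate f u)) (trans eq (Vecₚ.lookup∘tabulate f v)))

  χ-bound : ∀ C k T → 32 ^ 252 ≤ C → 76 ≤ C → TriangleFree G → n ≤ 3 * (minDegree G + T) → 0 < n → Parameters k n T →
            χ G ≤ C + 1 + k
  χ-bound C k T 32^252≤C 76≤C no△ minDeg n>0 prm = Colourable⇒χ≤ (Col⇒Colourable
    (dichotomy adjacent (λ p → adjacent⁺ (~-sym (adjacent⁻ p)))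
      (λ {x} {y} {z} xy xz yz → no△ y x z (~-sym (adjacent⁻ xy)) (adjacent⁻ xz) (adjacent⁻ yz))
      C k T 32^252≤C 76≤C
      (λ v → ≤-trans minDeg (≤-trans (≤-reflexive (*-distribˡ-+ 3 (minDegree G) T)) (+-monoˡ-≤ (3 * T) (*-monoʳ-≤ 3 (minDegree≤ v)))))
      n>0 prm))

-- Rational approximation of the exponent

module Reals {x : Cut} (X : IsReal x) where
  open IsReal X

  upper-up : ∀ {p q} → p ℚ.< q → Upper x p → Upper x q
  upper-up {p} {q} p<q p∈ = from (upper-rounded q) (_ , p<q , p∈)

  lower<upper : ∀ {p q} → Lower x p → Upper x q → p ℚ.< q
  lower<upper {p} {q} p∈ q∈ with ℚₚ.<-cmp p q
  ... | tri< p<q _ _    = p<q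
  ... | tri≈ _ refl _   = ⊥-elim (disjoint p (p∈ , q∈))
  ... | tri> _ _ q<p    = ⊥-elim (disjoint p (p∈ , upper-up q<p q∈))

neg-involutive : ∀ t → ℚ.- (ℚ.- t) ≡ t
neg-involutive = solve 1 (λ t → :- (:- t) := t) refl

0<1 : 0ℚ ℚ.< 1ℚ
0<1 = ℚ.*<* (ℤ.+<+ (s≤s z≤n))

p<p+h : ∀ p {h} → 0ℚ ℚ.< h → p ℚ.< p ℚ.+ h
p<p+h p 0<h = ℚₚ.≤-<-trans (ℚₚ.≤-reflexive (sym (ℚₚ.+-identityʳ p))) (ℚₚ.+-monoʳ-< p 0<h)

0<⇒<+ : ∀ {p q} → p ℚ.< q → 0ℚ ℚ.< q ℚ.- p
0<⇒<+ {p} {q} p<q = subst (λ w → w ℚ.< q ℚ.- p) (ℚₚ.+-inverseʳ p) (ℚₚ.+-monoˡ-< (ℚ.- p) p<q)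

infixl 7 _⊗_
-- Repeated addition, so that one unfolding matches one step of `narrow`.
_⊗_ : ℕ → ℚ → ℚ
zero  ⊗ h = 0ℚ
suc m ⊗ h = h ℚ.+ m ⊗ h

⊗-toℚᵘ : ∀ m h → toℚᵘ (m ⊗ h) ℚᵘ.≃ mkℚᵘ (+ m) 0 ℚᵘ.* toℚᵘ h
⊗-toℚᵘ zero    h = ℚᵘₚ.≃-sym (ℚᵘₚ.*-zeroˡ (toℚᵘ h))
⊗-toℚᵘ (suc m) h = ℚᵘₚ.≃-trans (ℚₚ.toℚᵘ-homo-+ h (m ⊗ h)) (ℚᵘₚ.≃-trans {toℚᵘ h ℚᵘ.+ toℚᵘ (m ⊗ h)} {mkℚᵘ (+ 1) 0 ℚᵘ.* toℚᵘ h ℚᵘ.+ mkℚᵘ (+ m) 0 ℚᵘ.* toℚᵘ h} {mkℚᵘ (+ suc m) 0 ℚᵘ.* toℚᵘ h}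
  (ℚᵘₚ.+-cong {toℚᵘ h} {mkℚᵘ (+ 1) 0 ℚᵘ.* toℚᵘ h} (ℚᵘₚ.≃-sym (ℚᵘₚ.*-identityˡ (toℚᵘ h))) (⊗-toℚᵘ m h))
  (ℚᵘₚ.≃-trans {j = (mkℚᵘ (+ 1) 0 ℚᵘ.+ mkℚᵘ (+ m) 0) ℚᵘ.* toℚᵘ h} (ℚᵘₚ.≃-sym (ℚᵘₚ.*-distribʳ-+ (toℚᵘ h) (mkℚᵘ (+ 1) 0) (mkℚᵘ (+ m) 0)))
    (ℚᵘₚ.*-congʳ {toℚᵘ h} {mkℚᵘ (+ 1) 0 ℚᵘ.+ mkℚᵘ (+ m) 0} {mkℚᵘ (+ suc m) 0} 1+m)))
  where
  1+m : mkℚᵘ (+ 1) 0 ℚᵘ.+ mkℚᵘ (+ m) 0 ℚᵘ.≃ mkℚᵘ (+ suc m) 0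
  1+m = *≡* (cong (λ w → (1ℤ ℤ.+ w) ℤ.* 1ℤ) (ℤₚ.*-identityʳ (+ m)))

-- For x = a/b and h = p/q, the multiple |a| q of h is |a| p, which is at least x.
archimedean : ∀ x {h} → 0ℚ ℚ.< h → ∃ λ m → x ℚ.≤ m ⊗ h
archimedean x {h} 0<h = ℤ.∣ ↥ x ∣ * ↧ₙ h , ℚₚ.toℚᵘ-cancel-≤ (ℚᵘₚ.≤-respʳ-≃ (ℚᵘₚ.≃-sym (⊗-toℚᵘ (ℤ.∣ ↥ x ∣ * ↧ₙ h) h)) (bound x h 0<h))
  where
  bound : ∀ x h → 0ℚ ℚ.< h → toℚᵘ x ℚᵘ.≤ mkℚᵘ (+ (ℤ.∣ ↥ x ∣ * ↧ₙ h)) 0 ℚᵘ.* toℚᵘ h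
  bound (mkℚ a b-1 _) (mkℚ (+ suc p) q-1 _) _ = *≤* (ℤₚ.≤-trans (ℤₚ.*-monoʳ-≤-nonNeg (+ (1 * suc q-1)) (a≤∣a∣ a))
    (ℤₚ.≤-trans (ℤₚ.≤-reflexive (sym (ℤₚ.pos-* ℤ.∣ a ∣ (1 * suc q-1))))
      (ℤₚ.≤-trans (ℤ.+≤+ le) (ℤₚ.≤-reflexive (trans (ℤₚ.pos-* (ℤ.∣ a ∣ * suc q-1 * suc p) (suc b-1)) (cong (λ w → w ℤ.* + suc b-1) (ℤₚ.pos-* (ℤ.∣ a ∣ * suc q-1) (suc p))))))))
    where
    a≤∣a∣ : ∀ a → a ℤ.≤ + ℤ.∣ a ∣
    a≤∣a∣ (+ k)      = ℤₚ.≤-refl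
    a≤∣a∣ (-[1+ k ]) = ℤ.-≤+
    le : ℤ.∣ a ∣ * (1 * suc q-1) ≤ ℤ.∣ a ∣ * suc q-1 * suc p * suc b-1
    le = ≤-trans (≤-reflexive (cong (ℤ.∣ a ∣ *_) (*-identityˡ (suc q-1)))) (≤-trans (m≤m*n _ (suc p)) (m≤m*n _ (suc b-1)))
  bound x (mkℚ (+ zero) q-1 _) (ℚ.*<* (ℤ.+<+ ()))
  bound x (mkℚ -[1+ p ] q-1 _) (ℚ.*<* ())

module _ {x : Cut} (X : IsReal x) where
  open IsReal X
  open Reals X

  -- `located` either moves `s` up by `h` or certifies `s + 2 h` as an upper bound; `m` counts the
  -- steps left before `s` would reach `u₀`. Comparing with `u₀` keeps `u ≤ u₀`.
  narrow : ∀ {u₀ h} → 0ℚ ℚ.< h → Upper x u₀ → ∀ m s → Lower x s → u₀ ℚ.≤ s ℚ.+ m ⊗ h →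
           ∃ λ t → ∃ λ u → Lower x t × Upper x u × s ℚ.≤ t × u ℚ.≤ u₀ × u ℚ.≤ t ℚ.+ (h ℚ.+ h)
  narrow 0<h u₀∈ zero s s∈ u₀≤ = ⊥-elim (ℚₚ.<-irrefl refl (ℚₚ.<-≤-trans (lower<upper s∈ u₀∈) (ℚₚ.≤-trans u₀≤ (ℚₚ.≤-reflexive (ℚₚ.+-identityʳ s)))))
  narrow {u₀} {h} 0<h u₀∈ (suc m) s s∈ u₀≤ with located (s ℚ.+ h) (s ℚ.+ (h ℚ.+ h)) (ℚₚ.+-monoʳ-< s (p<p+h h 0<h))
  ... | inj₁ s+h∈ = let t , u , t∈ , u∈ , s≤t , u≤ , u≤t = narrow 0<h u₀∈ m (s ℚ.+ h) s+h∈ (ℚₚ.≤-trans u₀≤ (ℚₚ.≤-reflexive (sym (ℚₚ.+-assoc s h (m ⊗ h)))))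
    in t , u , t∈ , u∈ , ℚₚ.≤-trans (ℚₚ.<⇒≤ (p<p+h s 0<h)) s≤t , u≤ , u≤t
  ... | inj₂ s+2h∈ with ℚₚ.≤-total u₀ (s ℚ.+ (h ℚ.+ h))
  ... | inj₁ u₀≤s+2h = s , u₀ , s∈ , u₀∈ , ℚₚ.≤-refl , ℚₚ.≤-refl , u₀≤s+2h
  ... | inj₂ s+2h≤u₀ = s , s ℚ.+ (h ℚ.+ h) , s∈ , s+2h∈ , ℚₚ.≤-refl , s+2h≤u₀ , ℚₚ.≤-refl

  enclose : ∀ {s₀ u₀ τ} → 0ℚ ℚ.< τ → Lower x s₀ → Upper x u₀ →
            ∃ λ s → ∃ λ u → Lower x s × Upper x u × s₀ ℚ.≤ s × u ℚ.≤ u₀ × u ℚ.≤ s ℚ.+ τ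
  enclose {s₀} {u₀} {τ} 0<τ s₀∈ u₀∈ =
    let h = ½ ℚ.* τ
        0<h = subst (λ w → w ℚ.< h) (ℚₚ.*-zeroʳ ½) (ℚₚ.*-monoʳ-<-pos ½ 0<τ)
        m , le = archimedean (u₀ ℚ.- s₀) 0<h
        s , u , s∈ , u∈ , s₀≤ , ≤u₀ , close = narrow 0<h u₀∈ m s₀ s₀∈
          (ℚₚ.≤-trans (ℚₚ.≤-reflexive (split u₀ s₀)) (ℚₚ.+-monoʳ-≤ s₀ le))
    in s , u , s∈ , u∈ , s₀≤ , ≤u₀ , ℚₚ.≤-trans close (ℚₚ.≤-reflexive (cong (s ℚ.+_)
         (trans (sym (ℚₚ.*-distribʳ-+ τ ½ ½)) (ℚₚ.*-identityˡ τ))))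
    where
    split : ∀ u s → u ≡ s ℚ.+ (u ℚ.- s)
    split = solve 2 (λ u s → u := s :+ (u :+ :- s)) refl

*-pos : ∀ {p q} → 0ℚ ℚ.< p → 0ℚ ℚ.< q → 0ℚ ℚ.< p ℚ.* q
*-pos {p} {q} 0<p 0<q = subst (λ w → w ℚ.< p ℚ.* q) (ℚₚ.*-zeroˡ q) (ℚₚ.*-monoˡ-<-pos q {{ℚ.positive 0<q}} 0<p)

*ʳ-mono-< : ∀ {p q} r → 0ℚ ℚ.< r → p ℚ.< q → p ℚ.* r ℚ.< q ℚ.* r
*ʳ-mono-< r 0<r = ℚₚ.*-monoˡ-<-pos r {{ℚ.positive 0<r}}

*-mono₂-≤ : ∀ {p q r s} → 0ℚ ℚ.< p → 0ℚ ℚ.< r → p ℚ.≤ q → r ℚ.≤ s → p ℚ.* r ℚ.≤ q ℚ.* s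
*-mono₂-≤ {p} {q} {r} {s} 0<p 0<r p≤q r≤s = ℚₚ.≤-trans
  (ℚₚ.*-monoʳ-≤-nonNeg r {{ℚ.nonNegative (ℚₚ.<⇒≤ 0<r)}} p≤q)
  (ℚₚ.*-monoˡ-≤-nonNeg q {{ℚ.nonNegative (ℚₚ.<⇒≤ (ℚₚ.<-≤-trans 0<p p≤q))}} r≤s)

cancelʳ-< : ∀ {p q} r → 0ℚ ℚ.< r → p ℚ.* r ℚ.< q ℚ.* r → p ℚ.< q
cancelʳ-< r 0<r = ℚₚ.*-cancelʳ-<-nonNeg r {{ℚ.nonNegative (ℚₚ.<⇒≤ 0<r)}}

record Quotient (p q : ℚ) : Set where
  field
    value : ℚ
    exact : value ℚ.* q ≡ p

quotient : ∀ p {q} → 0ℚ ℚ.< q → Quotient p q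
quotient p {q} 0<q = record { value = p ℚ.* inv ; exact = trans (ℚₚ.*-assoc p inv q) (trans (cong (p ℚ.*_) (ℚₚ.*-inverseˡ q)) (ℚₚ.*-identityʳ p)) }
  where
  instance
    q≢0 : ℚ.NonZero q
    q≢0 = ℚₚ.pos⇒nonZero q {{ℚ.positive 0<q}}
  inv = ℚ.1/ q

corners : ∀ {a b c d} → 0ℚ ℚ.< a → 0ℚ ℚ.< c → a ℚ.≤ b → c ℚ.≤ d →
          a ℚ.* c ℚ.≤ ((a ℚ.* c) ⊓ (a ℚ.* d)) ⊓ ((b ℚ.* c) ⊓ (b ℚ.* d))
corners 0<a 0<c a≤b c≤d = ℚₚ.⊓-glb (ℚₚ.⊓-glb ℚₚ.≤-refl (*-mono₂-≤ 0<a 0<c ℚₚ.≤-refl c≤d))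
  (ℚₚ.⊓-glb (*-mono₂-≤ 0<a 0<c a≤b ℚₚ.≤-refl) (*-mono₂-≤ 0<a 0<c a≤b c≤d))

module _ {δ : Cut} (Δ : IsReal δ) where
  open IsReal Δ
  open Reals Δ

  -- A sum of cuts asks for strict bounds on both summands; roundedness gives `t > s` still below
  -- `δ`, and the slack `t - s` goes to the summand 1.
  1-δ-upper : ∀ {s} → Lower δ s → Upper (1ᴿ -ᴿ δ) (1ℚ ℚ.- s)
  1-δ-upper {s} s∈ with to (lower-rounded s) s∈
  ... | t , s<t , t∈ = 1ℚ ℚ.+ (t ℚ.- s) , ℚ.- t , p<p+h 1ℚ (0<⇒<+ s<t) , subst (Lower δ) (sym (neg-involutive t)) t∈ , eq 1ℚ s t
    where
    eq : ∀ o s t → o ℚ.- s ≡ (o ℚ.+ (t ℚ.- s)) ℚ.+ ℚ.- t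
    eq = solve 3 (λ o s t → o :+ :- s := (o :+ (t :+ :- s)) :+ :- t) refl

  1-δ-lower : ∀ {u} → Upper δ u → Lower (1ᴿ -ᴿ δ) (1ℚ ℚ.- u)
  1-δ-lower {u} u∈ with to (upper-rounded u) u∈
  ... | t , t<u , t∈ = 1ℚ ℚ.- (u ℚ.- t) , ℚ.- t , below , subst (Upper δ) (sym (neg-involutive t)) t∈ , eq 1ℚ u t
    where
    eq : ∀ o u t → o ℚ.- u ≡ (o ℚ.- (u ℚ.- t)) ℚ.+ ℚ.- t
    eq = solve 3 (λ o u t → o :+ :- u := (o :+ :- (u :+ :- t)) :+ :- t) refl
    below : 1ℚ ℚ.- (u ℚ.- t) ℚ.< 1ℚ
    below = ℚₚ.<-≤-trans (ℚₚ.+-monoʳ-< 1ℚ (ℚₚ.neg-antimono-< (0<⇒<+ t<u))) (ℚₚ.≤-reflexive (ℚₚ.+-identityʳ 1ℚ))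

1+ε-lower : ∀ {ε κ e} → κ ℚ.< e → Lower ε e → Lower (1ᴿ +ᴿ ε) (1ℚ ℚ.+ κ)
1+ε-lower {ε} {κ} {e} κ<e e∈ = 1ℚ ℚ.+ (κ ℚ.- e) , e , below , e∈ , eq 1ℚ κ e
  where
  eq : ∀ o k e → o ℚ.+ k ≡ (o ℚ.+ (k ℚ.- e)) ℚ.+ e
  eq = solve 3 (λ o k e → o :+ k := (o :+ (k :+ :- e)) :+ e) refl
  below : 1ℚ ℚ.+ (κ ℚ.- e) ℚ.< 1ℚ
  below = ℚₚ.<-≤-trans (ℚₚ.+-monoʳ-< 1ℚ (subst (λ w → κ ℚ.- e ℚ.< w) (ℚₚ.+-inverseʳ e) (ℚₚ.+-monoˡ-< (ℚ.- e) κ<e))) (ℚₚ.≤-reflexive (ℚₚ.+-identityʳ 1ℚ))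

-- With `r` = P/Q, `ratio` is P/(Q-P), the number that `k` has to exceed: a rational version of
-- (1-δ)/δ.
record Exponent (δ ε : Cut) (0<δ : 0ᴿ <ᴿ δ) : Set where
  field
    r      : ℚ
    0<r    : 0ℚ ℚ.< r
    r<1    : r ℚ.< 1ℚ
    upper  : Upper (1ᴿ -ᴿ δ) r
    ratio  : ℚ
    exact  : ratio ℚ.* (1ℚ ℚ.- r) ≡ r
    lower  : Lower (divide ((1ᴿ +ᴿ ε) *ᴿ (1ᴿ -ᴿ δ)) δ 0<δ) ratio

-- With s < δ < u close together, r = 1 - s lies above 1 - δ, while r / (1 - r) = (1 - s) / s
-- is still below (1 + κ) (1 - u) / u for a positive κ < ε.
exponent : ∀ {δ ε} → IsReal δ → IsReal ε → (0<δ : 0ᴿ <ᴿ δ) → δ <ᴿ 1ᴿ → 0ᴿ <ᴿ ε → Exponent δ ε 0<δ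
exponent {δ} {ε} Δ E 0<δ@(s₀ , 0<s₀ , s₀∈) (u₀ , u₀∈ , u₀<1) (e , 0<e , e∈) = record
  { r = 1ℚ ℚ.- s ; 0<r = 0<⇒<+ s<1 ; r<1 = r<1 ; upper = 1-δ-upper Δ s∈
  ; ratio = B ; exact = trans (cong (B ℚ.*_) (1-[1-s] 1ℚ s)) B*s
  ; lower = α , β , γ , ζ , (α∈ , β∈ , γ∈ , ζ∈) , ℚₚ.<-≤-trans B<αγ (corners 0<α 0<γ α≤β γ≤ζ) }
  where
  open Reals Δ
  1-[1-s] : ∀ o s → o ℚ.- (o ℚ.- s) ≡ s
  1-[1-s] = solve 2 (λ o s → o :+ :- (o :+ :- s) := s) refl
  κ-dense = ℚₚ.<-dense 0<e
  κ = proj₁ κ-dense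
  0<κ : 0ℚ ℚ.< κ
  0<κ = proj₁ (proj₂ κ-dense)
  κ<e : κ ℚ.< e
  κ<e = proj₂ (proj₂ κ-dense)
  0<1-u₀ : 0ℚ ℚ.< 1ℚ ℚ.- u₀
  0<1-u₀ = 0<⇒<+ u₀<1
  -- Multiplied by `s`, the aim `B * u < A` becomes `u < s + κ * s * (1 - u)`. The width `τ` lies
  -- below `κ * s₀ * (1 - u₀)`, a lower bound for the last term that is available before `s` and `u`
  -- are.
  τ-dense = ℚₚ.<-dense (*-pos (*-pos 0<κ 0<s₀) 0<1-u₀)
  τ = proj₁ τ-dense
  enclosure = enclose Δ (proj₁ (proj₂ τ-dense)) s₀∈ u₀∈
  s = proj₁ enclosure
  u = proj₁ (proj₂ enclosure)
  s∈ : Lower δ s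
  s∈ = proj₁ (proj₂ (proj₂ enclosure))
  u∈ : Upper δ u
  u∈ = proj₁ (proj₂ (proj₂ (proj₂ enclosure)))
  s₀≤s : s₀ ℚ.≤ s
  s₀≤s = proj₁ (proj₂ (proj₂ (proj₂ (proj₂ enclosure))))
  u≤u₀ : u ℚ.≤ u₀
  u≤u₀ = proj₁ (proj₂ (proj₂ (proj₂ (proj₂ (proj₂ enclosure)))))
  u≤s+τ : u ℚ.≤ s ℚ.+ τ
  u≤s+τ = proj₂ (proj₂ (proj₂ (proj₂ (proj₂ (proj₂ enclosure)))))
  s<u : s ℚ.< u
  s<u = lower<upper s∈ u∈
  u<1 : u ℚ.< 1ℚ
  u<1 = ℚₚ.≤-<-trans u≤u₀ u₀<1
  s<1 : s ℚ.< 1ℚ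
  s<1 = ℚₚ.<-trans s<u u<1
  0<s : 0ℚ ℚ.< s
  0<s = ℚₚ.<-≤-trans 0<s₀ s₀≤s
  0<u : 0ℚ ℚ.< u
  0<u = ℚₚ.<-trans 0<s s<u
  0<1-u : 0ℚ ℚ.< 1ℚ ℚ.- u
  0<1-u = 0<⇒<+ u<1
  r<1 : 1ℚ ℚ.- s ℚ.< 1ℚ
  r<1 = ℚₚ.<-≤-trans (ℚₚ.+-monoʳ-< 1ℚ (ℚₚ.neg-antimono-< 0<s)) (ℚₚ.≤-reflexive (ℚₚ.+-identityʳ 1ℚ))
  0<1+κ : 0ℚ ℚ.< 1ℚ ℚ.+ κ
  0<1+κ = ℚₚ.<-trans 0<1 (p<p+h 1ℚ 0<κ)
  A = (1ℚ ℚ.+ κ) ℚ.* (1ℚ ℚ.- u)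
  quot-B = quotient (1ℚ ℚ.- s) 0<s
  B = Quotient.value quot-B
  B*s : B ℚ.* s ≡ 1ℚ ℚ.- s
  B*s = Quotient.exact quot-B
  u<s+ : u ℚ.< s ℚ.+ κ ℚ.* s ℚ.* (1ℚ ℚ.- u)
  u<s+ = ℚₚ.≤-<-trans u≤s+τ (ℚₚ.+-monoʳ-< s (ℚₚ.<-≤-trans (proj₂ (proj₂ τ-dense))
    (*-mono₂-≤ (*-pos 0<κ 0<s₀) 0<1-u₀ (*-mono₂-≤ 0<κ 0<s₀ ℚₚ.≤-refl s₀≤s) (ℚₚ.+-monoʳ-≤ 1ℚ (ℚₚ.neg-antimono-≤ u≤u₀)))))
  B*u<A : B ℚ.* u ℚ.< A
  B*u<A = cancelʳ-< s 0<s (subst₂ ℚ._<_ (trans (eq₁ s u) (sym (trans (eq₂ B u s) (cong (ℚ._* u) B*s)))) (eq₃ s u κ)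
    (ℚₚ.+-monoˡ-< (ℚ.- (s ℚ.* u)) u<s+))
    where
    eq₁ : ∀ s u → u ℚ.+ ℚ.- (s ℚ.* u) ≡ (1ℚ ℚ.- s) ℚ.* u
    eq₁ = solve 2 (λ s u → u :+ :- (s :* u) := (con 1ℚ :+ :- s) :* u) refl
    eq₂ : ∀ B u s → B ℚ.* u ℚ.* s ≡ B ℚ.* s ℚ.* u
    eq₂ = solve 3 (λ B u s → B :* u :* s := B :* s :* u) refl
    eq₃ : ∀ s u k → (s ℚ.+ k ℚ.* s ℚ.* (1ℚ ℚ.- u)) ℚ.+ ℚ.- (s ℚ.* u) ≡ (1ℚ ℚ.+ k) ℚ.* (1ℚ ℚ.- u) ℚ.* s
    eq₃ = solve 3 (λ s u k → (s :+ k :* s :* (con 1ℚ :+ :- u)) :+ :- (s :* u) := (con 1ℚ :+ k) :* (con 1ℚ :+ :- u) :* s) refl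
  -- `B < A / u` is split into `α < A` and `γ < 1 / u` with `B < α * γ`, because lower bounds of a
  -- product of cuts are built from strict bounds of its factors.
  α-dense = ℚₚ.<-dense B*u<A
  α = proj₁ α-dense
  B*u<α : B ℚ.* u ℚ.< α
  B*u<α = proj₁ (proj₂ α-dense)
  α<A : α ℚ.< A
  α<A = proj₂ (proj₂ α-dense)
  0<B : 0ℚ ℚ.< B
  0<B = cancelʳ-< s 0<s (subst₂ ℚ._<_ (sym (ℚₚ.*-zeroˡ s)) (sym B*s) (0<⇒<+ s<1))
  0<α : 0ℚ ℚ.< α
  0<α = ℚₚ.<-trans (*-pos 0<B 0<u) B*u<α
  quot-γ = quotient B 0<α
  quot-u = quotient 1ℚ 0<u
  γ-dense = ℚₚ.<-dense {Quotient.value quot-γ} {Quotient.value quot-u} (cancelʳ-< (α ℚ.* u) (*-pos 0<α 0<u) (subst₂ ℚ._<_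
    (trans (cong (ℚ._* u) (sym (Quotient.exact quot-γ))) (ℚₚ.*-assoc (Quotient.value quot-γ) α u))
    (sym (trans (eq (Quotient.value quot-u) α u) (trans (cong (α ℚ.*_) (Quotient.exact quot-u)) (ℚₚ.*-identityʳ α))))
    B*u<α))
    where
    eq : ∀ v a u → v ℚ.* (a ℚ.* u) ≡ a ℚ.* (v ℚ.* u)
    eq = solve 3 (λ v a u → v :* (a :* u) := a :* (v :* u)) refl
  γ = proj₁ γ-dense
  B<αγ : B ℚ.< α ℚ.* γ
  B<αγ = subst₂ ℚ._<_ (Quotient.exact quot-γ) (ℚₚ.*-comm γ α) (*ʳ-mono-< α 0<α (proj₁ (proj₂ γ-dense)))
  γ*u<1 : γ ℚ.* u ℚ.< 1ℚ
  γ*u<1 = subst (λ w → γ ℚ.* u ℚ.< w) (Quotient.exact quot-u) (*ʳ-mono-< u 0<u (proj₂ (proj₂ γ-dense)))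
  0<γ : 0ℚ ℚ.< γ
  0<γ = cancelʳ-< α 0<α (subst₂ ℚ._<_ (sym (ℚₚ.*-zeroˡ α)) (ℚₚ.*-comm α γ) (ℚₚ.<-trans 0<B B<αγ))
  -- A product of cuts asks for a whole box; `ζ` and `β` close it from above and may be crude.
  quot-s = quotient 1ℚ 0<s
  ζ = Quotient.value quot-s ℚ.+ 1ℚ
  1<ζ*s : 1ℚ ℚ.< ζ ℚ.* s
  1<ζ*s = subst (λ w → 1ℚ ℚ.< w) (sym (trans (ℚₚ.*-distribʳ-+ s (Quotient.value quot-s) 1ℚ) (cong₂ ℚ._+_ (Quotient.exact quot-s) (ℚₚ.*-identityˡ s)))) (p<p+h 1ℚ 0<s)
  γ≤ζ : γ ℚ.≤ ζ
  γ≤ζ = ℚₚ.<⇒≤ (cancelʳ-< s 0<s (ℚₚ.≤-<-trans (*-mono₂-≤ 0<γ 0<s ℚₚ.≤-refl (ℚₚ.<⇒≤ s<u)) (ℚₚ.<-trans γ*u<1 1<ζ*s)))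
  γ∈ : Lower (recip δ 0<δ) γ
  γ∈ = u , u∈ , γ*u<1
  ζ∈ : Upper (recip δ 0<δ) ζ
  ζ∈ = s , s∈ , 0<s , 1<ζ*s
  e′ = proj₁ (IsReal.upper-inhabited E)
  e′∈ : Upper ε e′
  e′∈ = proj₂ (IsReal.upper-inhabited E)
  b = (1ℚ ℚ.+ 1ℚ) ℚ.+ e′
  1+κ≤b : 1ℚ ℚ.+ κ ℚ.≤ b
  1+κ≤b = ℚₚ.+-mono-≤ (ℚₚ.<⇒≤ (p<p+h 1ℚ 0<1)) (ℚₚ.<⇒≤ (ℚₚ.<-trans κ<e (Reals.lower<upper E e∈ e′∈)))
  1-u≤1-s : 1ℚ ℚ.- u ℚ.≤ 1ℚ ℚ.- s
  1-u≤1-s = ℚₚ.+-monoʳ-≤ 1ℚ (ℚₚ.neg-antimono-≤ (ℚₚ.<⇒≤ s<u))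
  b∈ : Upper (1ᴿ +ᴿ ε) b
  b∈ = 1ℚ ℚ.+ 1ℚ , e′ , p<p+h 1ℚ 0<1 , e′∈ , refl
  max = (((1ℚ ℚ.+ κ) ℚ.* (1ℚ ℚ.- u)) ⊔ ((1ℚ ℚ.+ κ) ℚ.* (1ℚ ℚ.- s))) ⊔ ((b ℚ.* (1ℚ ℚ.- u)) ⊔ (b ℚ.* (1ℚ ℚ.- s)))
  β = max ℚ.+ 1ℚ
  max<β : max ℚ.< β
  max<β = p<p+h max 0<1
  α≤β : α ℚ.≤ β
  α≤β = ℚₚ.≤-trans (ℚₚ.<⇒≤ α<A) (ℚₚ.≤-trans (ℚₚ.≤-trans (ℚₚ.p≤p⊔q A _) (ℚₚ.p≤p⊔q _ _)) (ℚₚ.<⇒≤ max<β))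
  α∈ : Lower ((1ᴿ +ᴿ ε) *ᴿ (1ᴿ -ᴿ δ)) α
  α∈ = 1ℚ ℚ.+ κ , b , 1ℚ ℚ.- u , 1ℚ ℚ.- s , (1+ε-lower {ε} κ<e e∈ , b∈ , 1-δ-lower Δ u∈ , 1-δ-upper Δ s∈) ,
    ℚₚ.<-≤-trans α<A (corners 0<1+κ 0<1-u 1+κ≤b 1-u≤1-s)
  β∈ : Upper ((1ᴿ +ᴿ ε) *ᴿ (1ᴿ -ᴿ δ)) β
  β∈ = 1ℚ ℚ.+ κ , b , 1ℚ ℚ.- u , 1ℚ ℚ.- s , (1+ε-lower {ε} κ<e e∈ , b∈ , 1-δ-lower Δ u∈ , 1-δ-upper Δ s∈) , max<β

-- From cuts to inequalities between natural numbers

ι : ℤ → ℚ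
ι z = z ℚ./ 1

ι-toℚᵘ : ∀ z → toℚᵘ (ι z) ℚᵘ.≃ mkℚᵘ z 0
ι-toℚᵘ z = ℚₚ.toℚᵘ-fromℚᵘ (mkℚᵘ z 0)

ι-* : ∀ a b → ι a ℚ.* ι b ≡ ι (a ℤ.* b)
ι-* a b = ℚₚ.toℚᵘ-injective (ℚᵘₚ.≃-trans (ℚₚ.toℚᵘ-homo-* (ι a) (ι b))
  (ℚᵘₚ.≃-trans (ℚᵘₚ.*-cong (ι-toℚᵘ a) (ι-toℚᵘ b)) (ℚᵘₚ.≃-sym (ι-toℚᵘ (a ℤ.* b)))))

ι-+ : ∀ a b → ι a ℚ.+ ι b ≡ ι (a ℤ.+ b)
ι-+ a b = ℚₚ.toℚᵘ-injective (ℚᵘₚ.≃-trans (ℚₚ.toℚᵘ-homo-+ (ι a) (ι b))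
  (ℚᵘₚ.≃-trans (ℚᵘₚ.+-cong (ι-toℚᵘ a) (ι-toℚᵘ b))
  (ℚᵘₚ.≃-trans (*≡* (cong (ℤ._* + 1) (cong₂ ℤ._+_ (ℤₚ.*-identityʳ a) (ℤₚ.*-identityʳ b)))) (ℚᵘₚ.≃-sym (ι-toℚᵘ (a ℤ.+ b))))))

ι-mono-< : ∀ {a b} → a ℤ.< b → ι a ℚ.< ι b
ι-mono-< {a} {b} a<b = ℚₚ.toℚᵘ-cancel-< (ℚᵘₚ.<-respˡ-≃ (ℚᵘₚ.≃-sym (ι-toℚᵘ a)) (ℚᵘₚ.<-respʳ-≃ (ℚᵘₚ.≃-sym (ι-toℚᵘ b))
  (*<* (subst₂ ℤ._<_ (sym (ℤₚ.*-identityʳ a)) (sym (ℤₚ.*-identityʳ b)) a<b))))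

ι-^ : ∀ m k → ι (+ m) ^ℚ k ≡ ι (+ (m ^ k))
ι-^ m zero    = refl
ι-^ m (suc k) = trans (cong (ι (+ m) ℚ.*_) (ι-^ m k)) (trans (ι-* (+ m) (+ (m ^ k))) (cong ι (sym (ℤₚ.pos-* m (m ^ k)))))

↥-pos : ∀ r → 0ℚ ℚ.< r → ↥ r ≡ + ℤ.∣ ↥ r ∣
↥-pos (mkℚ (+ _) _ _)    _ = refl
↥-pos (mkℚ -[1+ _ ] _ _) (ℚ.*<* ())

↥<↧ : ∀ r → 0ℚ ℚ.< r → r ℚ.< 1ℚ → ℤ.∣ ↥ r ∣ < ↧ₙ r
↥<↧ (mkℚ (+ p) q _)    _ (ℚ.*<* p<q) = ℤₚ.drop‿+<+ (subst₂ ℤ._<_ (ℤₚ.*-identityʳ (+ p)) (ℤₚ.*-identityˡ (+ suc q)) p<q)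
↥<↧ (mkℚ -[1+ _ ] _ _) (ℚ.*<* ()) _

clear-denominators : ∀ r c → r ℚ.< ι c ℚ.* (1ℚ ℚ.- r) → ↥ r ℤ.< c ℤ.* (↧ r ℤ.- ↥ r)
clear-denominators r@(mkℚ p q _) c r< with ℚᵘₚ.<-respʳ-≃ rhs (ℚₚ.toℚᵘ-mono-< r<)
  where
  rhs : toℚᵘ (ι c ℚ.* (1ℚ ℚ.- r)) ℚᵘ.≃ mkℚᵘ c 0 ℚᵘ.* (mkℚᵘ (+ 1) 0 ℚᵘ.+ ℚᵘ.- toℚᵘ r)
  rhs = ℚᵘₚ.≃-trans (ℚₚ.toℚᵘ-homo-* (ι c) (1ℚ ℚ.- r)) (ℚᵘₚ.*-cong (ι-toℚᵘ c)
    (ℚᵘₚ.≃-trans (ℚₚ.toℚᵘ-homo-+ 1ℚ (ℚ.- r)) (ℚᵘₚ.+-congʳ (mkℚᵘ (+ 1) 0) (ℚₚ.toℚᵘ-homo‿- r))))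
... | *<* h = ℤₚ.*-cancelʳ-<-nonNeg (+ suc q) (subst₂ ℤ._<_
    (cong (λ w → p ℤ.* + suc w) (trans (+-identityʳ (q + 0)) (+-identityʳ q))) (cong (ℤ._* + suc q) (lem c p (+ suc q))) h)
  where
  lem : ∀ c p q → c ℤ.* (+ 1 ℤ.* q ℤ.+ ℤ.- p ℤ.* + 1) ≡ c ℤ.* (q ℤ.+ ℤ.- p)
  lem = ℤ-Solver.solve-∀

-- The fraction P/D lies strictly below the integer `c`, so rounding it down and adding one stays
-- within `c`, also when `D` divides `P`.
ceiling-lower : ∀ P D .{{_ : NonZero D}} c → + P ℤ.< c ℤ.* + D → + suc (P / D) ℤ.≤ c
ceiling-lower P D (+ k)    h = ℤ.+≤+ (m<n*o⇒m/o<n (ℤₚ.drop‿+<+ (subst (λ w → + P ℤ.< w) (sym (ℤₚ.pos-* k D)) h)))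
ceiling-lower P (suc D) -[1+ k ] ()

-- `k` is the least number with `P < k * (Q ∸ P)`; rearranged, this leaves a whole factor `n`
-- against the powers of `L` in `parameters`.
exponent-gap : ∀ P Q .{{_ : NonZero (Q ∸ P)}} → P ≤ Q → let k = suc (P / (Q ∸ P)) in P + k * P + 1 ≤ k * Q
exponent-gap P Q P≤Q = begin
  P + k * P + 1          ≡⟨ lem P (k * P) ⟩
  k * P + suc P          ≤⟨ +-monoʳ-≤ (k * P) P<kD ⟩
  k * P + k * (Q ∸ P)    ≡⟨ *-distribˡ-+ k P (Q ∸ P) ⟨
  k * (P + (Q ∸ P))      ≡⟨ cong (k *_) (m+[n∸m]≡n P≤Q) ⟩
  k * Q                  ∎
  where
  open ≤-Reasoning
  k = suc (P / (Q ∸ P))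
  lem : ∀ P kP → P + kP + 1 ≡ kP + (1 + P)
  lem = solve-∀
  P<kD : P < k * (Q ∸ P)
  P<kD = ≤-trans (s≤s (≤-reflexive (m≡m%n+[m/n]*n P (Q ∸ P)))) (+-monoˡ-≤ (P / (Q ∸ P) * (Q ∸ P)) (m%n<n P (Q ∸ P)))

floor-root : ∀ Q .{{_ : NonZero Q}} x b → x < suc b ^ Q → ∃ λ τ → τ ^ Q ≤ x × x < suc τ ^ Q
floor-root Q x b x< with b ^ Q ≤? x
... | yes p = b , p , x<
floor-root Q       x (suc b) x< | no ¬p = floor-root Q x b (≰⇒> ¬p)
floor-root (suc Q) x zero    x< | no ¬p = ⊥-elim (¬p z≤n)

-- Rounding the root up at most doubles it, except from 0 to 1, where `n` being positive suffices.
suc-root : ∀ Q n τ P → τ ^ Q ≤ n ^ P → 0 < n → suc τ ^ Q ≤ 2 ^ Q * n ^ P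
suc-root Q n zero    P h n>0 = ≤-trans (≤-reflexive (^-zeroˡ Q)) (*-mono-≤ (m^n>0 2 Q) (m^n>0 n {{ℕ.>-nonZero n>0}} P))
suc-root Q n (suc τ) P h n>0 = ≤-trans (^-monoˡ-≤ Q (suc≤2* {suc τ} (s≤s z≤n)))
  (≤-trans (≤-reflexive (^-distrib-* 2 (suc τ) Q)) (*-monoʳ-≤ (2 ^ Q) h))

-- T bounds n ^ (1 - δ) from above, because T ^ Q > n ^ P and P / Q = r > 1 - δ.
degree-bound : ∀ {δ r} n m T → 0ℚ ℚ.< r → Upper (1ᴿ -ᴿ δ) r → 0 < T → n ^ ℤ.∣ ↥ r ∣ < T ^ ↧ₙ r →
               fromℚ (+ n ℚ./ 3) -ᴿ n ^ᴿ (1ᴿ -ᴿ δ) ≤ᴿ fromℤ (+ m) → n ≤ 3 * (m + T)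
-- If `3 * (m + T) < n`, then `m = (m + T) - T` is in the lower cut of the left side of `hyp`, which
-- yields `m < m`.
degree-bound {δ} {r} n m T 0<r upper 0<T n^P< hyp = ≮⇒≥ λ lt → ℚₚ.<-irrefl refl
  (hyp {ι (+ m)} (ι (+ (m + T)) , ℚ.- ι (+ T) , below lt , T∈ , difference))
  where
  below : 3 * (m + T) < n → ι (+ (m + T)) ℚ.< + n ℚ./ 3
  below lt = ℚₚ.toℚᵘ-cancel-< (ℚᵘₚ.<-respˡ-≃ (ℚᵘₚ.≃-sym (ι-toℚᵘ (+ (m + T)))) (ℚᵘₚ.<-respʳ-≃ (ℚᵘₚ.≃-sym (ℚₚ.toℚᵘ-fromℚᵘ (mkℚᵘ (+ n) 2)))
    (*<* (subst₂ ℤ._<_ (trans (cong +_ (*-comm 3 (m + T))) (ℤₚ.pos-* (m + T) 3)) (sym (ℤₚ.*-identityʳ (+ n))) (ℤ.+<+ lt)))))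
  T∈ : Upper (n ^ᴿ (1ᴿ -ᴿ δ)) (ℚ.- (ℚ.- ι (+ T)))
  T∈ = subst (Upper (n ^ᴿ (1ᴿ -ᴿ δ))) (sym (neg-involutive (ι (+ T))))
    (r , upper , ι-mono-< (ℤ.+<+ 0<T) , subst (PowAbove (ι (+ T)) (↧ₙ r) n) (sym (↥-pos r 0<r))
      (subst (λ w → ι (+ (n ^ ℤ.∣ ↥ r ∣)) ℚ.< w) (sym (ι-^ T (↧ₙ r))) (ι-mono-< (ℤ.+<+ n^P<))))
  difference : ι (+ m) ≡ ι (+ (m + T)) ℚ.+ ℚ.- ι (+ T)
  difference = sym (trans (cong (ℚ._+ ℚ.- ι (+ T)) (sym (ι-+ (+ m) (+ T)))) (trans (ℚₚ.+-assoc (ι (+ m)) (ι (+ T)) _)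
    (trans (cong (ι (+ m) ℚ.+_) (ℚₚ.+-inverseʳ (ι (+ T)))) (ℚₚ.+-identityʳ (ι (+ m))))))

χ-bound-above : ∀ C → 32 ^ 252 ≤ C → 76 ≤ C → (δ ε : Cut) (0<δ : 0ᴿ <ᴿ δ) → Exponent δ ε 0<δ →
  ∃[ N ] ((n : ℕ) → N ≤ n → (G : Graph n) → TriangleFree G →
  fromℚ (+ n ℚ./ 3) -ᴿ n ^ᴿ (1ᴿ -ᴿ δ) ≤ᴿ fromℤ (+ minDegree G) →
  (c : ℤ) → IsCeiling (divide ((1ᴿ +ᴿ ε) *ᴿ (1ᴿ -ᴿ δ)) δ 0<δ) c →
  + χ G ℤ.≤ + C ℤ.+ + 1 ℤ.+ c)
-- The added 1 makes `n` positive.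
χ-bound-above C 32^252≤C 76≤C δ ε 0<δ E = N + 1 , bound
  where
  open Exponent E
  P Q D k N : ℕ
  P = ℤ.∣ ↥ r ∣
  Q = ↧ₙ r
  D = Q ∸ P
  P<Q : P < Q
  P<Q = ↥<↧ r 0<r r<1
  instance
    D≢0 : NonZero D
    D≢0 = ℕ.>-nonZero (m<n⇒0<n∸m P<Q)
  k = suc (P / D)
  params : ∃ λ N → ∀ n → N ≤ n → ∀ T → 1 ≤ T → T ^ Q ≤ 2 ^ Q * n ^ P → Parameters k n T
  params = parameters P Q k (exponent-gap P Q (<⇒≤ P<Q))
  N = proj₁ params
  k≤c : ∀ c → divide ((1ᴿ +ᴿ ε) *ᴿ (1ᴿ -ᴿ δ)) δ 0<δ ≤ᴿ fromℤ c → + k ℤ.≤ c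
  k≤c c V≤c = ceiling-lower P D c (subst₂ ℤ._<_ (↥-pos r 0<r) (cong (c ℤ.*_) Q-P)
    (clear-denominators r c (subst (ℚ._< ι c ℚ.* (1ℚ ℚ.- r)) exact (*ʳ-mono-< (1ℚ ℚ.- r) (0<⇒<+ r<1) (V≤c lower)))))
    where
    Q-P : ↧ r ℤ.- ↥ r ≡ + D
    Q-P = trans (cong (λ w → + Q ℤ.- w) (↥-pos r 0<r)) (trans (ℤₚ.m-n≡m⊖n Q P) (ℤₚ.⊖-≥ (<⇒≤ P<Q)))
  bound : (n : ℕ) → N + 1 ≤ n → (G : Graph n) → TriangleFree G →
    fromℚ (+ n ℚ./ 3) -ᴿ n ^ᴿ (1ᴿ -ᴿ δ) ≤ᴿ fromℤ (+ minDegree G) →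
    (c : ℤ) → IsCeiling (divide ((1ᴿ +ᴿ ε) *ᴿ (1ᴿ -ᴿ δ)) δ 0<δ) c →
    + χ G ℤ.≤ + C ℤ.+ + 1 ℤ.+ c
  bound n N<n G no△ degrees c (V≤c , _) = ℤₚ.≤-trans (ℤ.+≤+ χ≤) (ℤₚ.+-monoʳ-≤ (+ C ℤ.+ + 1) (k≤c c V≤c))
    where
    approx : ∃ λ τ → τ ^ Q ≤ n ^ P × n ^ P < suc τ ^ Q
    approx = floor-root Q (n ^ P) (n ^ P)
      (≤-trans (≤-reflexive (sym (^-identityʳ (suc (n ^ P))))) (^-monoʳ-≤ (suc (n ^ P)) (ℕ.>-nonZero⁻¹ Q)))
    τ : ℕ
    τ = proj₁ approx
    n>0 : 0 < n
    n>0 = ≤-trans (m≤n+m 1 N) N<n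
    χ≤ : χ G ≤ C + 1 + k
    χ≤ = χ-bound G C k (suc τ) 32^252≤C 76≤C no△
      (degree-bound {δ} {r} n (minDegree G) (suc τ) 0<r upper (s≤s z≤n) (proj₂ (proj₂ approx)) degrees) n>0
      (proj₂ params n (≤-trans (m≤m+n N 1) N<n) (suc τ) (s≤s z≤n) (suc-root Q n τ P (proj₁ (proj₂ approx)) n>0))

theorem1p5 : (δ ε : Cut) → IsReal δ → IsReal ε →
    (0<δ : 0ᴿ <ᴿ δ) → δ <ᴿ 1ᴿ → 0ᴿ <ᴿ ε →
    ∃[ N ] ((n : ℕ) → N ≤ n → (G : Graph n) → TriangleFree G →
    fromℚ (+ n ℚ./ 3) -ᴿ n ^ᴿ (1ᴿ -ᴿ δ) ≤ᴿ fromℤ (+ minDegree G) →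
    (c : ℤ) → IsCeiling (divide ((1ᴿ +ᴿ ε) *ᴿ (1ᴿ -ᴿ δ)) δ 0<δ) c →
    + χ G ℤ.≤ + (10 ^ 391) ℤ.+ + 1 ℤ.+ c)
-- `32 ^ 252` is `2 ^ 1260`, a number of 380 decimal digits.
theorem1p5 δ ε Δ E 0<δ δ<1 0<ε = χ-bound-above (10 ^ 391) (≤ᵇ⇒≤ (32 ^ 252) (10 ^ 391) _) (≤ᵇ⇒≤ 76 (10 ^ 391) _)
  δ ε 0<δ (exponent Δ E 0<δ δ<1 0<ε)
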